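{- For every ordinal $\alpha>2$ (infinite included), every finite $k\ge1$ and every $r\in\omega$, there is an algebra $\mathfrak A^r\in\mathfrak{Nr}_\alpha\mathsf{CA}_{\alpha+k}\setminus S\mathfrak{Nr}_\alpha\mathsf{CA}_{\alpha+k+1}$ such that $\prod_{r\in\omega}\mathfrak A^r/F\in\mathsf{RCA}_\alpha$ for any non-principal ultrafilter $F$ on $\omega$. In particular, the variety $S\mathfrak{Nr}_\alpha\mathsf{CA}_{\alpha+k+1}$ is not axiomatizable by a finite schema over $S\mathfrak{Nr}_\alpha\mathsf{CA}_{\alpha+k}$.
   Context: For an ordinal $\alpha$, $\mathsf{CA}_\alpha$ is the class of cylindric algebras of dimension $\alpha$. For $\alpha\le\beta$ and $\mathfrak B\in\mathsf{CA}_\beta$, the neat reduct $\mathfrak{Nr}_\alpha\mathfrak B\in\mathsf{CA}_\alpha$ has universe $\{b\in B:c_ib=b\text{ for all }\alpha\le i<\beta\}$ and the operations of $\mathfrak B$ with indices $<\alpha$; $\mathfrak{Nr}_\alpha\mathsf{CA}_\beta$ is the class of (isomorphic copies of) all such algebras, and $S$ is closure under subalgebras. $\mathsf{RCA}_\alpha$ is the class of representable algebras, i.e. those isomorphic to subalgebras of direct products of cylindric set algebras of dimension $\alpha$. "Axiomatizable by a finite schema over" means, for finite $\alpha$, by finitely many equations added; for infinite $\alpha$, by all instances of finitely many equation schemes added, an instance of a scheme (an equation in the signature of $\mathsf{CA}_\omega$) being obtained by replacing the finitely many indices occurring in it by indices $<\alpha$ via an injective map. -}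

module Defs where

open import Level using (Level; Setω; _⊔_; suc; 0ℓ)
open import Data.Nat.Base using (ℕ)
open import Data.Fin.Base as Fin using (Fin)
import Data.Fin.Properties as Fin
import Data.Fin.Induction as Fin
open import Data.List.Base using (List; []; _∷_; _++_)
open import Data.List.Membership.Propositional using (_∈_)
open import Data.List.Relation.Unary.All using (All)
open import Data.Product using (Σ; ∃; _×_; _,_; proj₁; proj₂)
open import Data.Sum.Base using (_⊎_; inj₁; inj₂)
open import Data.Sum.Relation.Binary.LeftOrder
  using (_⊎-<_; ₁∼₁; ⊎-<-transitive; ⊎-<-trichotomous; ⊎-<-wellFounded)
open import Data.Sum.Relation.Binary.Pointwise using (Pointwise-≡⇒≡; ≡⇒Pointwise-≡)
open import Algebra.Core using (Op₁; Op₂)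
open import Algebra.Lattice.Bundles using (BooleanAlgebra)
open import Algebra.Lattice.Structures using (IsBooleanAlgebra)
import Algebra.Lattice.Properties.BooleanAlgebra as BooleanAlgebraProperties
open import Axiom.ExcludedMiddle using (ExcludedMiddle)
open import Function.Base using (_∘_; id)
open import Function.Bundles using (Func; Surjection; _↔_; _⇔_)
open import Function.Definitions using (Congruent; Injective; Surjective)
open import Induction.WellFounded using (WellFounded)
open import Relation.Binary.Bundles using (Setoid)
open import Relation.Binary.Core using (Rel)
open import Relation.Binary.Definitions using (Trichotomous; tri<; tri≈; tri>)
open import Relation.Binary.Structures using (IsStrictTotalOrder)
import Relation.Binary.Structures.Biased as Biased
open import Relation.Binary.PropositionalEquality
  using (_≡_; _≢_; refl; sym; cong; isEquivalence)
import Relation.Binary.Reasoning.Setoid as SetoidReasoning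
open import Relation.Nullary.Negation using (¬_)
open import Relation.Unary using (Pred; _⊆_; _≐_; _∩_; _∪_; ∁)
open import Relation.Unary.Polymorphic using (∅; U)

private
  variable
    a b c c′ e e′ ℓ p : Level

------------------------------------------------------------------------
-- Classical foundations

-- The ambient theory is ZFC.  Types do not have quotients, so the axiom of
-- choice is stated for setoids: every surjection has a section that
-- respects the equalities.

record Classical : Setω where
  field
    excludedMiddle : ∀ ℓ → ExcludedMiddle ℓ
    choice : ∀ {a b c d} (S : Setoid a b) (T : Setoid c d) (f : Surjection S T) →
             Σ (Func T S) λ g →
             ∀ y → Setoid._≈_ T (Surjection.to f (Func.to g y)) y

------------------------------------------------------------------------
-- Ordinals

record Ordinal ℓ : Set (suc ℓ) where
  infix 4 _<_
  field
    Carrier            : Set ℓ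
    _<_                : Rel Carrier ℓ
    isStrictTotalOrder : IsStrictTotalOrder _≡_ _<_
    wellFounded        : WellFounded _<_

∣_∣ : Ordinal ℓ → Set ℓ
∣_∣ = Ordinal.Carrier

fin : ℕ → Ordinal 0ℓ
fin n = record
  { Carrier            = Fin n
  ; _<_                = Fin._<_
  ; isStrictTotalOrder = Fin.<-isStrictTotalOrder
  ; wellFounded        = Fin.<-wellFounded
  }

infixl 6 _+ₒ_

_+ₒ_ : Ordinal a → Ordinal b → Ordinal (a ⊔ b)
α +ₒ β = record
  { Carrier            = ∣ α ∣ ⊎ ∣ β ∣
  ; _<_                = α._<_ ⊎-< β._<_
  ; isStrictTotalOrder = Biased.isStrictTotalOrderᶜ record
      { isEquivalence = isEquivalence
      ; trans         = ⊎-<-transitive (STO.trans α.isStrictTotalOrder)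
                                       (STO.trans β.isStrictTotalOrder)
      ; compare       = compare
      }
  ; wellFounded        = ⊎-<-wellFounded α.wellFounded β.wellFounded
  }
  where
  module α = Ordinal α
  module β = Ordinal β
  module STO = IsStrictTotalOrder

  compare : Trichotomous _≡_ (α._<_ ⊎-< β._<_)
  compare x y with ⊎-<-trichotomous (STO.compare α.isStrictTotalOrder)
                                    (STO.compare β.isStrictTotalOrder) x y
  ... | tri< x<y x≉y x≯y = tri< x<y (x≉y ∘ ≡⇒Pointwise-≡) x≯y
  ... | tri≈ x≮y x≈y x≯y = tri≈ x≮y (Pointwise-≡⇒≡ x≈y) x≯y
  ... | tri> x≮y x≉y x>y = tri> x≮y (x≉y ∘ ≡⇒Pointwise-≡) x>y

-- α ≤ β: α is isomorphic to an initial segment of β.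

infix 4 _≤ₒ_ _<ₒ_

record _≤ₒ_ (α : Ordinal a) (β : Ordinal b) : Set (a ⊔ b) where
  private
    module α = Ordinal α
    module β = Ordinal β
  field
    embed    : ∣ α ∣ → ∣ β ∣
    monotone : ∀ {i j} → i α.< j → embed i β.< embed j
    initial  : ∀ {i y} → y β.< embed i → ∃ λ j → embed j ≡ y

  -- Outside y says α ≤ y, with y an element of β.
  Outside : ∣ β ∣ → Set (a ⊔ b)
  Outside y = ∀ i → embed i ≢ y

_<ₒ_ : Ordinal a → Ordinal b → Set (a ⊔ b)
α <ₒ β = Σ (α ≤ₒ β) λ α≤β → ∃ (_≤ₒ_.Outside α≤β)

≤-+ₒ : (α : Ordinal a) (β : Ordinal b) → α ≤ₒ α +ₒ β
≤-+ₒ α β = record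
  { embed    = inj₁
  ; monotone = ₁∼₁
  ; initial  = λ { (₁∼₁ {x = x} _) → x , refl }
  }

FiniteOrdinal : Ordinal a → Set a
FiniteOrdinal α = ∃ λ n → ∣ α ∣ ↔ Fin n

------------------------------------------------------------------------
-- Cylindric algebras

-- Algebras of the similarity type of CA_I.

record RawCylindricAlgebra (I : Set a) c e : Set (a ⊔ suc (c ⊔ e)) where
  infix  8 -_
  infixr 7 _∧_
  infixr 6 _∨_
  infix  4 _≈_
  field
    Carrier : Set c
    _≈_     : Rel Carrier e
    _∨_     : Op₂ Carrier
    _∧_     : Op₂ Carrier
    -_      : Op₁ Carrier
    ⊤       : Carrier
    ⊥       : Carrier
    cyl     : I → Op₁ Carrier
    diag    : I → I → Carrier

record IsCylindricAlgebra {I : Set a} (A : RawCylindricAlgebra I c e) : Set (a ⊔ c ⊔ e) where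
  open RawCylindricAlgebra A
  field
    isBooleanAlgebra : IsBooleanAlgebra _≈_ _∨_ _∧_ -_ ⊤ ⊥
    cyl-cong         : ∀ i → Congruent _≈_ _≈_ (cyl i)
    cyl-⊥            : ∀ i → cyl i ⊥ ≈ ⊥
    cyl-extensive    : ∀ i x → x ∨ cyl i x ≈ cyl i x
    cyl-∧            : ∀ i x y → cyl i (x ∧ cyl i y) ≈ cyl i x ∧ cyl i y
    cyl-comm         : ∀ i j x → cyl i (cyl j x) ≈ cyl j (cyl i x)
    diag-refl        : ∀ i → diag i i ≈ ⊤
    diag-cyl         : ∀ {i j k} → k ≢ i → k ≢ j →
                       diag i j ≈ cyl k (diag i k ∧ diag k j)
    diag-complement  : ∀ {i j} → i ≢ j → ∀ x →
                       cyl i (diag i j ∧ x) ∧ cyl i (diag i j ∧ - x) ≈ ⊥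

  booleanAlgebra : BooleanAlgebra c e
  booleanAlgebra = record { isBooleanAlgebra = isBooleanAlgebra }

infix 4 _≅_

record _≅_ {I : Set a} (A : RawCylindricAlgebra I c e)
           (B : RawCylindricAlgebra I c′ e′) : Set (a ⊔ c ⊔ e ⊔ c′ ⊔ e′) where
  private
    module A = RawCylindricAlgebra A
    module B = RawCylindricAlgebra B
  field
    to         : A.Carrier → B.Carrier
    to-cong    : Congruent A._≈_ B._≈_ to
    injective  : Injective A._≈_ B._≈_ to
    surjective : Surjective A._≈_ B._≈_ to
    ∨-homo     : ∀ x y → to (x A.∨ y) B.≈ to x B.∨ to y
    ∧-homo     : ∀ x y → to (x A.∧ y) B.≈ to x B.∧ to y
    neg-homo   : ∀ x → to (A.- x) B.≈ B.- to x
    ⊤-homo     : to A.⊤ B.≈ B.⊤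
    ⊥-homo     : to A.⊥ B.≈ B.⊥
    cyl-homo   : ∀ i x → to (A.cyl i x) B.≈ B.cyl i (to x)
    diag-homo  : ∀ i j → to (A.diag i j) B.≈ B.diag i j

record Subuniverse {I : Set a} (A : RawCylindricAlgebra I c e) p
                   : Set (a ⊔ c ⊔ e ⊔ suc p) where
  open RawCylindricAlgebra A
  field
    Member      : Pred Carrier p
    resp        : ∀ {x y} → x ≈ y → Member x → Member y
    ∨-closed    : ∀ {x y} → Member x → Member y → Member (x ∨ y)
    ∧-closed    : ∀ {x y} → Member x → Member y → Member (x ∧ y)
    neg-closed  : ∀ {x} → Member x → Member (- x)
    ⊤-closed    : Member ⊤
    ⊥-closed    : Member ⊥
    cyl-closed  : ∀ i {x} → Member x → Member (cyl i x)
    diag-closed : ∀ i j → Member (diag i j)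

subalgebra : {I : Set a} {A : RawCylindricAlgebra I c e} →
             Subuniverse A p → RawCylindricAlgebra I (c ⊔ p) e
subalgebra {A = A} P = record
  { Carrier = Σ Carrier Member
  ; _≈_     = λ x y → proj₁ x ≈ proj₁ y
  ; _∨_     = λ x y → proj₁ x ∨ proj₁ y , ∨-closed (proj₂ x) (proj₂ y)
  ; _∧_     = λ x y → proj₁ x ∧ proj₁ y , ∧-closed (proj₂ x) (proj₂ y)
  ; -_      = λ x → - proj₁ x , neg-closed (proj₂ x)
  ; ⊤       = ⊤ , ⊤-closed
  ; ⊥       = ⊥ , ⊥-closed
  ; cyl     = λ i x → cyl i (proj₁ x) , cyl-closed i (proj₂ x)
  ; diag    = λ i j → diag i j , diag-closed i j
  }
  where
  open RawCylindricAlgebra A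
  open Subuniverse P

∏ : {I : Set a} {J : Set b} → (J → RawCylindricAlgebra I c e) →
    RawCylindricAlgebra I (b ⊔ c) (b ⊔ e)
∏ {J = J} A = record
  { Carrier = ∀ r → A.Carrier r
  ; _≈_     = λ f g → ∀ r → A._≈_ r (f r) (g r)
  ; _∨_     = λ f g r → A._∨_ r (f r) (g r)
  ; _∧_     = λ f g r → A._∧_ r (f r) (g r)
  ; -_      = λ f r → A.-_ r (f r)
  ; ⊤       = λ r → A.⊤ r
  ; ⊥       = λ r → A.⊥ r
  ; cyl     = λ i f r → A.cyl r i (f r)
  ; diag    = λ i j r → A.diag r i j
  }
  where module A r = RawCylindricAlgebra (A r)

------------------------------------------------------------------------
-- Ultraproducts

record IsUltrafilter {J : Set a} (F : Pred (Pred J ℓ) p) : Set (a ⊔ suc ℓ ⊔ p) where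
  field
    upward : ∀ {X Y} → X ⊆ Y → F X → F Y
    meet   : ∀ {X Y} → F X → F Y → F (X ∩ Y)
    whole  : F U
    proper : ¬ F ∅
    ultra  : ∀ X → F X ⊎ F (∁ X)

Principal : {J : Set a} → Pred (Pred J ℓ) p → Set (a ⊔ suc ℓ ⊔ p)
Principal F = ∃ λ j → ∀ X → F X ⇔ X j

ultraproduct : {I : Set a} {J : Set b} → (J → RawCylindricAlgebra I c e) →
               Pred (Pred J e) p → RawCylindricAlgebra I (b ⊔ c) p
ultraproduct A F = record
  { RawCylindricAlgebra (∏ A) hiding (_≈_)
  ; _≈_ = λ f g → F (λ r → RawCylindricAlgebra._≈_ (A r) (f r) (g r))
  }

------------------------------------------------------------------------
-- Neat reducts

reduct : {I : Set a} {J : Set b} → (I → J) →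
         RawCylindricAlgebra J c e → RawCylindricAlgebra I c e
reduct ι B = record
  { RawCylindricAlgebra B hiding (cyl; diag)
  ; cyl  = cyl ∘ ι
  ; diag = λ i j → diag (ι i) (ι j)
  }
  where open RawCylindricAlgebra B

module _ {α : Ordinal a} {β : Ordinal b} (α≤β : α ≤ₒ β)
         {B : RawCylindricAlgebra ∣ β ∣ c e} (isCA : IsCylindricAlgebra B) where

  open RawCylindricAlgebra B
  open IsCylindricAlgebra isCA
  open IsBooleanAlgebra isBooleanAlgebra
    renaming (refl to ≈-refl; sym to ≈-sym; trans to ≈-trans)
  open BooleanAlgebraProperties booleanAlgebra
  open SetoidReasoning (BooleanAlgebra.setoid booleanAlgebra)
  open _≤ₒ_ α≤β

  private
    cyl-⊤ : ∀ i → cyl i ⊤ ≈ ⊤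
    cyl-⊤ i = begin
      cyl i ⊤      ≈⟨ cyl-extensive i ⊤ ⟨
      ⊤ ∨ cyl i ⊤  ≈⟨ ∨-zeroˡ (cyl i ⊤) ⟩
      ⊤            ∎

    cyl-idem : ∀ i x → cyl i (cyl i x) ≈ cyl i x
    cyl-idem i x = begin
      cyl i (cyl i x)      ≈⟨ cyl-cong i (∧-identityˡ (cyl i x)) ⟨
      cyl i (⊤ ∧ cyl i x)  ≈⟨ cyl-∧ i ⊤ x ⟩
      cyl i ⊤ ∧ cyl i x    ≈⟨ ∧-congʳ (cyl-⊤ i) ⟩
      ⊤ ∧ cyl i x          ≈⟨ ∧-identityˡ (cyl i x) ⟩
      cyl i x              ∎

    fixed-∧ : ∀ i {x y} → cyl i x ≈ x → cyl i y ≈ y → cyl i (x ∧ y) ≈ x ∧ y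
    fixed-∧ i {x} {y} p q = begin
      cyl i (x ∧ y)        ≈⟨ cyl-cong i (∧-congˡ q) ⟨
      cyl i (x ∧ cyl i y)  ≈⟨ cyl-∧ i x y ⟩
      cyl i x ∧ cyl i y    ≈⟨ ∧-cong p q ⟩
      x ∧ y                ∎

    fixed-neg : ∀ i {x} → cyl i x ≈ x → cyl i (- x) ≈ - x
    fixed-neg i {x} p = begin
      cyl i (- x)                            ≈⟨ ∧-identityʳ (cyl i (- x)) ⟨
      cyl i (- x) ∧ ⊤                        ≈⟨ ∧-congˡ (∨-complementʳ x) ⟨
      cyl i (- x) ∧ (x ∨ - x)                ≈⟨ ∧-distribˡ-∨ (cyl i (- x)) x (- x) ⟩
      (cyl i (- x) ∧ x) ∨ (cyl i (- x) ∧ - x)  ≈⟨ ∨-congʳ disjoint ⟩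
      ⊥ ∨ (cyl i (- x) ∧ - x)                ≈⟨ ∨-identityˡ (cyl i (- x) ∧ - x) ⟩
      cyl i (- x) ∧ - x                      ≈⟨ ∧-comm (cyl i (- x)) (- x) ⟩
      - x ∧ cyl i (- x)                      ≈⟨ ∧-congˡ (cyl-extensive i (- x)) ⟨
      - x ∧ (- x ∨ cyl i (- x))              ≈⟨ ∧-absorbs-∨ (- x) (cyl i (- x)) ⟩
      - x                                    ∎
      where
      disjoint : cyl i (- x) ∧ x ≈ ⊥
      disjoint = begin
        cyl i (- x) ∧ x        ≈⟨ ∧-congˡ p ⟨
        cyl i (- x) ∧ cyl i x  ≈⟨ cyl-∧ i (- x) x ⟨
        cyl i (- x ∧ cyl i x)  ≈⟨ cyl-cong i (∧-congˡ p) ⟩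
        cyl i (- x ∧ x)        ≈⟨ cyl-cong i (∧-complementˡ x) ⟩
        cyl i ⊥                ≈⟨ cyl-⊥ i ⟩
        ⊥                      ∎

    fixed-∨ : ∀ i {x y} → cyl i x ≈ x → cyl i y ≈ y → cyl i (x ∨ y) ≈ x ∨ y
    fixed-∨ i {x} {y} p q = begin
      cyl i (x ∨ y)              ≈⟨ cyl-cong i dual ⟩
      cyl i (- (- x ∧ - y))      ≈⟨ fixed-neg i (fixed-∧ i (fixed-neg i p) (fixed-neg i q)) ⟩
      - (- x ∧ - y)              ≈⟨ dual ⟨
      x ∨ y                      ∎
      where
      dual : x ∨ y ≈ - (- x ∧ - y)
      dual = begin
        x ∨ y            ≈⟨ ¬-involutive (x ∨ y) ⟨
        - - (x ∨ y)      ≈⟨ ¬-cong (deMorgan₂ x y) ⟩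
        - (- x ∧ - y)    ∎

    fixed-diag : ∀ {i j k} → k ≢ i → k ≢ j → cyl k (diag i j) ≈ diag i j
    fixed-diag {i} {j} {k} k≢i k≢j = begin
      cyl k (diag i j)                     ≈⟨ cyl-cong k (diag-cyl k≢i k≢j) ⟩
      cyl k (cyl k (diag i k ∧ diag k j))  ≈⟨ cyl-idem k (diag i k ∧ diag k j) ⟩
      cyl k (diag i k ∧ diag k j)          ≈⟨ diag-cyl k≢i k≢j ⟨
      diag i j                             ∎

  neatSubuniverse : Subuniverse (reduct embed B) (a ⊔ b ⊔ e)
  neatSubuniverse = record
    { Member      = λ x → ∀ i → Outside i → cyl i x ≈ x
    ; resp        = λ x≈y h i o → ≈-trans (cyl-cong i (≈-sym x≈y)) (≈-trans (h i o) x≈y)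
    ; ∨-closed    = λ h k i o → fixed-∨ i (h i o) (k i o)
    ; ∧-closed    = λ h k i o → fixed-∧ i (h i o) (k i o)
    ; neg-closed  = λ h i o → fixed-neg i (h i o)
    ; ⊤-closed    = λ i _ → cyl-⊤ i
    ; ⊥-closed    = λ i _ → cyl-⊥ i
    ; cyl-closed  = λ j {x} h i o →
        ≈-trans (cyl-comm i (embed j) x) (cyl-cong (embed j) (h i o))
    ; diag-closed = λ j k i o → fixed-diag (o j ∘ sym) (o k ∘ sym)
    }

  𝔑𝔯 : RawCylindricAlgebra ∣ α ∣ (a ⊔ b ⊔ c ⊔ e) e
  𝔑𝔯 = subalgebra neatSubuniverse

------------------------------------------------------------------------
-- Classes of algebras

-- Set ℓ plays the role of the universe of sets: dimensions, algebras, bases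
-- of set algebras and index sets of products all range over it.

Class : (I : Set ℓ) (p : Level) → Set (suc ℓ ⊔ suc p)
Class {ℓ} I p = Pred (RawCylindricAlgebra I ℓ ℓ) p

NrCA : {α β : Ordinal ℓ} → α ≤ₒ β → Class ∣ α ∣ (suc ℓ)
NrCA {ℓ} {α} {β} α≤β A =
  Σ (RawCylindricAlgebra ∣ β ∣ ℓ ℓ) λ B →
  Σ (IsCylindricAlgebra B) λ isCA →
  A ≅ 𝔑𝔯 α≤β isCA

S : {I : Set ℓ} → Class I p → Class I (suc ℓ ⊔ p)
S {ℓ} {I = I} K A =
  Σ (RawCylindricAlgebra I ℓ ℓ) λ B → K B ×
  Σ (Subuniverse B ℓ) λ P → A ≅ subalgebra P

-- The algebra of all I-ary relations on a base V.  As equality on V is a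
-- setoid equality and equality of sequences is pointwise, a relation has to
-- be invariant under pointwise equality.

module _ (I : Set ℓ) (V : Setoid ℓ ℓ) where

  private
    module V = Setoid V

    Sequence : Set ℓ
    Sequence = I → V.Carrier

    Invariant : Pred Sequence ℓ → Set ℓ
    Invariant X = ∀ {s t} → (∀ i → s i V.≈ t i) → X s → X t

  fullSetAlgebra : RawCylindricAlgebra I (suc ℓ) ℓ
  fullSetAlgebra = record
    { Carrier = Σ (Pred Sequence ℓ) Invariant
    ; _≈_     = λ X Y → proj₁ X ≐ proj₁ Y
    ; _∨_     = λ (X , invX) (Y , invY) → X ∪ Y ,
        λ { s≈t (inj₁ x) → inj₁ (invX s≈t x) ; s≈t (inj₂ y) → inj₂ (invY s≈t y) }
    ; _∧_     = λ (X , invX) (Y , invY) → X ∩ Y ,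
        λ s≈t (x , y) → invX s≈t x , invY s≈t y
    ; -_      = λ (X , invX) → ∁ X , λ s≈t ¬x x → ¬x (invX (V.sym ∘ s≈t) x)
    ; ⊤       = U , λ _ → id
    ; ⊥       = ∅ , λ _ → id
    ; cyl     = λ i (X , invX) →
        (λ s → ∃ λ t → X t × (∀ j → j ≢ i → t j V.≈ s j)) ,
        λ s≈s′ (t , x , t≈s) → t , x , λ j j≢i → V.trans (t≈s j j≢i) (s≈s′ j)
    ; diag    = λ i j → (λ s → s i V.≈ s j) ,
        λ s≈t si≈sj → V.trans (V.sym (s≈t i)) (V.trans si≈sj (s≈t j))
    }

record CylindricSetAlgebra (I : Set ℓ) : Set (suc (suc ℓ)) where
  field
    base     : Setoid ℓ ℓ
    universe : Subuniverse (fullSetAlgebra I base) (suc ℓ)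

  algebra : RawCylindricAlgebra I (suc ℓ) ℓ
  algebra = subalgebra universe

RCA : (α : Ordinal ℓ) → Class ∣ α ∣ (suc (suc ℓ))
RCA {ℓ} α A =
  Σ (Set ℓ) λ J →
  Σ (J → CylindricSetAlgebra ∣ α ∣) λ C →
  Σ (Subuniverse (∏ (CylindricSetAlgebra.algebra ∘ C)) (suc ℓ)) λ P →
  A ≅ subalgebra P

------------------------------------------------------------------------
-- Equations and equation schemes

data Term (I : Set a) : Set a where
  var     : ℕ → Term I
  _∨′_    : Term I → Term I → Term I
  _∧′_    : Term I → Term I → Term I
  -′_     : Term I → Term I
  ⊤′ ⊥′   : Term I
  cyl′    : I → Term I → Term I
  diag′   : I → I → Term I

Equation : Set a → Set a
Equation I = Term I × Term I

mapIndices : {I : Set a} {J : Set b} → (I → J) → Term I → Term J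
mapIndices ρ (var n)     = var n
mapIndices ρ (s ∨′ t)    = mapIndices ρ s ∨′ mapIndices ρ t
mapIndices ρ (s ∧′ t)    = mapIndices ρ s ∧′ mapIndices ρ t
mapIndices ρ (-′ t)      = -′ mapIndices ρ t
mapIndices ρ ⊤′          = ⊤′
mapIndices ρ ⊥′          = ⊥′
mapIndices ρ (cyl′ i t)  = cyl′ (ρ i) (mapIndices ρ t)
mapIndices ρ (diag′ i j) = diag′ (ρ i) (ρ j)

indices : {I : Set a} → Term I → List I
indices (var n)     = []
indices (s ∨′ t)    = indices s ++ indices t
indices (s ∧′ t)    = indices s ++ indices t
indices (-′ t)      = indices t
indices ⊤′          = []
indices ⊥′          = []
indices (cyl′ i t)  = i ∷ indices t
indices (diag′ i j) = i ∷ j ∷ []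

module _ {I : Set a} (A : RawCylindricAlgebra I c e) where
  open RawCylindricAlgebra A

  ⟦_⟧ : Term I → (ℕ → Carrier) → Carrier
  ⟦ var n     ⟧ v = v n
  ⟦ s ∨′ t    ⟧ v = ⟦ s ⟧ v ∨ ⟦ t ⟧ v
  ⟦ s ∧′ t    ⟧ v = ⟦ s ⟧ v ∧ ⟦ t ⟧ v
  ⟦ -′ t      ⟧ v = - ⟦ t ⟧ v
  ⟦ ⊤′        ⟧ v = ⊤
  ⟦ ⊥′        ⟧ v = ⊥
  ⟦ cyl′ i t  ⟧ v = cyl i (⟦ t ⟧ v)
  ⟦ diag′ i j ⟧ v = diag i j

  infix 4 _⊨_ _⊨ˢ_

  _⊨_ : Equation I → Set (c ⊔ e)
  _⊨_ (s , t) = ∀ v → ⟦ s ⟧ v ≈ ⟦ t ⟧ v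

  -- All instances of a scheme, a scheme being an equation in the signature
  -- of CA_ω.  Only the values of ρ on occurring indices matter, so ρ is a
  -- total function that is injective on these.
  _⊨ˢ_ : Equation ℕ → Set (a ⊔ c ⊔ e)
  _⊨ˢ_ (s , t) =
    (ρ : ℕ → I) →
    (∀ {m n} → m ∈ indices s ++ indices t → n ∈ indices s ++ indices t →
       ρ m ≡ ρ n → m ≡ n) →
    _⊨_ (mapIndices ρ s , mapIndices ρ t)

FiniteSchemaAxiomatizable : {p q : Level} (α : Ordinal ℓ) →
                            (L : Class ∣ α ∣ p) (K : Class ∣ α ∣ q) → Set (suc ℓ ⊔ p ⊔ q)
FiniteSchemaAxiomatizable α L K =
  (FiniteOrdinal α ×
    Σ (List (Equation ∣ α ∣)) λ E → ∀ A → L A ⇔ (K A × All (A ⊨_) E))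
  ⊎
  (¬ FiniteOrdinal α ×
    Σ (List (Equation ℕ)) λ E → ∀ A → L A ⇔ (K A × All (A ⊨ˢ_) E))

{-# OPTIONS --safe #-}
module Submission where

-- 𝔄 r is the neat reduct of the complex algebra of all networks on α + k nodes:
-- nodes have sorts, edges have colours, of which there is one less than nodes,
-- and each colour comes in r + 1 shades.  Two edges of a triangle may have the
-- same colour and shade only if the third edge does not have this colour with
-- the same or a greater shade.  As a node excludes at most one colour for a
-- missing edge, some colour is left when all nodes but the two ends of this edge
-- are given; hence networks amalgamate and cylindrifications commute.
--
-- With one more variable there is a contradiction.  Nodes of different sorts
-- are chosen one after the other, in such a way that each has edges of a single
-- label to a large set of sorts of later ones.  When a colour recurs, its shade
-- is smaller than before and the earlier node can be forgotten, so at most one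
-- node per colour is kept while the shades decrease.  All this is visible in
-- three dimensions.  For large α, the remaining indices are played by constants
-- each of which uses up a colour.
--
-- In the ultraproduct shades do not run out.  A new node that is prescribed on
-- α − 1 others leaves a colour unused, because k ≥ 1, and it can be joined to all
-- further nodes by edges of this colour in new shades.  The representation is an
-- ultraproduct of finite pieces of this construction, indexed by finite sets of
-- coordinates and of Skolem terms, and its points are all Skolem terms.
--
-- If finitely many schemes axiomatized the larger dimension, one of them would
-- fail in 𝔄 r for many r, hence in a representable ultraproduct.

open import Defs
open import Level using (Level; Lift; lift; lower; _⊔_; suc)
open import Algebra.Lattice.Bundles using (BooleanAlgebra)
open import Algebra.Lattice.Structures using (IsBooleanAlgebra)
import Algebra.Lattice.Properties.BooleanAlgebra as BooleanAlgebraProperties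
import Algebra.Lattice.Properties.Lattice as LatticeProperties
open import Data.Bool.Base as 𝔹 using (Bool; true; false; not)
import Data.Bool.Properties as Boolₚ
open import Data.Empty using (⊥-elim) renaming (⊥ to ⊥₀)
open import Data.Fin.Base as Fin using (Fin; toℕ; _↑ˡ_; _↑ʳ_)
import Data.Fin.Properties as Fin
open import Data.List.Base
  using (List; []; _∷_; [_]; _++_; map; length; foldl; foldr; allFin; cartesianProduct; cartesianProductWith; deduplicate)
open import Data.List.Properties using (length-++; length-map; length-tabulate)
open import Data.List.Membership.Propositional using (_∈_; _∉_)
open import Data.List.Membership.Propositional.Properties
  using (∈-++⁺ˡ; ∈-++⁺ʳ; ∈-map⁺; ∈-map⁻; ∈-allFin; ∈-deduplicate⁺; ∈-deduplicate⁻;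
         ∈-cartesianProduct⁺; ∈-cartesianProductWith⁺)
import Data.List.Relation.Binary.Subset.Propositional as Subset
open import Data.List.Relation.Unary.All as All using (All; []; _∷_)
open import Data.List.Relation.Unary.AllPairs using ([]; _∷_)
open import Data.List.Relation.Unary.Any using (Any; here; there; _─_)
open import Data.List.Relation.Unary.Unique.Propositional using (Unique)
open import Data.List.Relation.Unary.Unique.Propositional.Properties using (allFin⁺)
import Data.List.Relation.Unary.Unique.DecPropositional.Properties as UniqueDec
open import Data.Maybe.Base using (Maybe; nothing; just)
open import Data.Nat.Base as ℕ using (ℕ; z≤n; s≤s; _+_; _*_)
import Data.Nat.Properties as ℕ
open import Data.Nat.ListAction using (sum)
open import Data.Product using (Σ; ∃; _×_; _,_; proj₁; proj₂; uncurry)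
open import Data.Sum.Base using (_⊎_; inj₁; inj₂; [_,_]′)
open import Data.Sum.Properties using (inj₁-injective; inj₂-injective)
open import Function.Base using (_∘_; id; const; case_of_)
open import Function.Bundles using (Func; Surjection; Equivalence; mk⇔)
open import Relation.Binary.Bundles using (Setoid)
open import Relation.Binary.Core using (Rel)
import Relation.Binary.Lattice.Bundles as OrderLattice
import Relation.Binary.Reasoning.PartialOrder as PosetReasoning
open import Relation.Binary.Structures using (IsEquivalence; IsStrictTotalOrder)
open import Relation.Binary.PropositionalEquality as ≡
  using (_≡_; _≢_; refl; sym; trans; cong; cong₂; subst; subst₂)
open import Relation.Nullary using (¬_; Dec; yes; no; does; contradiction)
open import Relation.Nullary.Decidable using (decidable-stable)
open import Relation.Unary using (Pred; _≐_)
import Relation.Unary.Polymorphic as Polymorphic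

-- Classical logic and ultrafilters

-- The number k enters through two counts. Apart from the colours of the constants, k + 2 colours
-- remain, and the descent keeps one node for each; with two further variables this takes k + 4 = 3
-- + (k + 1) of them, three from α and all k + 1 spare ones. In the other direction, an element of 𝔄
-- r does not see the k spare nodes, so in the representation these may duplicate others, and α - 1
-- demanded nodes face α + k - 1 colours. For infinite α such counts say nothing by themselves. The
-- condition `Weak` makes almost every index name a constant whose edges have the colour of this
-- index; each count then takes place in a finite list, where no injection into a proper part
-- exists. A scheme may fail in 𝔄 r at an instance that depends on r, which a single ultraproduct of
-- the 𝔄 r cannot detect. Representability is therefore proved for ultraproducts of reducts of the 𝔄
-- r along arbitrary injections of α into itself, one for each r. Sets of worlds are Boolean-valued,
-- so that the algebras stay at the level ℓ of the dimension.

module Logic (cl : Classical) where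

  open 𝔹 using (_∧_; _∨_)

  open Classical cl

  private
    variable
      p q : Level
      P : Set p
      Q : Set q

  em : Dec P
  em {p} = excludedMiddle p

  dne : ¬ ¬ P → P
  dne = decidable-stable em

  ⌈_⌉ : Set p → Bool
  ⌈ P ⌉ = does (em {P = P})

  ⌈⌉⁺ : P → ⌈ P ⌉ ≡ true
  ⌈⌉⁺ {P = P} x with em {P = P}
  ... | yes _ = refl
  ... | no ¬x = contradiction x ¬x

  ⌈⌉⁻ : ⌈ P ⌉ ≡ true → P
  ⌈⌉⁻ {P = P} eq with em {P = P}
  ... | yes x = x

  ∧⁺ : ∀ {x y} → x ≡ true → y ≡ true → x ∧ y ≡ true
  ∧⁺ refl refl = refl

  ∧⁻ : ∀ {x y} → x ∧ y ≡ true → x ≡ true × y ≡ true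
  ∧⁻ {true} {true} refl = refl , refl

  not⁺ : ∀ {x} → ¬ x ≡ true → not x ≡ true
  not⁺ {false} _ = refl
  not⁺ {true}  h = contradiction refl h

  not⁻ : ∀ {x} → not x ≡ true → ¬ x ≡ true
  not⁻ {false} _ ()

  ∨⁺ : ∀ {x y} → x ≡ true ⊎ y ≡ true → x ∨ y ≡ true
  ∨⁺ (inj₁ refl)         = refl
  ∨⁺ {false} (inj₂ refl) = refl
  ∨⁺ {true}  (inj₂ refl) = refl

  ∨⁻ : ∀ {x y} → x ∨ y ≡ true → x ≡ true ⊎ y ≡ true
  ∨⁻ {true}  _ = inj₁ refl
  ∨⁻ {false} h = inj₂ h

  Bool-ext : ∀ {x y} → (x ≡ true → y ≡ true) → (y ≡ true → x ≡ true) → x ≡ y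
  Bool-ext f g = Boolₚ.⇔→≡ (mk⇔ f g)

module Ultrafilters (cl : Classical) {ℓ : Level} (Y : Set ℓ) where

  open 𝔹 using (_∧_)
  open import Relation.Unary using (_⊆_; _∩_)
  open Classical cl
  open Logic cl

  -- Boolean values keep families of sets, and the quantification over all towers below, inside
  -- `Set ℓ`.
  Sub : Set ℓ
  Sub = Y → Bool

  Fam : Set ℓ
  Fam = Sub → Bool

  infix 4 _∋_ _≼_ _≋_

  _∋_ : ∀ {x} {X : Set x} → (X → Bool) → X → Set
  A ∋ z = A z ≡ true

  _≼_ : Fam → Fam → Set ℓ
  A ≼ B = ∀ z → A ∋ z → B ∋ z

  _≋_ : Fam → Fam → Set ℓ
  A ≋ B = A ≼ B × B ≼ A

  record ProperFilter (A : Fam) : Set ℓ where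
    field
      upward : ∀ {X Z} → (∀ y → X ∋ y → Z ∋ y) → A ∋ X → A ∋ Z
      meet   : ∀ {X Z} → A ∋ X → A ∋ Z → A ∋ (λ y → X y ∧ Z y)
      proper : ∀ {X} → A ∋ X → ∃ λ y → X ∋ y

  open ProperFilter

  ProperFilter-resp : ∀ {A B} → A ≋ B → ProperFilter A → ProperFilter B
  ProperFilter-resp (A≼B , B≼A) F = record
    { upward = λ X⊆Z BX → A≼B _ (upward F X⊆Z (B≼A _ BX))
    ; meet   = λ BX BZ → A≼B _ (meet F (B≼A _ BX) (B≼A _ BZ))
    ; proper = λ BX → proper F (B≼A _ BX)
    }

  Extends : Fam → Fam → Set ℓ
  Extends A B = ProperFilter B × A ≼ B × ¬ B ≼ A

  private

    ≋-setoid : Setoid ℓ ℓ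
    ≋-setoid = record
      { Carrier = Fam
      ; _≈_ = _≋_
      ; isEquivalence = record
        { refl  = (λ _ → id) , (λ _ → id)
        ; sym   = λ (p , q) → q , p
        ; trans = λ (p , q) (p′ , q′) → (λ z → p′ z ∘ p z) , (λ z → q z ∘ q′ z)
        }
      }

    module ≋ = Setoid ≋-setoid

    -- Since the extension is ignored by the equality here, a section of `base` picks one extension
    -- per `≋`-class; this is what makes `next` respect `≋`.
    Extendible : Setoid ℓ ℓ
    Extendible = record
      { Carrier = Σ Fam (∃ ∘ Extends)
      ; _≈_ = λ x y → proj₁ x ≋ proj₁ y
      ; isEquivalence = record { refl = ≋.refl ; sym = ≋.sym ; trans = ≋.trans }
      }

    Extension : Setoid ℓ ℓ
    Extension = record
      { Carrier = Σ Fam λ A → ∃ (Extends A)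
      ; _≈_ = λ x y → proj₁ x ≋ proj₁ y × proj₁ (proj₂ x) ≋ proj₁ (proj₂ y)
      ; isEquivalence = record
        { refl  = ≋.refl , ≋.refl
        ; sym   = λ (p , q) → ≋.sym p , ≋.sym q
        ; trans = λ (p , q) (p′ , q′) → ≋.trans p p′ , ≋.trans q q′
        }
      }

    base : Surjection Extension Extendible
    base = record
      { to = id
      ; cong = proj₁
      ; surjective = λ x → x , proj₁
      }

    chosen : Func Extendible Extension
    chosen = proj₁ (choice Extension Extendible base)

    chosen-base : ∀ x → proj₁ (Func.to chosen x) ≋ proj₁ x
    chosen-base = proj₂ (choice Extension Extendible base)

    next : Fam → Fam
    next A with em {P = ∃ (Extends A)}
    ... | yes p = proj₁ (proj₂ (Func.to chosen (A , p)))
    ... | no _  = A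

    next-cong : ∀ {A B} → A ≋ B → next A ≋ next B
    next-cong {A} {B} A≋B with em {P = ∃ (Extends A)} | em {P = ∃ (Extends B)}
    ... | yes p | yes q = proj₂ (Func.cong chosen {A , p} {B , q} A≋B)
    ... | no  _ | no  _ = A≋B
    ... | yes (C , fC , A≼C , C⋠A) | no ¬q = contradiction
      (C , fC , (λ z → A≼C z ∘ proj₂ A≋B z) , λ C≼B → C⋠A (λ z → proj₂ A≋B z ∘ C≼B z)) ¬q
    ... | no ¬p | yes (C , fC , B≼C , C⋠B) = contradiction
      (C , fC , (λ z → B≼C z ∘ proj₁ A≋B z) , λ C≼A → C⋠B (λ z → proj₁ A≋B z ∘ C≼A z)) ¬p

    next-inflationary : ∀ A → A ≼ next A
    next-inflationary A z Az with em {P = ∃ (Extends A)}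
    ... | no _  = Az
    ... | yes p with Func.to chosen (A , p) | chosen-base (A , p)
    ...   | _ , _ , _ , A′≼B , _ | _ , A≼A′ = A′≼B z (A≼A′ z Az)

    next-filter : ∀ {A} → ProperFilter A → ProperFilter (next A)
    next-filter {A} fA with em {P = ∃ (Extends A)}
    ... | no _  = fA
    ... | yes p = proj₁ (proj₂ (proj₂ (Func.to chosen (A , p))))

    next-maximal : ∀ {A} → next A ≼ A → ¬ ∃ (Extends A)
    next-maximal {A} nA≼A with em {P = ∃ (Extends A)}
    ... | no ¬p = ¬p
    ... | yes p with Func.to chosen (A , p) | chosen-base (A , p)
    ...   | _ , _ , _ , _ , B⋠A′ | _ , A≼A′ = λ _ → B⋠A′ (λ z → A≼A′ z ∘ nA≼A z)

  -- The Bourbaki–Witt argument: the least family of filters that contains A₀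
  -- and is closed under next and suprema is a chain, so its supremum is maximal.
  module _ (A₀ : Fam) (filter₀ : ProperFilter A₀) (whole₀ : A₀ ∋ (λ _ → true)) where

    private

      sup : (Fam → Bool) → Fam
      sup 𝒮 z = ⌈ A₀ ∋ z ⊎ (∃ λ A → 𝒮 ∋ A × A ∋ z) ⌉

      record Tower (𝒯 : Fam → Bool) : Set ℓ where
        field
          resp        : ∀ {A B} → A ≋ B → 𝒯 ∋ A → 𝒯 ∋ B
          next-closed : ∀ {A} → 𝒯 ∋ A → 𝒯 ∋ next A
          sup-closed  : ∀ 𝒮 → (∀ A → 𝒮 ∋ A → 𝒯 ∋ A) → 𝒯 ∋ sup 𝒮

      open Tower

      Member : Fam → Set ℓ
      Member A = ∀ 𝒯 → Tower 𝒯 → 𝒯 ∋ A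

      Member-sup : ∀ 𝒮 → (∀ A → 𝒮 ∋ A → Member A) → Member (sup 𝒮)
      Member-sup 𝒮 h 𝒯 t = sup-closed t 𝒮 λ A SA → h A SA 𝒯 t

      -- The members that satisfy `P` form a tower, and a member lies in every tower.
      induction : (P : Fam → Set ℓ) →
                  (∀ {A B} → A ≋ B → P A → P B) →
                  (∀ A → Member A → P A → P (next A)) →
                  (∀ 𝒮 → (∀ A → 𝒮 ∋ A → Member A × P A) → P (sup 𝒮)) →
                  ∀ {A} → Member A → P A
      induction P r n s mA = proj₂ (⌈⌉⁻ (mA (λ A → ⌈ Member A × P A ⌉) record
        { resp        = λ A≋B h → let m , pA = ⌈⌉⁻ h in
                          ⌈⌉⁺ ((λ 𝒯 t → resp t A≋B (m 𝒯 t)) , r A≋B pA)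
        ; next-closed = λ h → let m , pA = ⌈⌉⁻ h in
                          ⌈⌉⁺ ((λ 𝒯 t → next-closed t (m 𝒯 t)) , n _ m pA)
        ; sup-closed  = λ 𝒮 h → ⌈⌉⁺
            ( Member-sup 𝒮 (λ A SA → proj₁ (⌈⌉⁻ (h A SA)))
            , s 𝒮 (λ A SA → ⌈⌉⁻ (h A SA)))
        }))

      ≼-sup : ∀ {𝒮 A} → 𝒮 ∋ A → A ≼ sup 𝒮
      ≼-sup SA z Az = ⌈⌉⁺ (inj₂ (_ , SA , Az))

      sup-least : ∀ {𝒮 B} → A₀ ≼ B → (∀ A → 𝒮 ∋ A → A ≼ B) → sup 𝒮 ≼ B
      sup-least A₀≼B h z e with ⌈⌉⁻ e
      ... | inj₁ A₀z          = A₀≼B z A₀z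
      ... | inj₂ (A , SA , Az) = h A SA z Az

      A₀≼ : ∀ {A} → Member A → A₀ ≼ A
      A₀≼ = induction (A₀ ≼_)
        (λ (A≼B , _) h z → A≼B z ∘ h z)
        (λ A _ h z → next-inflationary A z ∘ h z)
        (λ 𝒮 _ z A₀z → ⌈⌉⁺ (inj₁ A₀z))

      -- The auxiliary notion of the Bourbaki-Witt argument: it forces every member to lie below `C`
      -- or above `next C`, and every member turns out to have it.
      Extreme : Fam → Set ℓ
      Extreme C = ∀ {A} → Member A → A ≼ C → ¬ C ≼ A → next A ≼ C

      extreme-comparable : ∀ {C} → Member C → Extreme C →
                           ∀ {A} → Member A → A ≼ C ⊎ next C ≼ A
      extreme-comparable {C} mC eC = induction (λ A → A ≼ C ⊎ next C ≼ A)
        (λ { (A≼B , B≼A) (inj₁ A≼C) → inj₁ λ z → A≼C z ∘ B≼A z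
           ; (A≼B , B≼A) (inj₂ C≼A) → inj₂ λ z → A≼B z ∘ C≼A z })
        step
        λ 𝒮 h → case em {P = ∃ λ A → 𝒮 ∋ A × next C ≼ A} of λ
          { (yes (A , SA , C≼A)) → inj₂ λ z → ≼-sup {𝒮} SA z ∘ C≼A z
          ; (no ¬p) → inj₁ (sup-least {𝒮} (A₀≼ mC) λ A SA →
              [ id , (λ C≼A → contradiction (A , SA , C≼A) ¬p) ]′ (proj₂ (h A SA)))
          }
        where
        step : ∀ A → Member A → A ≼ C ⊎ next C ≼ A → next A ≼ C ⊎ next C ≼ next A
        step A mA (inj₂ C≼A) = inj₂ λ z → next-inflationary A z ∘ C≼A z
        step A mA (inj₁ A≼C) with em {P = C ≼ A}
        ... | yes C≼A = inj₂ (proj₁ (next-cong (C≼A , A≼C)))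
        ... | no  C⋠A = inj₁ (eC mA A≼C C⋠A)

      extreme : ∀ {C} → Member C → Extreme C
      extreme mC = proj₂ (induction (λ C → Member C × Extreme C)
        (λ (B≼C , C≼B) (mB , eB) →
          (λ 𝒯 t → resp t (B≼C , C≼B) (mB 𝒯 t)) ,
          λ mA A≼C C⋠A z → B≼C z ∘ eB mA (λ z → C≼B z ∘ A≼C z) (λ B≼A → C⋠A λ z → B≼A z ∘ C≼B z) z)
        (λ C mC (_ , eC) → (λ 𝒯 t → next-closed t (mC 𝒯 t)) , next-extreme C mC eC)
        (λ 𝒮 h → Member-sup 𝒮 (λ A SA → proj₁ (h A SA)) ,
                 sup-extreme 𝒮 (λ A SA → proj₂ (h A SA)))
        mC)
        where
        next-extreme : ∀ C → Member C → Extreme C → Extreme (next C)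
        next-extreme C mC eC {A} mA A≼nC nC⋠A with extreme-comparable mC eC mA
        ... | inj₂ nC≼A = contradiction nC≼A nC⋠A
        ... | inj₁ A≼C with em {P = C ≼ A}
        ...   | yes C≼A = proj₁ (next-cong (A≼C , C≼A))
        ...   | no  C⋠A = λ z → next-inflationary C z ∘ eC mA A≼C C⋠A z

        sup-extreme : ∀ 𝒮 → (∀ A → 𝒮 ∋ A → Member A × Extreme A) → Extreme (sup 𝒮)
        sup-extreme 𝒮 h {A} mA A≼s s⋠A with em {P = ∃ λ C → 𝒮 ∋ C × ¬ next C ≼ A}
        ... | no ¬p = contradiction
          (sup-least {𝒮} (A₀≼ mA) λ C SC z →
            dne (λ nC⋠A → ¬p (C , SC , nC⋠A)) z ∘ next-inflationary C z) s⋠A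
        ... | yes (C , SC , nC⋠A) with h C SC
        ...   | mC , eC with extreme-comparable mC eC mA
        ...     | inj₂ nC≼A = contradiction nC≼A nC⋠A
        ...     | inj₁ A≼C with em {P = C ≼ A}
        ...       | no  C⋠A = λ z → ≼-sup {𝒮} SC z ∘ eC mA A≼C C⋠A z
        ...       | yes C≼A with extreme-comparable mC eC (Member-sup 𝒮 (λ B SB → proj₁ (h B SB)))
        ...         | inj₁ s≼C  = contradiction (λ z → C≼A z ∘ s≼C z) s⋠A
        ...         | inj₂ nC≼s = λ z → nC≼s z ∘ proj₁ (next-cong (A≼C , C≼A)) z

      chain : ∀ {A B} → Member A → Member B → A ≼ B ⊎ B ≼ A
      chain {A} {B} mA mB with extreme-comparable mB (extreme mB) mA
      ... | inj₁ A≼B  = inj₁ A≼B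
      ... | inj₂ nB≼A = inj₂ λ z → nB≼A z ∘ next-inflationary B z

      sup-filter : ∀ 𝒮 → (∀ A → 𝒮 ∋ A → Member A × ProperFilter A) → ProperFilter (sup 𝒮)
      sup-filter 𝒮 h = record
        { upward = λ X⊆Z s → case ⌈⌉⁻ s of λ
            { (inj₁ a) → ⌈⌉⁺ (inj₁ (upward filter₀ X⊆Z a))
            ; (inj₂ (A , SA , a)) → ⌈⌉⁺ (inj₂ (A , SA , upward (proj₂ (h A SA)) X⊆Z a)) }
        ; meet = λ s t → ⌈⌉⁺ (meet′ (⌈⌉⁻ s) (⌈⌉⁻ t))
        ; proper = λ s → case ⌈⌉⁻ s of λ
            { (inj₁ a) → proper filter₀ a
            ; (inj₂ (A , SA , a)) → proper (proj₂ (h A SA)) a }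
        }
        where
        In : Sub → Set ℓ
        In X = A₀ ∋ X ⊎ (∃ λ A → 𝒮 ∋ A × A ∋ X)

        meet′ : ∀ {X Z} → In X → In Z → In (λ y → X y ∧ Z y)
        meet′ (inj₁ a) (inj₁ b) = inj₁ (meet filter₀ a b)
        meet′ (inj₁ a) (inj₂ (B , SB , b)) with h B SB
        ... | mB , fB = inj₂ (B , SB , meet fB (A₀≼ mB _ a) b)
        meet′ (inj₂ (A , SA , a)) (inj₁ b) with h A SA
        ... | mA , fA = inj₂ (A , SA , meet fA a (A₀≼ mA _ b))
        meet′ (inj₂ (A , SA , a)) (inj₂ (B , SB , b)) with h A SA | h B SB
        ... | mA , fA | mB , fB with chain mA mB
        ...   | inj₁ A≼B = inj₂ (B , SB , meet fB (A≼B _ a) b)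
        ...   | inj₂ B≼A = inj₂ (A , SA , meet fA a (B≼A _ b))

      Member-filter : ∀ {A} → Member A → ProperFilter A
      Member-filter = induction ProperFilter ProperFilter-resp (λ _ _ → next-filter) sup-filter

    maximal : Fam
    maximal = sup λ A → ⌈ Member A ⌉

    private
      maximal-member : Member maximal
      maximal-member = Member-sup _ λ A → ⌈⌉⁻

    A₀≼maximal : A₀ ≼ maximal
    A₀≼maximal = A₀≼ maximal-member

    maximal-filter : ProperFilter maximal
    maximal-filter = Member-filter maximal-member

    -- Otherwise adjoining `X` gives a proper filter strictly above `maximal`; but `next maximal` is
    -- a member and so lies below the supremum, which rules out strict extensions.
    maximal-ultra : ∀ X → ¬ maximal ∋ X → maximal ∋ (not ∘ X)
    maximal-ultra X ∌X = dne λ ∌X̅ → next-maximal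
      (≼-sup (⌈⌉⁺ (λ 𝒯 t → next-closed t (maximal-member 𝒯 t))))
      (adjoined , adjoined-filter ∌X̅
      , (λ Z MZ → ⌈⌉⁺ (Z , MZ , λ y → proj₁ ∘ ∧⁻))
      , λ h → ∌X (h X (⌈⌉⁺ ((λ _ → true) , A₀≼maximal _ whole₀ , λ y → id))))
      where
      adjoined : Fam
      adjoined Z = ⌈ ∃ (λ V → maximal ∋ V × (∀ y → V y ∧ X y ≡ true → Z ∋ y)) ⌉

      adjoined-filter : ¬ maximal ∋ (not ∘ X) → ProperFilter adjoined
      adjoined-filter ∌X̅ = record
        { upward = λ X⊆Z a → let V , MV , h = ⌈⌉⁻ a in ⌈⌉⁺ (V , MV , λ y → X⊆Z y ∘ h y)
        ; meet = λ a b → let V , MV , h = ⌈⌉⁻ a ; W , MW , h′ = ⌈⌉⁻ b in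
            ⌈⌉⁺ (_ , meet maximal-filter MV MW , λ y e →
              let vw , x = ∧⁻ {V y ∧ W y} e ; v , w = ∧⁻ {V y} vw in ∧⁺ (h y (∧⁺ v x)) (h′ y (∧⁺ w x)))
        ; proper = λ {Z} a → let V , MV , h = ⌈⌉⁻ a in dne λ empty →
            ∌X̅ (upward maximal-filter (λ y Vy → not⁺ λ Xy → empty (y , h y (∧⁺ Vy Xy))) MV)
        }

  -- Excluded middle replaces predicates by Boolean sets, so the ultrafilter lives at level `ℓ`
  -- whatever the level of `𝓕`.
  extend : ∀ {q} (𝓕 : Pred (Pred Y ℓ) q) →
           (∀ {X Z} → X ⊆ Z → 𝓕 X → 𝓕 Z) →
           (∀ {X Z} → 𝓕 X → 𝓕 Z → 𝓕 (X ∩ Z)) →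
           𝓕 Polymorphic.U →
           (∀ {X} → 𝓕 X → ∃ X) →
           ∃ λ (G : Pred (Pred Y ℓ) ℓ) → IsUltrafilter G × (∀ {X} → 𝓕 X → G X)
  extend 𝓕 upw met whl prp = G , isUltrafilter , λ FX →
    lift (A₀≼maximal A₀ filter₀ whole₀ _ (⌈⌉⁺ (upw (lift ∘ ⌈⌉⁺) FX)))
    where
    set : Sub → Pred Y ℓ
    set X y = Lift ℓ (X ∋ y)

    A₀ : Fam
    A₀ X = ⌈ 𝓕 (set X) ⌉

    filter₀ : ProperFilter A₀
    filter₀ = record
      { upward = λ X⊆Z FX → ⌈⌉⁺ (upw (λ {y} (lift Xy) → lift (X⊆Z y Xy)) (⌈⌉⁻ FX))
      ; meet   = λ FX FZ → ⌈⌉⁺ (upw (λ (lift x , lift z) → lift (∧⁺ x z)) (met (⌈⌉⁻ FX) (⌈⌉⁻ FZ)))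
      ; proper = λ FX → let y , lift Xy = prp (⌈⌉⁻ FX) in y , Xy
      }

    whole₀ : A₀ ∋ (λ _ → true)
    whole₀ = ⌈⌉⁺ (upw (λ _ → lift refl) whl)

    module M = ProperFilter (maximal-filter A₀ filter₀ whole₀)

    G : Pred (Pred Y ℓ) ℓ
    G X = Lift ℓ (maximal A₀ filter₀ whole₀ ∋ (λ y → ⌈ X y ⌉))

    isUltrafilter : IsUltrafilter G
    isUltrafilter = record
      { upward = λ X⊆Z (lift m) → lift (M.upward (λ y e → ⌈⌉⁺ (X⊆Z (⌈⌉⁻ e))) m)
      ; meet   = λ (lift m) (lift n) → lift (M.upward
          (λ y e → let x , z = ∧⁻ e in ⌈⌉⁺ (⌈⌉⁻ x , ⌈⌉⁻ z)) (M.meet m n))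
      ; whole  = lift (M.upward (λ y _ → ⌈⌉⁺ _) (A₀≼maximal A₀ filter₀ whole₀ _ whole₀))
      ; proper = λ (lift m) → case ⌈⌉⁻ (proj₂ (M.proper m)) of λ ()
      ; ultra  = λ X → case em {P = maximal A₀ filter₀ whole₀ ∋ (λ y → ⌈ X y ⌉)} of λ
          { (yes m) → inj₁ (lift m)
          ; (no ¬m) → inj₂ (lift (M.upward (λ y e → ⌈⌉⁺ λ x → not⁻ e (⌈⌉⁺ x))
                        (maximal-ultra A₀ filter₀ whole₀ _ ¬m)))
          }
      }

-- Complex algebras

-- The conditions match the cylindric axioms: `R-comm` gives commuting cylindrifications, the `D`
-- fields give the axioms on diagonals. Worlds will consist of functions, hence the separate
-- equality.
record Frame {ℓ} (I : Set ℓ) : Set (suc ℓ) where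
  infix 4 _≈_
  field
    World    : Set ℓ
    _≈_      : Rel World ℓ
    R        : I → Rel World ℓ
    D        : I → I → Pred World ℓ
    ≈⇒R      : ∀ {i g h} → g ≈ h → R i g h
    R-refl   : ∀ {i g} → R i g g
    R-sym    : ∀ {i g h} → R i g h → R i h g
    R-trans  : ∀ {i g h k} → R i g h → R i h k → R i g k
    R-comm   : ∀ {i j g h k} → R i g h → R j h k → ∃ λ h′ → R j g h′ × R i h′ k
    D-resp   : ∀ {i j g h} → g ≈ h → D i j g → D i j h
    D-sym≈   : ∀ {i j g h} → g ≈ h → D i j h → D i j g
    D-refl   : ∀ {i g} → D i i g
    D-split  : ∀ {i j k g} → k ≢ i → k ≢ j → D i j g →
               ∃ λ h → R k g h × D i k h × D k j h
    D-join   : ∀ {i j k g h} → k ≢ i → k ≢ j → R k g h → D i k h → D k j h → D i j g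
    D-unique : ∀ {i j g h} → i ≢ j → R i g h → D i j g → D i j h → g ≈ h

module ComplexAlgebra (cl : Classical) {ℓ} {I : Set ℓ} (𝔉 : Frame I) where

  open 𝔹 using (_∧_; _∨_)
  open Logic cl
  open Frame 𝔉

  -- With predicates instead of truth values the carrier would leave `Set ℓ`, over which the classes
  -- of algebras range.
  Element : Set ℓ
  Element = Σ (World → Bool) λ X → ∀ {g h} → g ≈ h → X g ≡ X h

  infix 4 _∈ᵉ_
  _∈ᵉ_ : World → Element → Set
  g ∈ᵉ X = proj₁ X g ≡ true

  ⟨_⟩ : (P : Pred World ℓ) → (∀ {g h} → g ≈ h → P g → P h) → (∀ {g h} → g ≈ h → P h → P g) → Element
  ⟨ P ⟩ r r′ = (λ g → ⌈ P g ⌉) ,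
    λ e → Bool-ext (λ p → ⌈⌉⁺ (r e (⌈⌉⁻ p))) (λ p → ⌈⌉⁺ (r′ e (⌈⌉⁻ p)))

  complex : RawCylindricAlgebra I ℓ ℓ
  complex = record
    { Carrier = Element
    ; _≈_     = λ X Y → ∀ g → proj₁ X g ≡ proj₁ Y g
    ; _∨_     = λ (X , rX) (Y , rY) → (λ g → X g ∨ Y g) , λ e → cong₂ _∨_ (rX e) (rY e)
    ; _∧_     = λ (X , rX) (Y , rY) → (λ g → X g ∧ Y g) , λ e → cong₂ _∧_ (rX e) (rY e)
    ; -_      = λ (X , rX) → (λ g → not (X g)) , λ e → cong not (rX e)
    ; ⊤       = (λ _ → true) , λ _ → refl
    ; ⊥       = (λ _ → false) , λ _ → refl
    ; cyl     = λ i X → ⟨ (λ g → ∃ λ h → R i g h × h ∈ᵉ X) ⟩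
        (λ e (h , r , x) → h , R-trans (R-sym (≈⇒R e)) r , x)
        (λ e (h , r , x) → h , R-trans (≈⇒R e) r , x)
    ; diag    = λ i j → ⟨ D i j ⟩ D-resp D-sym≈
    }

  open RawCylindricAlgebra complex public using (cyl; diag)
  private module A = RawCylindricAlgebra complex

  cyl⁺ : ∀ {i} X {g h} → R i g h → h ∈ᵉ X → g ∈ᵉ cyl i X
  cyl⁺ X r x = ⌈⌉⁺ (_ , r , x)

  cyl⁻ : ∀ {i} X {g} → g ∈ᵉ cyl i X → ∃ λ h → R i g h × h ∈ᵉ X
  cyl⁻ X = ⌈⌉⁻

  ext : ∀ {X Y} → (∀ {g} → g ∈ᵉ X → g ∈ᵉ Y) → (∀ {g} → g ∈ᵉ Y → g ∈ᵉ X) → X A.≈ Y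
  ext f h g = Bool-ext f h

  isBooleanAlgebra : IsBooleanAlgebra A._≈_ A._∨_ A._∧_ A.-_ A.⊤ A.⊥
  isBooleanAlgebra = record
    { isDistributiveLattice = record
      { isLattice = record
        { isEquivalence = record
          { refl  = λ _ → refl
          ; sym   = λ p g → sym (p g)
          ; trans = λ p q g → trans (p g) (q g)
          }
        ; ∨-comm     = λ X Y g → Boolₚ.∨-comm (proj₁ X g) (proj₁ Y g)
        ; ∨-assoc    = λ X Y Z g → Boolₚ.∨-assoc (proj₁ X g) (proj₁ Y g) (proj₁ Z g)
        ; ∨-cong     = λ p q g → cong₂ _∨_ (p g) (q g)
        ; ∧-comm     = λ X Y g → Boolₚ.∧-comm (proj₁ X g) (proj₁ Y g)
        ; ∧-assoc    = λ X Y Z g → Boolₚ.∧-assoc (proj₁ X g) (proj₁ Y g) (proj₁ Z g)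
        ; ∧-cong     = λ p q g → cong₂ _∧_ (p g) (q g)
        ; absorptive = (λ X Y g → proj₁ Boolₚ.∨-∧-absorptive (proj₁ X g) (proj₁ Y g))
                     , (λ X Y g → proj₂ Boolₚ.∨-∧-absorptive (proj₁ X g) (proj₁ Y g))
        }
      ; ∨-distrib-∧ = (λ X Y Z g → proj₁ Boolₚ.∨-distrib-∧ (proj₁ X g) (proj₁ Y g) (proj₁ Z g))
                    , (λ X Y Z g → proj₂ Boolₚ.∨-distrib-∧ (proj₁ X g) (proj₁ Y g) (proj₁ Z g))
      ; ∧-distrib-∨ = (λ X Y Z g → proj₁ Boolₚ.∧-distrib-∨ (proj₁ X g) (proj₁ Y g) (proj₁ Z g))
                    , (λ X Y Z g → proj₂ Boolₚ.∧-distrib-∨ (proj₁ X g) (proj₁ Y g) (proj₁ Z g))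
      }
    ; ∨-complement = (λ X g → proj₁ Boolₚ.∨-inverse (proj₁ X g)) , (λ X g → proj₂ Boolₚ.∨-inverse (proj₁ X g))
    ; ∧-complement = (λ X g → proj₁ Boolₚ.∧-inverse (proj₁ X g)) , (λ X g → proj₂ Boolₚ.∧-inverse (proj₁ X g))
    ; ¬-cong       = λ p g → cong not (p g)
    }

  isCylindricAlgebra : IsCylindricAlgebra complex
  isCylindricAlgebra = record
    { isBooleanAlgebra = isBooleanAlgebra
    ; cyl-cong         = λ i {X} {Y} p → ext {cyl i X} {cyl i Y}
        (λ c → let h , r , x = cyl⁻ X c in cyl⁺ Y r (trans (sym (p h)) x))
        (λ c → let h , r , x = cyl⁻ Y c in cyl⁺ X r (trans (p h) x))
    ; cyl-⊥            = λ i → ext {cyl i A.⊥} {A.⊥} (λ c → ⊥-case (cyl⁻ A.⊥ c)) (λ ())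
    ; cyl-extensive    = λ i X → ext {X A.∨ cyl i X} {cyl i X}
        (λ e → ∨-case i X (∨⁻ e)) (λ c → ∨⁺ (inj₂ c))
    ; cyl-∧            = λ i X Y → ext {cyl i (X A.∧ cyl i Y)} {cyl i X A.∧ cyl i Y}
        (λ c → let h , r , xy = cyl⁻ (X A.∧ cyl i Y) c ; x , y = ∧⁻ xy ; h′ , r′ , y′ = cyl⁻ Y y in
          ∧⁺ (cyl⁺ X r x) (cyl⁺ Y (R-trans r r′) y′))
        (λ c → let x , y = ∧⁻ c ; h , r , x′ = cyl⁻ X x ; h′ , r′ , y′ = cyl⁻ Y y in
          cyl⁺ (X A.∧ cyl i Y) r (∧⁺ x′ (cyl⁺ Y (R-trans (R-sym r) r′) y′)))
    ; cyl-comm         = λ i j X → ext {cyl i (cyl j X)} {cyl j (cyl i X)} (swap i j X) (swap j i X)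
    ; diag-refl        = λ i → ext {diag i i} {A.⊤} (λ _ → refl) (λ _ → ⌈⌉⁺ D-refl)
    ; diag-cyl         = λ {i} {j} {k} k≢i k≢j → ext {diag i j} {cyl k (diag i k A.∧ diag k j)}
        (λ d → let h , r , d₁ , d₂ = D-split k≢i k≢j (⌈⌉⁻ d) in
          cyl⁺ (diag i k A.∧ diag k j) r (∧⁺ (⌈⌉⁺ d₁) (⌈⌉⁺ d₂)))
        (λ c → let h , r , d = cyl⁻ (diag i k A.∧ diag k j) c ; d₁ , d₂ = ∧⁻ d in
          ⌈⌉⁺ (D-join k≢i k≢j r (⌈⌉⁻ d₁) (⌈⌉⁻ d₂)))
    ; diag-complement  = λ {i} {j} i≢j X →
        ext {cyl i (diag i j A.∧ X) A.∧ cyl i (diag i j A.∧ A.- X)} {A.⊥}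
        (λ c → let c₁ , c₂ = ∧⁻ c
                   h , r , dx = cyl⁻ (diag i j A.∧ X) c₁ ; d , x = ∧⁻ dx
                   h′ , r′ , dx′ = cyl⁻ (diag i j A.∧ A.- X) c₂ ; d′ , x′ = ∧⁻ dx′ in
          ⊥-elim (not⁻ x′ (trans (sym (proj₂ X (D-unique i≢j (R-trans (R-sym r) r′) (⌈⌉⁻ d) (⌈⌉⁻ d′)))) x)))
        (λ ())
    }
    where
    ⊥-case : ∀ {i g} → (∃ λ h → R i g h × h ∈ᵉ A.⊥) → g ∈ᵉ A.⊥
    ⊥-case (_ , _ , ())

    ∨-case : ∀ i X {g} → g ∈ᵉ X ⊎ g ∈ᵉ cyl i X → g ∈ᵉ cyl i X
    ∨-case i X (inj₁ x) = cyl⁺ X R-refl x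
    ∨-case i X (inj₂ c) = c

    swap : ∀ i j X {g} → g ∈ᵉ cyl i (cyl j X) → g ∈ᵉ cyl j (cyl i X)
    swap i j X c =
      let h , r , c′ = cyl⁻ (cyl j X) c ; k , s , x = cyl⁻ X c′ ; h′ , s′ , r′ = R-comm r s in
      cyl⁺ (cyl i X) s′ (cyl⁺ X r′ x)

-- Networks

module Update (cl : Classical) {a b} {X : Set a} {Y : Set b} where

  open Logic cl

  infixl 9 _[_↦_]
  _[_↦_] : (X → Y) → X → Y → X → Y
  (f [ i ↦ y ]) x with em {P = x ≡ i}
  ... | yes _ = y
  ... | no  _ = f x

  ↦-same : ∀ f i {y} → (f [ i ↦ y ]) i ≡ y
  ↦-same f i with em {P = i ≡ i}
  ... | yes _  = refl
  ... | no i≢i = contradiction refl i≢i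

  ↦-other : ∀ f i {y x} → x ≢ i → (f [ i ↦ y ]) x ≡ f x
  ↦-other f i {x = x} x≢i with em {P = x ≡ i}
  ... | yes x≡i = contradiction x≡i x≢i
  ... | no _    = refl

module Pigeonhole (cl : Classical) where

  open Logic cl

  length-─ : ∀ {a p} {X : Set a} {P : X → Set p} {xs} (p : Any P xs) → length xs ≡ ℕ.suc (length (xs ─ p))
  length-─ (here _)           = refl
  length-─ {xs = _ ∷ _} (there p) = cong ℕ.suc (length-─ p)

  ∈-─⁺ : ∀ {a} {X : Set a} {xs : List X} {x y} (p : y ∈ xs) → x ∈ xs → x ≢ y → x ∈ (xs ─ p)
  ∈-─⁺ (here refl) (here refl) x≢y = contradiction refl x≢y
  ∈-─⁺ (here refl) (there q)   x≢y = q
  ∈-─⁺ (there p)   (here refl) x≢y = here refl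
  ∈-─⁺ (there p)   (there q)   x≢y = there (∈-─⁺ p q x≢y)

  injection-length : ∀ {a b r} {X : Set a} {Y : Set b} (R : X → Y → Set r) →
    (∀ {x x′ y} → R x y → R x′ y → x ≡ x′) →
    ∀ {xs ys} → Unique xs → (∀ {x} → x ∈ xs → ∃ λ y → y ∈ ys × R x y) →
    length xs ℕ.≤ length ys
  injection-length R inj {[]}     {ys} []         h = z≤n
  injection-length R inj {x ∷ xs} {ys} (x≢ ∷ xs!) h with h (here refl)
  ... | y , y∈ys , Rxy = subst (ℕ.suc (length xs) ℕ.≤_) (sym (length-─ y∈ys))
    (s≤s (injection-length R inj xs! λ x′∈xs → let y′ , y′∈ys , Rxy′ = h (there x′∈xs) in
      y′ , ∈-─⁺ y∈ys y′∈ys (λ { refl → All.lookup x≢ x′∈xs (inj Rxy Rxy′) }) , Rxy′))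

  -- The list may have repetitions, so lengths are compared after their removal.
  no-proper-injection : ∀ {a r} {X : Set a} (R : X → X → Set r) →
    (∀ {x x′ y} → R x y → R x′ y → x ≡ x′) →
    ∀ {xs i} → i ∈ xs → ¬ (∀ {x} → x ∈ xs → ∃ λ y → y ∈ xs × y ≢ i × R x y)
  no-proper-injection {X = X} R inj {xs} {i} i∈xs h = ℕ.<-irrefl refl
    (subst (ℕ._≤ length (ys ─ i∈ys)) (length-─ i∈ys)
      (injection-length R inj (UniqueDec.deduplicate-! _≟_ xs) λ x∈ys →
        let y , y∈xs , y≢i , Rxy = h (∈-deduplicate⁻ _≟_ xs x∈ys) in
        y , ∈-─⁺ i∈ys (∈-deduplicate⁺ _≟_ y∈xs) y≢i , Rxy))
    where
    _≟_ : (x y : X) → Dec (x ≡ y)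
    x ≟ y = em

    ys = deduplicate _≟_ xs

    i∈ys : i ∈ ys
    i∈ys = ∈-deduplicate⁺ _≟_ i∈xs

  fresh : ∀ {n} (xs : List (Fin n)) → length xs ℕ.< n → ∃ λ i → i ∉ xs
  fresh {n} xs xs<n = dne λ h → ℕ.<⇒≱ xs<n
    (subst (ℕ._≤ length xs) (length-tabulate {n = n} id)
      (injection-length _≡_ (λ p q → trans p (sym q)) (allFin⁺ n) λ {i} _ →
        i , dne (λ i∉xs → h (i , i∉xs)) , refl))

record Triple {ℓ} (A : Set ℓ) : Set ℓ where
  field
    o₀ o₁ o₂ : A
    o₀≢o₁    : o₀ ≢ o₁
    o₀≢o₂    : o₀ ≢ o₂
    o₁≢o₂    : o₁ ≢ o₂

module Networks (cl : Classical) {ℓ : Level} {A : Set ℓ} (os : Triple A) (k r ψ : ℕ) where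

  open Logic cl
  open Triple os
  open Pigeonhole cl
  module _ {a b} {X : Set a} {Y : Set b} where
    open Update cl {a} {b} {X} {Y} public

  I : Set ℓ
  I = A ⊎ Fin k

  Shade : Set
  Shade = Fin (ℕ.suc r)

  -- `cc` joins different constants. It takes part in no monochromatic triangle, so arbitrarily many
  -- constants coexist without spending colours on each other.
  data Lab : Set ℓ where
    eq  : Lab
    cc  : Lab
    col : I → Shade → Lab

  -- nothing is the sort of the constant nodes.
  Sort : Set
  Sort = Maybe (Fin ψ)

  data Edge (σ τ : Sort) : Lab → Set ℓ where
    eqᵉ  : σ ≡ τ → Edge σ τ eq
    ccᵉ  : σ ≡ nothing → τ ≡ nothing → Edge σ τ cc
    -- Excluding o₀ leaves one colour less than there are nodes in I.
    colᵉ : ∀ {c s} → c ≢ inj₁ o₀ → ¬ (σ ≡ nothing × τ ≡ nothing) → Edge σ τ (col c s)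

  Edge-sym : ∀ {σ τ l} → Edge σ τ l → Edge τ σ l
  Edge-sym (eqᵉ σ≡τ)     = eqᵉ (sym σ≡τ)
  Edge-sym (ccᵉ p q)     = ccᵉ q p
  Edge-sym (colᵉ c≢ ¬pq) = colᵉ c≢ λ (p , q) → ¬pq (q , p)

  -- `a` and `b` are the edges of a triangle at one corner and `c` is the opposite edge. A smaller
  -- shade of the same colour remains allowed for `c`, which is why the descent has to run through
  -- the shades.
  record Half (a b c : Lab) : Set ℓ where
    constructor half
    field
      eq-cong : c ≡ eq → a ≡ b
      not-bad : ∀ {x s s′} → a ≡ col x s → b ≡ col x s → c ≡ col x s′ → s′ Fin.< s

  open Half

  Half-sym : ∀ {a b c} → Half a b c → Half b a c
  Half-sym (half e n) = half (sym ∘ e) (λ p q → n q p)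

  Tri : Lab → Lab → Lab → Set ℓ
  Tri a b c = Half a b c × Half a c b × Half b c a

  Tri-swapʳ : ∀ {a b c} → Tri a b c → Tri a c b
  Tri-swapʳ (h₁ , h₂ , h₃) = h₂ , h₁ , Half-sym h₃

  Tri-swapˡ : ∀ {a b c} → Tri a b c → Tri b a c
  Tri-swapˡ (h₁ , h₂ , h₃) = Half-sym h₁ , h₃ , h₂

  Tri-eq : ∀ a → Tri eq a a
  Tri-eq a = half sym (λ ()) , half sym (λ ()) , half (λ _ → refl) (λ _ _ ())

  record Net {q} (Q : Set q) : Set (ℓ ⊔ q) where
    field
      lab      : Q → Q → Lab
      sort     : Q → Sort
      lab-refl : ∀ x → lab x x ≡ eq
      lab-sym  : ∀ x y → lab x y ≡ lab y x
      edge     : ∀ x y → Edge (sort x) (sort y) (lab x y)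
      tri      : ∀ x y z → Tri (lab x y) (lab x z) (lab y z)

    lab-cong : ∀ {x y} z → lab x y ≡ eq → lab x z ≡ lab y z
    lab-cong {x} {y} z e = eq-cong (proj₂ (proj₂ (tri x y z))) e

    lab-cong₂ : ∀ {x y x′ y′} → lab x x′ ≡ eq → lab y y′ ≡ eq → lab x y ≡ lab x′ y′
    lab-cong₂ {x} {y} {x′} {y′} e e′ = trans (lab-cong y e)
      (trans (lab-sym x′ y) (trans (lab-cong x′ e′) (lab-sym y′ x′)))

    lab-trans : ∀ {x y z} → lab x y ≡ eq → lab y z ≡ eq → lab x z ≡ eq
    lab-trans e e′ = trans (lab-cong _ e) e′

    sort-cong : ∀ {x y} → lab x y ≡ eq → sort x ≡ sort y
    sort-cong {x} {y} e with lab x y | edge x y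
    sort-cong refl | eq | eqᵉ p = p

  open Net

  pull : ∀ {p q} {P : Set p} {Q : Set q} → (P → Q) → Net Q → Net P
  pull f M = record
    { lab      = λ x y → lab M (f x) (f y)
    ; sort     = λ x → sort M (f x)
    ; lab-refl = λ x → lab-refl M (f x)
    ; lab-sym  = λ x y → lab-sym M (f x) (f y)
    ; edge     = λ x y → edge M (f x) (f y)
    ; tri      = λ x y z → tri M (f x) (f y) (f z)
    }

  infix 4 _≗ⁿ_
  record _≗ⁿ_ {q} {Q : Set q} (M N : Net Q) : Set (ℓ ⊔ q) where
    constructor _,_
    field
      lab≡  : ∀ x y → lab M x y ≡ lab N x y
      sort≡ : ∀ x → sort M x ≡ sort N x

  pull-cong : ∀ {p q} {P : Set p} {Q : Set q} {f g : P → Q} (M : Net Q) →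
              (∀ x → lab M (f x) (g x) ≡ eq) → pull f M ≗ⁿ pull g M
  pull-cong M e = (λ x y → lab-cong₂ M (e x) (e y)) , (λ x → sort-cong M (e x))

  extend : ∀ {q} {Q : Set q} (M : Net Q) (l : Q → Lab) (σ : Sort) →
           (∀ x → Edge σ (sort M x) (l x)) → (∀ x y → Tri (l x) (l y) (lab M x y)) →
           Net (Maybe Q)
  extend {Q = Q} M l σ ed tr = record
    { lab = lab′ ; sort = sort′ ; lab-refl = refl′ ; lab-sym = sym′ ; edge = edge′ ; tri = tri′ }
    where
    lab′ : Maybe Q → Maybe Q → Lab
    lab′ nothing  nothing  = eq
    lab′ nothing  (just y) = l y
    lab′ (just x) nothing  = l x
    lab′ (just x) (just y) = lab M x y

    sort′ : Maybe Q → Sort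
    sort′ nothing  = σ
    sort′ (just x) = sort M x

    refl′ : ∀ x → lab′ x x ≡ eq
    refl′ nothing  = refl
    refl′ (just x) = lab-refl M x

    sym′ : ∀ x y → lab′ x y ≡ lab′ y x
    sym′ nothing  nothing  = refl
    sym′ nothing  (just y) = refl
    sym′ (just x) nothing  = refl
    sym′ (just x) (just y) = lab-sym M x y

    edge′ : ∀ x y → Edge (sort′ x) (sort′ y) (lab′ x y)
    edge′ nothing  nothing  = eqᵉ refl
    edge′ nothing  (just y) = ed y
    edge′ (just x) nothing  = Edge-sym (ed x)
    edge′ (just x) (just y) = edge M x y

    tri′ : ∀ x y z → Tri (lab′ x y) (lab′ x z) (lab′ y z)
    tri′ nothing  nothing  nothing  = Tri-eq eq
    tri′ nothing  nothing  (just z) = Tri-eq (l z)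
    tri′ nothing  (just y) nothing  = Tri-swapˡ (Tri-eq (l y))
    tri′ nothing  (just y) (just z) = tr y z
    tri′ (just x) nothing  nothing  = Tri-swapʳ (Tri-swapˡ (Tri-eq (l x)))
    tri′ (just x) nothing  (just z) = Tri-swapʳ (tr x z)
    tri′ (just x) (just y) nothing  = Tri-swapˡ (Tri-swapʳ (tr x y))
    tri′ (just x) (just y) (just z) = tri M x y z

  -- All but finitely many j ∈ α are constants that use up the colour j.
  WeakAt : ∀ {q} {Q : Set q} → Net Q → (A → Q) → A → Set (ℓ ⊔ q)
  WeakAt M e j = sort M (e j) ≡ nothing ×
                 (∀ x → sort M x ≢ nothing → ∃ λ s → lab M (e j) x ≡ col (inj₁ j) s)

  Weak : ∀ {q} {Q : Set q} → Net Q → (A → Q) → Set (ℓ ⊔ q)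
  Weak M e = ∃ λ (Δ : List A) → ∀ j → j ∉ Δ → WeakAt M e j

  pull-weak : ∀ {p q} {P : Set p} {Q : Set q} {M : Net Q} {e : A → Q} (f : P → Q) (e′ : A → P) (Γ : List A) →
              (∀ j → j ∉ Γ → f (e′ j) ≡ e j) → Weak M e → Weak (pull f M) e′
  pull-weak {M = M} f e′ Γ h (Δ , w) = Δ ++ Γ , λ j j∉ →
    let fe≡e = h j (j∉ ∘ ∈-++⁺ʳ Δ) ; c , w′ = w j (j∉ ∘ ∈-++⁺ˡ) in
    trans (cong (sort M) fe≡e) c ,
    λ x nc → let s , l = w′ (f x) nc in s , trans (cong (λ y → lab M y (f x)) fe≡e) l

  World : Set ℓ
  World = Σ (Net I) λ g → Weak g inj₁

  net : World → Net I
  net = proj₁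

  Agree : I → Net I → Net I → Set ℓ
  Agree i g h = (∀ x y → x ≢ i → y ≢ i → lab g x y ≡ lab h x y) × (∀ x → x ≢ i → sort g x ≡ sort h x)

  Agree-sym : ∀ {i g h} → Agree i g h → Agree i h g
  Agree-sym (p , q) = (λ x y x≢ y≢ → sym (p x y x≢ y≢)) , λ x x≢ → sym (q x x≢)

  Agree-trans : ∀ {i g h m} → Agree i g h → Agree i h m → Agree i g m
  Agree-trans (p , q) (p′ , q′) =
    (λ x y x≢ y≢ → trans (p x y x≢ y≢) (p′ x y x≢ y≢)) , λ x x≢ → trans (q x x≢) (q′ x x≢)

  support : I → List A
  support (inj₁ a) = [ a ]
  support (inj₂ _) = []

  ∉support : ∀ i {j} → j ∉ support i → inj₁ j ≢ i
  ∉support (inj₁ a) j∉ refl = j∉ (here refl)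
  ∉support (inj₂ _) j∉ ()

  -- Makes `i` a duplicate of `j`: the witness for the diagonal axioms and for the degenerate cases
  -- of amalgamation.
  redirect : World → I → I → World
  redirect (g , w) i j = pull (id [ i ↦ j ]) g ,
    pull-weak {M = g} (id [ i ↦ j ]) inj₁ (support i) (λ a a∉ → ↦-other id i (∉support i a∉)) w

  redirect-agree : ∀ g i j → Agree i (net g) (net (redirect g i j))
  redirect-agree (g , _) i j =
    (λ x y x≢ y≢ → sym (cong₂ (lab g) (↦-other id i x≢) (↦-other id i y≢))) ,
    (λ x x≢ → sym (cong (sort g) (↦-other id i x≢)))

  redirect-eq : ∀ g i j → i ≢ j → lab (net (redirect g i j)) i j ≡ eq
  redirect-eq (g , _) i j i≢j =
    trans (cong₂ (lab g) (↦-same id i) (↦-other id i (i≢j ∘ sym))) (lab-refl g j)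

  -- Row `i` is a copy of row `j`, and row `j` is common to both networks.
  agree-eq : ∀ {i j : I} {g h} → i ≢ j → Agree i g h → lab g i j ≡ eq → lab h i j ≡ eq → g ≗ⁿ h
  agree-eq {i} {j} {g} {h} i≢j (p , q) e e′ = lab≡ , sort≡
    where
    row : ∀ y → y ≢ i → lab g i y ≡ lab h i y
    row y y≢i = trans (lab-cong g y e) (trans (p j y (i≢j ∘ sym) y≢i) (sym (lab-cong h y e′)))

    lab≡ : ∀ x y → lab g x y ≡ lab h x y
    lab≡ x y with em {P = x ≡ i} | em {P = y ≡ i}
    ... | no x≢i   | no y≢i   = p x y x≢i y≢i
    ... | yes refl | no y≢i   = row y y≢i
    ... | no x≢i   | yes refl = trans (lab-sym g x i) (trans (row x x≢i) (lab-sym h i x))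
    ... | yes refl | yes refl = trans (lab-refl g i) (sym (lab-refl h i))

    sort≡ : ∀ x → sort g x ≡ sort h x
    sort≡ x with em {P = x ≡ i}
    ... | no x≢i   = q x x≢i
    ... | yes refl = trans (sort-cong g e) (trans (q j (i≢j ∘ sym)) (sym (sort-cong h e′)))

-- Amalgamation of networks

module NetworkAlgebra (cl : Classical) {ℓ : Level} {A : Set ℓ} (os : Triple A) (k r ψ : ℕ) where

  open Logic cl
  open Triple os
  open Pigeonhole cl
  open Networks cl os k r ψ
  open Net

  col-injective : ∀ {l c c′ s s′} → l ≡ col c s → l ≡ col c′ s′ → c ≡ c′
  col-injective refl refl = refl

  -- Here α > 2 enters: three different indices of α cannot all lie among `i` and `j`.
  another : ∀ i j → ∃ λ (w : A) → inj₁ w ≢ i × inj₁ w ≢ j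
  another i j with em {P = inj₁ o₀ ≡ i ⊎ inj₁ o₀ ≡ j}
  ... | no h₀ = o₀ , h₀ ∘ inj₁ , h₀ ∘ inj₂
  ... | yes h₀ with em {P = inj₁ o₁ ≡ i ⊎ inj₁ o₁ ≡ j}
  ...   | no h₁ = o₁ , h₁ ∘ inj₁ , h₁ ∘ inj₂
  ...   | yes h₁ = o₂ , o₂≢ h₀ h₁
    where
    inj₁≢ : ∀ {a b : A} → a ≢ b → _≢_ {A = I} (inj₁ a) (inj₁ b)
    inj₁≢ a≢b e = a≢b (inj₁-injective e)

    o₂≢ : inj₁ o₀ ≡ i ⊎ inj₁ o₀ ≡ j → inj₁ o₁ ≡ i ⊎ inj₁ o₁ ≡ j → inj₁ o₂ ≢ i × inj₁ o₂ ≢ j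
    o₂≢ (inj₁ refl) (inj₁ e)    = contradiction (sym e) (inj₁≢ o₀≢o₁)
    o₂≢ (inj₁ refl) (inj₂ refl) = inj₁≢ (o₀≢o₂ ∘ sym) , inj₁≢ (o₁≢o₂ ∘ sym)
    o₂≢ (inj₂ refl) (inj₁ refl) = inj₁≢ (o₁≢o₂ ∘ sym) , inj₁≢ (o₀≢o₂ ∘ sym)
    o₂≢ (inj₂ refl) (inj₂ e)    = contradiction (sym e) (inj₁≢ o₀≢o₁)

  AgreeOff : I → I → Net I → Net I → Set ℓ
  AgreeOff i j g m =
    (∀ x y → x ≢ i → x ≢ j → y ≢ i → y ≢ j → lab g x y ≡ lab m x y) ×
    (∀ x → x ≢ i → x ≢ j → sort g x ≡ sort m x)

  -- As `i` already duplicates `w` in `g`, an edge of `g` away from `j` may be read with `w` in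
  -- place of `i`, and there `g` and `m` agree.
  redirect-agree₂ : ∀ {i j w} g m → AgreeOff i j (net g) (net m) → w ≢ i → w ≢ j →
                    lab (net g) i w ≡ eq → Agree j (net g) (net (redirect m i w))
  redirect-agree₂ {i} {j} {w} (g , _) (m , _) (p , q) w≢i w≢j e =
    (λ x y x≢j y≢j → trans (lab-cong₂ g (τ-eq x) (τ-eq y))
      (p (τ x) (τ y) (τ≢i x) (τ≢j x x≢j) (τ≢i y) (τ≢j y y≢j))) ,
    (λ x x≢j → trans (sort-cong g (τ-eq x)) (q (τ x) (τ≢i x) (τ≢j x x≢j)))
    where
    τ : I → I
    τ = id [ i ↦ w ]

    τ-eq : ∀ x → lab g x (τ x) ≡ eq
    τ-eq x with em {P = x ≡ i}
    ... | yes refl = e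
    ... | no _     = lab-refl g x

    τ≢i : ∀ x → τ x ≢ i
    τ≢i x with em {P = x ≡ i}
    ... | yes _  = w≢i
    ... | no x≢i = x≢i

    τ≢j : ∀ x → x ≢ j → τ x ≢ j
    τ≢j x x≢j with em {P = x ≡ i}
    ... | yes _ = w≢j
    ... | no _  = x≢j

  Kills : Net I → I → I → I → Set ℓ
  Kills g i c w = ∃ λ s → lab g i w ≡ col c s

  -- Every node kills at most one colour for the new edge, and a node outside
  -- the finite set U kills only its own colour; so some colour in U survives.
  free-colour : ∀ (i j : I) (g m : World) → ¬ (sort (net m) j ≡ nothing × sort (net g) i ≡ nothing) →
    i ≢ j → ∃ λ c → c ≢ inj₁ o₀ ×
    (∀ w → w ≢ i → w ≢ j → ¬ (Kills (net m) j c w × Kills (net g) i c w))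
  free-colour i j (g , Δg , wg) (m , Δm , wm) nc i≢j = dne λ none →
    no-proper-injection R R-inj {U} {j} (there (here refl)) λ {c} c∈U → killer none c∈U em
    where
    U : List I
    U = i ∷ j ∷ inj₁ o₀ ∷ map inj₁ (Δg ++ Δm) ++ map inj₂ (allFin k)

    -- The forbidden colour `o₀` is charged to the node `i`, any other colour to a node that kills
    -- it. Nothing is charged to `j`, so the members of `U` as colours would be injected into fewer
    -- members of `U` as nodes.
    R : I → I → Set ℓ
    R c w = c ≡ inj₁ o₀ × w ≡ i ⊎
            w ≢ i × w ≢ j × Kills m j c w × Kills g i c w

    R-inj : ∀ {c c′ w} → R c w → R c′ w → c ≡ c′
    R-inj (inj₁ (p , _)) (inj₁ (q , _)) = trans p (sym q)
    R-inj (inj₁ (_ , w≡i)) (inj₂ (w≢i , _)) = contradiction w≡i w≢i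
    R-inj (inj₂ (w≢i , _)) (inj₁ (_ , w≡i)) = contradiction w≡i w≢i
    R-inj (inj₂ (_ , _ , (_ , l) , _)) (inj₂ (_ , _ , (_ , l′) , _)) = col-injective l l′

    outside : ∀ {w} → w ∉ U → ∃ λ a → w ≡ inj₁ a × a ∉ Δg × a ∉ Δm
    outside {inj₁ a} w∉U = a , refl ,
      (λ a∈ → w∉U (there (there (there (∈-++⁺ˡ (∈-map⁺ inj₁ (∈-++⁺ˡ a∈))))))) ,
      (λ a∈ → w∉U (there (there (there (∈-++⁺ˡ (∈-map⁺ inj₁ (∈-++⁺ʳ Δg a∈)))))))
    outside {inj₂ b} w∉U = contradiction
      (there (there (there (∈-++⁺ʳ (map inj₁ (Δg ++ Δm)) (∈-map⁺ inj₂ (∈-allFin b)))))) w∉U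

    own : ∀ {c w} → w ∉ U → Kills m j c w → Kills g i c w → c ≡ w
    own w∉U (_ , km) (_ , kg) with outside w∉U
    ... | a , refl , a∉g , a∉m with em {P = sort m j ≡ nothing}
    ...   | no vn  = col-injective km (trans (lab-sym m j (inj₁ a)) (proj₂ (proj₂ (wm a a∉m) j vn)))
    ...   | yes vc = col-injective kg (trans (lab-sym g i (inj₁ a))
                       (proj₂ (proj₂ (wg a a∉g) i λ uc → nc (vc , uc))))

    killer : ¬ (∃ λ c → c ≢ inj₁ o₀ × (∀ w → w ≢ i → w ≢ j → ¬ (Kills m j c w × Kills g i c w))) →
             ∀ {c} → c ∈ U → Dec (c ≡ inj₁ o₀) → ∃ λ w → w ∈ U × w ≢ j × R c w
    killer none c∈U (yes c≡) = i , here refl , i≢j , inj₁ (c≡ , refl)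
    killer none {c} c∈U (no c≢) = dne λ h → none (c , c≢ , λ w w≢i w≢j (km , kg) →
      h (w , dne (λ w∉U → w∉U (subst (_∈ U) (own w∉U km kg) c∈U)) , w≢j , inj₂ (w≢i , w≢j , km , kg)))

  connection : ∀ (i j : I) (g m : World) → i ≢ j → ∃ λ l → l ≢ eq ×
    Edge (sort (net m) j) (sort (net g) i) l ×
    (∀ {c s} → l ≡ col c s → ∀ w → w ≢ i → w ≢ j → ¬ (Kills (net m) j c w × Kills (net g) i c w))
  connection i j g m i≢j with em {P = sort (net m) j ≡ nothing × sort (net g) i ≡ nothing}
  ... | yes (vc , uc) = cc , (λ ()) , ccᵉ vc uc , λ ()
  ... | no nc with free-colour i j g m nc i≢j
  -- The shade is arbitrary: no triangle on the new edge has all three edges of colour `c`.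
  ...   | c , c≢ , h = col c Fin.zero , (λ ()) , colᵉ c≢ nc , λ { refl → h }

  -- The main case of amalgamation: `i` is a genuinely new node in `g` and so is `j` in `m`, hence
  -- only the label between these two has to be found.
  module Glue (i j : I) (i≢j : i ≢ j) (𝔤 𝔪 : World) (off : AgreeOff i j (net 𝔤) (net 𝔪))
              (g-new : ∀ w → w ≢ i → w ≢ j → lab (net 𝔤) i w ≢ eq)
              (m-new : ∀ w → w ≢ i → w ≢ j → lab (net 𝔪) j w ≢ eq) where

    private
      g = net 𝔤
      m = net 𝔪

      w₀ : I
      w₀ = inj₁ (proj₁ (another i j))

      w₀≢i : w₀ ≢ i
      w₀≢i = proj₁ (proj₂ (another i j))

      w₀≢j : w₀ ≢ j
      w₀≢j = proj₂ (proj₂ (another i j))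

      -- The node `j` of `g` is unrelated to that of `m` and has to disappear. It is overwritten by
      -- a duplicate of `w₀`; then the node `j` of `m` is added as a new point.
      τ : I → I
      τ = id [ j ↦ w₀ ]

      τ≢j : ∀ x → τ x ≢ j
      τ≢j x with em {P = x ≡ j}
      ... | yes _  = w₀≢j
      ... | no x≢j = x≢j

      τ≢i : ∀ x → x ≢ i → τ x ≢ i
      τ≢i x x≢i with em {P = x ≡ j}
      ... | yes _ = w₀≢i
      ... | no _  = x≢i

      τi≡i : τ i ≡ i
      τi≡i = ↦-other id j i≢j

      l* : Lab
      l* = proj₁ (connection i j 𝔤 𝔪 i≢j)

      l*≢eq : l* ≢ eq
      l*≢eq = proj₁ (proj₂ (connection i j 𝔤 𝔪 i≢j))

      l*-edge : Edge (sort m j) (sort g i) l*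
      l*-edge = proj₁ (proj₂ (proj₂ (connection i j 𝔤 𝔪 i≢j)))

      l*-ok : ∀ {c s} → l* ≡ col c s → ∀ w → w ≢ i → w ≢ j → ¬ (Kills m j c w × Kills g i c w)
      l*-ok = proj₂ (proj₂ (proj₂ (connection i j 𝔤 𝔪 i≢j)))

      l : I → Lab
      l = (λ x → lab m j (τ x)) [ i ↦ l* ]

      ed : ∀ x → Edge (sort m j) (sort g (τ x)) (l x)
      ed x with em {P = x ≡ i}
      ... | yes refl = subst (λ y → Edge (sort m j) (sort g y) l*) (sym τi≡i) l*-edge
      ... | no x≢i   = subst (λ σ → Edge (sort m j) σ (lab m j (τ x)))
                         (sym (proj₂ off (τ x) (τ≢i x x≢i) (τ≢j x))) (edge m j (τ x))

      new-tri : ∀ w → w ≢ i → w ≢ j → Tri l* (lab m j w) (lab g i w)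
      new-tri w w≢i w≢j =
        half (λ e → contradiction e (g-new w w≢i w≢j)) (λ p q t → ⊥-elim (l*-ok p w w≢i w≢j ((_ , q) , (_ , t)))) ,
        half (λ e → contradiction e (m-new w w≢i w≢j)) (λ p q t → ⊥-elim (l*-ok p w w≢i w≢j ((_ , t) , (_ , q)))) ,
        half (λ e → contradiction e l*≢eq) (λ p q t → ⊥-elim (l*-ok t w w≢i w≢j ((_ , p) , (_ , q))))

      tr : ∀ x y → Tri (l x) (l y) (lab g (τ x) (τ y))
      tr x y with em {P = x ≡ i} | em {P = y ≡ i}
      ... | yes refl | yes refl = subst (Tri l* l*) (sym (lab-refl g (τ i))) (Tri-swapʳ (Tri-swapˡ (Tri-eq l*)))
      ... | yes refl | no y≢i   = subst (λ z → Tri l* (lab m j (τ y)) (lab g z (τ y))) (sym τi≡i)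
                                    (new-tri (τ y) (τ≢i y y≢i) (τ≢j y))
      ... | no x≢i   | yes refl = subst (λ z → Tri (lab m j (τ x)) l* z)
                                    (trans (lab-sym g i (τ x)) (cong (lab g (τ x)) (sym τi≡i)))
                                    (Tri-swapˡ (new-tri (τ x) (τ≢i x x≢i) (τ≢j x)))
      ... | no x≢i   | no y≢i   = subst (Tri (lab m j (τ x)) (lab m j (τ y)))
                                    (sym (proj₁ off (τ x) (τ y) (τ≢i x x≢i) (τ≢j x) (τ≢i y y≢i) (τ≢j y)))
                                    (tri m j (τ x) (τ y))

      ext : Net (Maybe I)
      ext = extend (pull τ g) l (sort m j) ed tr

      φ : I → Maybe I
      φ = just [ j ↦ nothing ]

      glue-net : Net I
      glue-net = pull φ ext

      sort-old : ∀ x → x ≢ j → sort glue-net x ≡ sort g x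
      sort-old x x≢j = trans (cong (sort ext) (↦-other just j x≢j)) (cong (sort g) (↦-other id j x≢j))

      lab-old : ∀ x y → x ≢ j → y ≢ j → lab glue-net x y ≡ lab g x y
      lab-old x y x≢j y≢j = trans (cong₂ (lab ext) (↦-other just j x≢j) (↦-other just j y≢j))
        (cong₂ (lab g) (↦-other id j x≢j) (↦-other id j y≢j))

      sort-new : sort glue-net j ≡ sort m j
      sort-new = cong (sort ext) (↦-same just j)

      lab-new : ∀ x → x ≢ i → x ≢ j → lab glue-net j x ≡ lab m j x
      lab-new x x≢i x≢j = trans (cong₂ (lab ext) (↦-same just j) (↦-other just j x≢j))
        (trans (↦-other (λ x → lab m j (τ x)) i x≢i) (cong (lab m j) (↦-other id j x≢j)))

      glue-weak : Weak glue-net inj₁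
      glue-weak = (support i ++ support j) ++ (proj₁ (proj₂ 𝔤) ++ proj₁ (proj₂ 𝔪)) , λ a a∉ →
        let a≢i = ∉support i (a∉ ∘ ∈-++⁺ˡ ∘ ∈-++⁺ˡ)
            a≢j = ∉support j (a∉ ∘ ∈-++⁺ˡ ∘ ∈-++⁺ʳ (support i))
            ac , ag = proj₂ (proj₂ 𝔤) a (a∉ ∘ ∈-++⁺ʳ (support i ++ support j) ∘ ∈-++⁺ˡ)
            _  , am = proj₂ (proj₂ 𝔪) a (a∉ ∘ ∈-++⁺ʳ (support i ++ support j) ∘ ∈-++⁺ʳ (proj₁ (proj₂ 𝔤)))
        in trans (sort-old (inj₁ a) a≢j) ac ,
           λ x nc → case em {P = x ≡ j} of λ
             { (yes refl) → let s , e = am j (nc ∘ trans sort-new) in s ,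
                 trans (lab-sym glue-net (inj₁ a) j) (trans (lab-new (inj₁ a) a≢i a≢j)
                   (trans (lab-sym m j (inj₁ a)) e))
             ; (no x≢j) → let s , e = ag x (nc ∘ trans (sort-old x x≢j)) in s ,
                 trans (lab-old (inj₁ a) x a≢j x≢j) e
             }

    glue : World
    glue = glue-net , glue-weak

    glue-agreeˡ : Agree j g (net glue)
    glue-agreeˡ = (λ x y x≢j y≢j → sym (lab-old x y x≢j y≢j)) , λ x x≢j → sym (sort-old x x≢j)

    glue-agreeʳ : Agree i (net glue) m
    glue-agreeʳ = lab≡ , sort≡
      where
      lab≡ : ∀ x y → x ≢ i → y ≢ i → lab glue-net x y ≡ lab m x y
      lab≡ x y x≢i y≢i = by em em
        where
        by : Dec (x ≡ j) → Dec (y ≡ j) → lab glue-net x y ≡ lab m x y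
        by (yes refl) (yes refl) = trans (lab-refl glue-net j) (sym (lab-refl m j))
        by (yes refl) (no y≢j)   = lab-new y y≢i y≢j
        by (no x≢j)   (yes refl) = trans (lab-sym glue-net x j) (trans (lab-new x x≢i x≢j) (lab-sym m j x))
        by (no x≢j)   (no y≢j)   = trans (lab-old x y x≢j y≢j) (proj₁ off x y x≢i x≢j y≢i y≢j)

      sort≡ : ∀ x → x ≢ i → sort glue-net x ≡ sort m x
      sort≡ x x≢i = by em
        where
        by : Dec (x ≡ j) → sort glue-net x ≡ sort m x
        by (yes refl) = sort-new
        by (no x≢j)   = trans (sort-old x x≢j) (proj₂ off x x≢i x≢j)

  -- This is the commutation of cylindrifications. If `i` in `g` or `j` in `m` duplicates a third
  -- node, the duplication is copied into the other network; otherwise `Glue` applies.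
  amalgamate : ∀ {i j : I} (g h m : World) → Agree i (net g) (net h) → Agree j (net h) (net m) →
               ∃ λ h′ → Agree j (net g) (net h′) × Agree i (net h′) (net m)
  amalgamate {i} {j} g h m g~h h~m with em {P = i ≡ j}
  ... | yes refl = g , ((λ _ _ _ _ → refl) , λ _ _ → refl) , Agree-trans {i} {net g} {net h} {net m} g~h h~m
  ... | no i≢j   = cases em em
    where
    off : AgreeOff i j (net g) (net m)
    off = (λ x y x≢i x≢j y≢i y≢j → trans (proj₁ g~h x y x≢i y≢i) (proj₁ h~m x y x≢j y≢j)) ,
          (λ x x≢i x≢j → trans (proj₂ g~h x x≢i) (proj₂ h~m x x≢j))

    off′ : AgreeOff j i (net m) (net g)
    off′ = (λ x y x≢j x≢i y≢j y≢i → sym (proj₁ off x y x≢i x≢j y≢i y≢j)) ,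
           (λ x x≢j x≢i → sym (proj₂ off x x≢i x≢j))

    cases : Dec (∃ λ w → w ≢ i × w ≢ j × lab (net g) i w ≡ eq) →
            Dec (∃ λ w → w ≢ i × w ≢ j × lab (net m) j w ≡ eq) →
            ∃ λ h′ → Agree j (net g) (net h′) × Agree i (net h′) (net m)
    cases (yes (w , w≢i , w≢j , e)) _ = redirect m i w ,
      redirect-agree₂ g m off w≢i w≢j e , Agree-sym {i} {net m} {net (redirect m i w)} (redirect-agree m i w)
    cases (no _) (yes (w , w≢i , w≢j , e)) = redirect g j w ,
      redirect-agree g j w , Agree-sym {i} {net m} {net (redirect g j w)} (redirect-agree₂ m g off′ w≢j w≢i e)
    cases (no ¬g) (no ¬m) = glue , glue-agreeˡ , glue-agreeʳ
      where open Glue i j i≢j g m off (λ w p q e → ¬g (w , p , q , e)) (λ w p q e → ¬m (w , p , q , e))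

  frame : Frame I
  frame = record
    { World    = World
    ; _≈_      = λ g h → net g ≗ⁿ net h
    ; R        = λ i g h → Agree i (net g) (net h)
    ; D        = λ i j g → lab (net g) i j ≡ eq
    ; ≈⇒R      = λ (p , q) → (λ x y _ _ → p x y) , (λ x _ → q x)
    ; R-refl   = (λ _ _ _ _ → refl) , (λ _ _ → refl)
    ; R-sym    = λ {i} {g} {h} → Agree-sym {i} {net g} {net h}
    ; R-trans  = λ {i} {g} {h} {m} → Agree-trans {i} {net g} {net h} {net m}
    ; R-comm   = λ {i} {j} {g} {h} {m} → amalgamate g h m
    ; D-resp   = λ {i} {j} (p , _) d → trans (sym (p i j)) d
    ; D-sym≈   = λ {i} {j} (p , _) d → trans (p i j) d
    ; D-refl   = λ {i} {g} → lab-refl (net g) i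
    ; D-split  = λ {i} {j} {x} {g} x≢i x≢j d → redirect g x i , redirect-agree g x i ,
        trans (lab-sym (net (redirect g x i)) i x) (redirect-eq g x i x≢i) ,
        trans (cong₂ (lab (net g)) (↦-same id x) (↦-other id x (x≢j ∘ sym))) d
    ; D-join   = λ {i} {j} {x} {g} {h} x≢i x≢j (p , _) d d′ →
        trans (p i j (x≢i ∘ sym) (x≢j ∘ sym)) (lab-trans (net h) d d′)
    ; D-unique = λ {i} {j} {g} {h} i≢j a d d′ → agree-eq i≢j a d d′
    }

  open ComplexAlgebra cl frame public

-- Non-embeddability

module CylindricProperties {a c e} {J : Set a} {𝔇 : RawCylindricAlgebra J c e}
                           (isCA : IsCylindricAlgebra 𝔇) where

  open RawCylindricAlgebra 𝔇 public
  open IsCylindricAlgebra isCA public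
  open IsBooleanAlgebra isBooleanAlgebra public
    using (∧-cong; ∧-congˡ; ∧-congʳ; ∨-cong; ∧-comm; ∧-assoc; ∧-distribˡ-∨; ∨-complementʳ)
    renaming (refl to ≈-refl; sym to ≈-sym; trans to ≈-trans)
  open BooleanAlgebraProperties booleanAlgebra public using (∧-identityˡ; ∧-identityʳ; ∨-identityˡ; ∧-zeroʳ; ∧-zeroˡ)
  open OrderLattice.Lattice
    (LatticeProperties.∨-∧-orderTheoreticLattice (BooleanAlgebra.lattice booleanAlgebra)) public
    using (_≤_; poset; antisym; x∧y≤x; x∧y≤y; ∧-greatest; x≤x∨y; y≤x∨y; ∨-least)
    renaming (refl to ≤-refl; reflexive to ≤-reflexive; trans to ≤-trans)
  open PosetReasoning poset

  x≤⊤ : ∀ x → x ≤ ⊤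
  x≤⊤ x = ≈-sym (∧-identityʳ x)

  ⊥≤x : ∀ x → ⊥ ≤ x
  ⊥≤x x = ≈-sym (∧-zeroˡ x)

  x≤⊥⇒x≈⊥ : ∀ {x} → x ≤ ⊥ → x ≈ ⊥
  x≤⊥⇒x≈⊥ x≤⊥ = antisym x≤⊥ (⊥≤x _)

  ∧-mono : ∀ {x y x′ y′} → x ≤ x′ → y ≤ y′ → x ∧ y ≤ x′ ∧ y′
  ∧-mono x≤x′ y≤y′ = ∧-greatest (≤-trans (x∧y≤x _ _) x≤x′) (≤-trans (x∧y≤y _ _) y≤y′)

  disjoint⇒≤- : ∀ {x y} → x ∧ y ≈ ⊥ → y ≤ - x
  disjoint⇒≤- {x} {y} d = ≈-sym (begin-equality
    y ∧ - x              ≈⟨ ∨-identityˡ _ ⟨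
    ⊥ ∨ y ∧ - x          ≈⟨ ∨-cong (≈-sym d) ≈-refl ⟩
    x ∧ y ∨ y ∧ - x      ≈⟨ ∨-cong (∧-comm x y) ≈-refl ⟩
    y ∧ x ∨ y ∧ - x      ≈⟨ ∧-distribˡ-∨ y x (- x) ⟨
    y ∧ (x ∨ - x)        ≈⟨ ∧-congˡ (∨-complementʳ x) ⟩
    y ∧ ⊤                ≈⟨ ∧-identityʳ y ⟩
    y                    ∎)

  Closed : J → Carrier → Set e
  Closed i x = cyl i x ≈ x

  x≤cyl : ∀ i x → x ≤ cyl i x
  x≤cyl i x = ≤-trans (x≤x∨y x (cyl i x)) (≤-reflexive (cyl-extensive i x))

  cyl-∧-closed : ∀ {i x y} → Closed i y → cyl i (x ∧ y) ≈ cyl i x ∧ y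
  cyl-∧-closed {i} {x} {y} cy = begin-equality
    cyl i (x ∧ y)        ≈⟨ cyl-cong i (∧-congˡ cy) ⟨
    cyl i (x ∧ cyl i y)  ≈⟨ cyl-∧ i x y ⟩
    cyl i x ∧ cyl i y    ≈⟨ ∧-congˡ cy ⟩
    cyl i x ∧ y          ∎

  cyl-⊤ : ∀ i → cyl i ⊤ ≈ ⊤
  cyl-⊤ i = antisym (x≤⊤ _) (x≤cyl i ⊤)

  cyl-idem : ∀ i x → Closed i (cyl i x)
  cyl-idem i x = begin-equality
    cyl i (cyl i x)      ≈⟨ cyl-cong i (∧-identityˡ (cyl i x)) ⟨
    cyl i (⊤ ∧ cyl i x)  ≈⟨ cyl-∧ i ⊤ x ⟩
    cyl i ⊤ ∧ cyl i x    ≈⟨ ∧-congʳ (cyl-⊤ i) ⟩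
    ⊤ ∧ cyl i x          ≈⟨ ∧-identityˡ (cyl i x) ⟩
    cyl i x              ∎

  cyl-mono : ∀ i {x y} → x ≤ y → cyl i x ≤ cyl i y
  cyl-mono i {x} {y} x≤y = begin
    cyl i x                ≈⟨ cyl-cong i (≈-trans x≤y (∧-congˡ y≤cy)) ⟩
    cyl i (x ∧ (y ∧ cyl i y)) ≈⟨ cyl-cong i (∧-assoc x y _) ⟨
    cyl i ((x ∧ y) ∧ cyl i y) ≈⟨ cyl-∧ i (x ∧ y) y ⟩
    cyl i (x ∧ y) ∧ cyl i y ≤⟨ x∧y≤y _ _ ⟩
    cyl i y                ∎
    where
    y≤cy : y ≈ y ∧ cyl i y
    y≤cy = x≤cyl i y

  Closed-resp : ∀ {i x y} → x ≈ y → Closed i x → Closed i y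
  Closed-resp {i} x≈y cx = ≈-trans (cyl-cong i (≈-sym x≈y)) (≈-trans cx x≈y)

  Closed-⊤ : ∀ {i} → Closed i ⊤
  Closed-⊤ = cyl-⊤ _

  Closed-∧ : ∀ {i x y} → Closed i x → Closed i y → Closed i (x ∧ y)
  Closed-∧ cx cy = ≈-trans (cyl-∧-closed cy) (∧-congʳ cx)

  Closed-cyl : ∀ {i} j {x} → Closed i x → Closed i (cyl j x)
  Closed-cyl {i} j {x} cx = ≈-trans (cyl-comm i j x) (cyl-cong j cx)

  Closed-diag : ∀ {i j k} → k ≢ i → k ≢ j → Closed k (diag i j)
  Closed-diag {k = k} k≢i k≢j = Closed-resp (≈-sym (diag-cyl k≢i k≢j)) (cyl-idem k _)

  cyl-diagʳ : ∀ {i j} → j ≢ i → cyl j (diag i j) ≈ ⊤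
  cyl-diagʳ {i} {j} j≢i = antisym (x≤⊤ _) (begin
    ⊤                            ≈⟨ diag-refl i ⟨
    diag i i                     ≈⟨ diag-cyl j≢i j≢i ⟩
    cyl j (diag i j ∧ diag j i)  ≤⟨ cyl-mono j (x∧y≤x _ _) ⟩
    cyl j (diag i j)             ∎)

  -- The substitution operator, which replaces the variable `i` by `j`.
  subs : J → J → Carrier → Carrier
  subs i j x = cyl i (diag i j ∧ x)

  subs-mono : ∀ i j {x y} → x ≤ y → subs i j x ≤ subs i j y
  subs-mono i j x≤y = cyl-mono i (∧-mono ≤-refl x≤y)

  -- Disjointness means `y ≤ - x`, and `diag-complement` separates the substitution of `x` from that
  -- of its complement.
  subs-disjoint : ∀ {i j x y} → i ≢ j → x ∧ y ≈ ⊥ → subs i j x ∧ subs i j y ≈ ⊥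
  subs-disjoint {i} {j} {x} i≢j d = x≤⊥⇒x≈⊥ (≤-trans
    (∧-mono ≤-refl (subs-mono i j (disjoint⇒≤- d))) (≤-reflexive (diag-complement i≢j x)))

  subs-∧-closed : ∀ {i j x y} → Closed i y → subs i j (x ∧ y) ≈ subs i j x ∧ y
  subs-∧-closed {i} {j} {x} {y} cy = ≈-trans (cyl-cong i (≈-sym (∧-assoc _ x y))) (cyl-∧-closed cy)

  subs-comm : ∀ {i j i′ j′} → i ≢ i′ → i ≢ j′ → i′ ≢ j → ∀ x →
              subs i j (subs i′ j′ x) ≈ subs i′ j′ (subs i j x)
  subs-comm {i} {j} {i′} {j′} i≢i′ i≢j′ i′≢j x = begin-equality
    cyl i (diag i j ∧ cyl i′ (diag i′ j′ ∧ x))    ≈⟨ cyl-cong i (pull (i≢i′ ∘ ≡.sym) i′≢j) ⟩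
    cyl i (cyl i′ (diag i j ∧ diag i′ j′ ∧ x))    ≈⟨ cyl-comm i i′ _ ⟩
    cyl i′ (cyl i (diag i j ∧ diag i′ j′ ∧ x))    ≈⟨ cyl-cong i′ (cyl-cong i shuffle) ⟩
    cyl i′ (cyl i (diag i′ j′ ∧ diag i j ∧ x))    ≈⟨ cyl-cong i′ (pull i≢i′ i≢j′) ⟨
    cyl i′ (diag i′ j′ ∧ cyl i (diag i j ∧ x))    ∎
    where
    pull : ∀ {i j k y} → k ≢ i → k ≢ j → diag i j ∧ cyl k y ≈ cyl k (diag i j ∧ y)
    pull {i} {j} {k} {y} k≢i k≢j = begin-equality
      diag i j ∧ cyl k y    ≈⟨ ∧-comm _ _ ⟩
      cyl k y ∧ diag i j    ≈⟨ cyl-∧-closed (Closed-diag k≢i k≢j) ⟨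
      cyl k (y ∧ diag i j)  ≈⟨ cyl-cong k (∧-comm _ _) ⟩
      cyl k (diag i j ∧ y)  ∎

    shuffle : diag i j ∧ diag i′ j′ ∧ x ≈ diag i′ j′ ∧ diag i j ∧ x
    shuffle = begin-equality
      diag i j ∧ diag i′ j′ ∧ x    ≈⟨ ∧-assoc _ _ x ⟨
      (diag i j ∧ diag i′ j′) ∧ x  ≈⟨ ∧-congʳ (∧-comm _ _) ⟩
      (diag i′ j′ ∧ diag i j) ∧ x  ≈⟨ ∧-assoc _ _ x ⟩
      diag i′ j′ ∧ diag i j ∧ x    ∎

  -- Renaming of a bound variable: as `x` does not depend on `j`, the equation
  -- `cyl j (diag i j) ≈ ⊤` can be inserted and the two cylindrifications exchanged.
  cyl-rename : ∀ {i j x} → i ≢ j → Closed j x → cyl i x ≈ cyl j (subs i j x)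
  cyl-rename {i} {j} {x} i≢j cx = begin-equality
    cyl i x                       ≈⟨ cyl-cong i (∧-identityˡ x) ⟨
    cyl i (⊤ ∧ x)                 ≈⟨ cyl-cong i (∧-congʳ (cyl-diagʳ (i≢j ∘ ≡.sym))) ⟨
    cyl i (cyl j (diag i j) ∧ x)  ≈⟨ cyl-cong i (cyl-∧-closed cx) ⟨
    cyl i (cyl j (diag i j ∧ x))  ≈⟨ cyl-comm i j _ ⟩
    cyl j (subs i j x)            ∎

  closed-meet-⊥ : ∀ {i x y} → Closed i x → x ∧ y ≈ ⊥ → x ∧ cyl i y ≈ ⊥
  closed-meet-⊥ {i} {x} {y} cx d = begin-equality
    x ∧ cyl i y    ≈⟨ ∧-comm _ _ ⟩
    cyl i y ∧ x    ≈⟨ cyl-∧-closed cx ⟨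
    cyl i (y ∧ x)  ≈⟨ cyl-cong i (≈-trans (∧-comm y x) d) ⟩
    cyl i ⊥        ≈⟨ cyl-⊥ i ⟩
    ⊥              ∎

  ⋀ : ∀ {x} {X : Set x} → List X → (X → Carrier) → Carrier
  ⋀ xs f = foldr (λ x y → f x ∧ y) ⊤ xs

  ⋁ : ∀ {x} {X : Set x} → List X → (X → Carrier) → Carrier
  ⋁ xs f = foldr (λ x y → f x ∨ y) ⊥ xs

  module _ {x} {X : Set x} {f : X → Carrier} where

    ⋀-lower : ∀ {xs i} → i ∈ xs → ⋀ xs f ≤ f i
    ⋀-lower (here ≡.refl) = x∧y≤x _ _
    ⋀-lower (there i∈xs)  = ≤-trans (x∧y≤y _ _) (⋀-lower i∈xs)

    ⋀-greatest : ∀ {xs z} → (∀ {i} → i ∈ xs → z ≤ f i) → z ≤ ⋀ xs f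
    ⋀-greatest {[]}     h = x≤⊤ _
    ⋀-greatest {i ∷ xs} h = ∧-greatest (h (here ≡.refl)) (⋀-greatest (h ∘ there))

    ⋀-closed : ∀ {xs j} → (∀ {i} → i ∈ xs → Closed j (f i)) → Closed j (⋀ xs f)
    ⋀-closed {[]}     h = Closed-⊤
    ⋀-closed {i ∷ xs} h = Closed-∧ (h (here ≡.refl)) (⋀-closed (h ∘ there))

    ⋁-upper : ∀ {xs i} → i ∈ xs → f i ≤ ⋁ xs f
    ⋁-upper (here ≡.refl) = x≤x∨y _ _
    ⋁-upper (there i∈xs)  = ≤-trans (⋁-upper i∈xs) (y≤x∨y _ _)

    ⋁-disjoint : ∀ {xs z} → (∀ {i} → i ∈ xs → z ∧ f i ≈ ⊥) → z ∧ ⋁ xs f ≈ ⊥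
    ⋁-disjoint {[]}     h = ∧-zeroʳ _
    ⋁-disjoint {i ∷ xs} {z} h = begin-equality
      z ∧ (f i ∨ ⋁ xs f)      ≈⟨ ∧-distribˡ-∨ z (f i) (⋁ xs f) ⟩
      z ∧ f i ∨ z ∧ ⋁ xs f    ≈⟨ ∨-cong (h (here ≡.refl)) (⋁-disjoint (h ∘ there)) ⟩
      ⊥ ∨ ⊥                   ≈⟨ ∨-identityˡ ⊥ ⟩
      ⊥                       ∎

-- Pigeonhole principle and bookkeeping for the descent

module Majority (cl : Classical) where

  open Logic cl

  record Split {a p} {X : Set a} (P : X → Set p) (xs : List X) : Set (a ⊔ p) where
    field
      inside outside : List X
      inside-unique  : Unique inside
      outside-unique : Unique outside
      inside⁻  : ∀ {x} → x ∈ inside → x ∈ xs × P x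
      outside⁻ : ∀ {x} → x ∈ outside → x ∈ xs × ¬ P x
      lengths  : length xs ≡ length inside + length outside

  split : ∀ {a p} {X : Set a} (P : X → Set p) {xs : List X} → Unique xs → Split P xs
  split P [] = record
    { inside = [] ; outside = [] ; inside-unique = [] ; outside-unique = []
    ; inside⁻ = λ () ; outside⁻ = λ () ; lengths = ≡.refl }
  split P {x ∷ xs} (x≢ ∷ xs!) with split P xs! | em {P = P x}
  ... | s | yes px = record
    { inside = x ∷ inside ; outside = outside
    ; inside-unique = All.tabulate (λ y∈ → All.lookup x≢ (proj₁ (inside⁻ y∈))) ∷ inside-unique
    ; outside-unique = outside-unique
    ; inside⁻ = λ { (here ≡.refl) → here ≡.refl , px
                  ; (there y∈) → let y∈xs , py = inside⁻ y∈ in there y∈xs , py }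
    ; outside⁻ = λ y∈ → let y∈xs , py = outside⁻ y∈ in there y∈xs , py
    ; lengths = ≡.cong ℕ.suc lengths }
    where open Split s
  ... | s | no ¬px = record
    { inside = inside ; outside = x ∷ outside
    ; inside-unique = inside-unique
    ; outside-unique = All.tabulate (λ y∈ → All.lookup x≢ (proj₁ (outside⁻ y∈))) ∷ outside-unique
    ; inside⁻ = λ y∈ → let y∈xs , py = inside⁻ y∈ in there y∈xs , py
    ; outside⁻ = λ { (here ≡.refl) → here ≡.refl , ¬px
                   ; (there y∈) → let y∈xs , py = outside⁻ y∈ in there y∈xs , py }
    ; lengths = ≡.trans (≡.cong ℕ.suc lengths) (≡.sym (ℕ.+-suc (length inside) (length outside))) }
    where open Split s

  -- For each label in turn, either more than `n` elements carry it or discarding it costs at most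
  -- `n` elements.
  majority : ∀ {a b p} {X : Set a} {Y : Set b} (P : Y → X → Set p) (n : ℕ) (ys : List Y) {xs : List X} →
    Unique xs → (∀ {x} → x ∈ xs → ∃ λ y → y ∈ ys × P y x) → length ys * n ℕ.< length xs →
    ∃ λ y → y ∈ ys × ∃ λ xs′ → Unique xs′ × n ℕ.< length xs′ × (∀ {x} → x ∈ xs′ → x ∈ xs × P y x)
  majority P n []       {x ∷ xs} xs! h _ = case h (here ≡.refl) of λ ()
  majority P n (y ∷ ys) {xs} xs! h n<xs with split (P y) xs!
  ... | s with n ℕ.<? length (Split.inside s)
  ...   | yes n< = y , here ≡.refl , inside , inside-unique , n< , inside⁻
    where open Split s
  ...   | no n≮ = let y′ , y′∈ , rest = majority P n ys outside-unique h′ ys<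
                      xs′ , xs′! , n< , f = rest in
                  y′ , there y′∈ , xs′ , xs′! , n< , λ x∈ → let x∈o , p = f x∈ in proj₁ (outside⁻ x∈o) , p
    where
    open Split s
    h′ : ∀ {x} → x ∈ outside → ∃ λ y′ → y′ ∈ ys × P y′ x
    h′ x∈o with outside⁻ x∈o
    ... | x∈xs , ¬py with h x∈xs
    ...   | _  , here ≡.refl , py = contradiction py ¬py
    ...   | y′ , there y′∈ , py   = y′ , y′∈ , py

    ys< : length ys * n ℕ.< length outside
    ys< = ℕ.+-cancelˡ-< n _ _ (ℕ.<-≤-trans (≡.subst (n + length ys * n ℕ.<_) lengths n<xs)
            (ℕ.+-monoˡ-≤ (length outside) (ℕ.≮⇒≥ n≮)))

  sum-< : ∀ {a} {X : Set a} {f g : X → ℕ} {x} (xs : List X) → (∀ x → f x ℕ.≤ g x) → x ∈ xs → f x ℕ.< g x →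
          sum (map f xs) ℕ.< sum (map g xs)
  sum-< (x ∷ xs) f≤g (here ≡.refl) fx<gx = ℕ.+-mono-<-≤ fx<gx (sum-≤ xs)
    where
    sum-≤ : ∀ xs → sum (map _ xs) ℕ.≤ sum (map _ xs)
    sum-≤ []       = z≤n
    sum-≤ (x ∷ xs) = ℕ.+-mono-≤ (f≤g x) (sum-≤ xs)
  sum-< (x ∷ xs) f≤g (there x∈xs) fx<gx = ℕ.+-mono-≤-< (f≤g x) (sum-< xs f≤g x∈xs fx<gx)

module Measure (N r : ℕ) where

  Shade : Set
  Shade = Fin (ℕ.suc r)

  State : Set
  State = Fin N → Maybe Shade

  -- An empty slot weighs more than any shade, so filling it decreases the measure too.
  weight : Maybe Shade → ℕ
  weight nothing  = ℕ.suc r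
  weight (just s) = toℕ s

  measure : State → ℕ
  measure σ = sum (map (weight ∘ σ) (allFin N))

  initial : State
  initial _ = nothing

  labels : List (Fin N × Shade)
  labels = cartesianProduct (allFin N) (allFin (ℕ.suc r))

  -- More than `need d` sorts are enough for `d` rounds: one sort is spent on the chosen node, and
  -- among the others some label is shared by enough sorts to continue.
  need : ℕ → ℕ
  need ℕ.zero    = 0
  need (ℕ.suc d) = ℕ.suc (length labels * need d)

  -- Both successors serve strict inequalities in `descent`, one for the measure and one for the
  -- number of sorts.
  sorts : ℕ
  sorts = ℕ.suc (need (ℕ.suc (measure initial)))

  Improves : State → Fin N → Shade → Set
  Improves σ t s = toℕ s ℕ.< weight (σ t)

-- The colours of the edges from one node to all later ones form the state.
-- Every step replaces a shade in the state by a smaller one (or fills an empty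
-- slot), the discarded node being overwritten, so that N + 2 variables suffice.
module Descent (cl : Classical) {a c e′} {J : Set a} {𝔇 : RawCylindricAlgebra J c e′}
               (isCA : IsCylindricAlgebra 𝔇) (N r ψ : ℕ) where

  open Logic cl
  open Majority cl
  open Update cl {X = Fin N} {Y = Maybe (Fin (ℕ.suc r))}
  open Measure N r
  open CylindricProperties isCA

  -- `v₁` holds the node just chosen, `v₀` a later one, and `y t` the kept node whose edges to later
  -- nodes have colour `t`. The sorts at `v₀` and `v₁` are given by `p` and `p′`; the labels of the
  -- edges from `y t` to `v₀`, from `y t` to `v₁` and from `v₁` to `v₀` by `e₀`, `e₁` and `m`.
  record Pattern : Set (a ⊔ c ⊔ e′) where
    field
      v₀ v₁    : J
      y        : Fin N → J
      v₀≢v₁    : v₀ ≢ v₁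
      v₀≢y     : ∀ t → v₀ ≢ y t
      v₁≢y     : ∀ t → v₁ ≢ y t
      p p′     : Fin ψ → Carrier
      e₀ e₁ m  : Fin N → Shade → Carrier
      p-closed₁  : ∀ κ → Closed v₁ (p κ)
      p-closedʸ  : ∀ κ t → Closed (y t) (p κ)
      p′-closed₀ : ∀ κ → Closed v₀ (p′ κ)
      e₀-closed₁ : ∀ t s → Closed v₁ (e₀ t s)
      e₀-closedʸ : ∀ t s {t′} → t′ ≢ t → Closed (y t′) (e₀ t s)
      e₁-closed₀ : ∀ t s → Closed v₀ (e₁ t s)
      m-closedʸ  : ∀ t s t′ → Closed (y t′) (m t s)
      p-rename   : ∀ κ → subs v₀ v₁ (p κ) ≤ p′ κ
      e-rename   : ∀ t s → subs v₀ v₁ (e₀ t s) ≤ e₁ t s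
      -- Expresses that `p κ ∧ p′ κ′` lies below the join of all `m t s` without forming this join.
      cover      : ∀ {κ κ′} → κ ≢ κ′ → ∀ {z} → z ≤ p κ ∧ p′ κ′ → (∀ t s → z ∧ m t s ≈ ⊥) → z ≈ ⊥
      bad        : ∀ t {s s′} → s Fin.≤ s′ → (e₀ t s ∧ e₁ t s) ∧ m t s′ ≈ ⊥
      copy       : ∀ t s → diag v₁ (y t) ∧ m t s ≤ e₀ t s

  module _ (𝔭 : Pattern) where

    open Pattern 𝔭
    open PosetReasoning poset

    value : (Fin N → Shade → Carrier) → Fin N → Maybe Shade → Carrier
    value f t nothing  = ⊤
    value f t (just s) = f t s

    literal : (Fin N → Shade → Carrier) → State → Fin N → Carrier
    literal f σ t = value f t (σ t)

    literal-closed : ∀ {j} f σ t → (∀ s → Closed j (f t s)) → Closed j (literal f σ t)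
    literal-closed f σ t h with σ t
    ... | nothing = Closed-⊤
    ... | just s  = h s

    π : (Fin N → Shade → Carrier) → State → Carrier
    π f σ = ⋀ (allFin N) (literal f σ)

    π-just : ∀ f σ {t s} → σ t ≡ just s → π f σ ≤ f t s
    π-just f σ {t} eq = ≡.subst (π f σ ≤_) (≡.cong (value f t) eq) (⋀-lower (∈-allFin t))

    body : State → Fin ψ → Carrier
    body σ κ = p κ ∧ π e₀ σ

    -- A formula about the kept nodes: every sort in `K` still has a candidate for a later node,
    -- with edges to the kept nodes as prescribed by `σ`.
    Ψ : State → List (Fin ψ) → Carrier
    Ψ σ K = ⋀ K (λ κ → cyl v₀ (body σ κ))

    body-closed₁ : ∀ σ κ → Closed v₁ (body σ κ)
    body-closed₁ σ κ = Closed-∧ (p-closed₁ κ)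
      (⋀-closed {xs = allFin N} λ {t} _ → literal-closed e₀ σ t (e₀-closed₁ t))

    Ψ-closed₀ : ∀ σ K → Closed v₀ (Ψ σ K)
    Ψ-closed₀ σ K = ⋀-closed {xs = K} λ _ → cyl-idem v₀ _

    Ψ-closed₁ : ∀ σ K → Closed v₁ (Ψ σ K)
    Ψ-closed₁ σ K = ⋀-closed {xs = K} λ {κ} _ → Closed-cyl v₀ (body-closed₁ σ κ)

    body-rename : ∀ σ κ → subs v₀ v₁ (body σ κ) ≤ p′ κ ∧ π e₁ σ
    body-rename σ κ = ∧-greatest
      (≤-trans (subs-mono v₀ v₁ (x∧y≤x _ _)) (p-rename κ))
      (⋀-greatest {xs = allFin N} λ {t} _ → lit t)
      where
      lit : ∀ t → subs v₀ v₁ (body σ κ) ≤ literal e₁ σ t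
      lit t with σ t in eq
      ... | nothing = x≤⊤ _
      ... | just s  = ≤-trans (subs-mono v₀ v₁ (≤-trans (x∧y≤y _ _) (π-just e₀ σ eq))) (e-rename t s)

    -- The candidate of sort `κ` is renamed from `v₀` to `v₁`, which frees `v₀` for candidates of
    -- the remaining sorts.
    choose-node : ∀ σ κ K → ¬ Ψ σ (κ ∷ K) ≈ ⊥ → ¬ (p′ κ ∧ π e₁ σ) ∧ Ψ σ K ≈ ⊥
    choose-node σ κ K ≉⊥ ≈⊥ = ≉⊥ (x≤⊥⇒x≈⊥ (begin
      cyl v₀ (body σ κ) ∧ Ψ σ K                ≈⟨ ∧-congʳ (cyl-rename v₀≢v₁ (body-closed₁ σ κ)) ⟩
      cyl v₁ (subs v₀ v₁ (body σ κ)) ∧ Ψ σ K   ≈⟨ cyl-∧-closed (Ψ-closed₁ σ K) ⟨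
      cyl v₁ (subs v₀ v₁ (body σ κ) ∧ Ψ σ K)   ≤⟨ cyl-mono v₁ (∧-mono (body-rename σ κ) ≤-refl) ⟩
      cyl v₁ ((p′ κ ∧ π e₁ σ) ∧ Ψ σ K)         ≈⟨ cyl-cong v₁ ≈⊥ ⟩
      cyl v₁ ⊥                                 ≈⟨ cyl-⊥ v₁ ⟩
      ⊥                                        ∎))

    labelled : State → Fin ψ → Fin N × Shade → Carrier
    labelled σ κ (t , s) = cyl v₀ (body σ κ ∧ m t s)

    -- By `cover` the edge from `v₁` to `v₀` has some label. Were its shade not smaller than the one
    -- stored for its colour, the kept node of this colour would complete a bad triangle.
    choose-label : ∀ σ {κ κ₀ z} → κ ≢ κ₀ → Closed v₀ z → ¬ z ≈ ⊥ → z ≤ p′ κ₀ ∧ π e₁ σ →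
      z ≤ cyl v₀ (body σ κ) →
      ∃ λ ts → uncurry (Improves σ) ts × ¬ z ∧ labelled σ κ ts ≈ ⊥
    choose-label σ {κ} {κ₀} {z} κ≢κ₀ cz z≉⊥ z≤ z≤′ = dne λ none → z≉⊥ (begin-equality
      z                         ≈⟨ z≤′ ⟩
      z ∧ cyl v₀ (body σ κ)     ≈⟨ closed-meet-⊥ cz (cover κ≢κ₀
          (∧-greatest (≤-trans (x∧y≤y _ _) (x∧y≤x _ _)) (≤-trans (x∧y≤x _ _) (≤-trans z≤ (x∧y≤x _ _))))
          λ t s → vanish none t s em) ⟩
      ⊥                         ∎)
      where
      vanish : ¬ (∃ λ ts → uncurry (Improves σ) ts × ¬ z ∧ labelled σ κ ts ≈ ⊥) →
               ∀ t s → Dec (Improves σ t s) → (z ∧ body σ κ) ∧ m t s ≈ ⊥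
      vanish none t s (yes i) = x≤⊥⇒x≈⊥ (begin
        (z ∧ body σ κ) ∧ m t s         ≈⟨ ∧-assoc _ _ _ ⟩
        z ∧ (body σ κ ∧ m t s)         ≤⟨ ∧-mono ≤-refl (x≤cyl v₀ _) ⟩
        z ∧ labelled σ κ (t , s)       ≈⟨ dne (λ ≉⊥ → none ((t , s) , i , ≉⊥)) ⟩
        ⊥                              ∎)
      vanish none t s (no ¬i) with σ t in eq
      ... | nothing = contradiction (Fin.toℕ<n s) ¬i
      ... | just s₀ = x≤⊥⇒x≈⊥ (begin
        (z ∧ body σ κ) ∧ m t s         ≤⟨ ∧-mono (∧-greatest
          (≤-trans (x∧y≤y _ _) (≤-trans (x∧y≤y _ _) (π-just e₀ σ eq)))
          (≤-trans (x∧y≤x _ _) (≤-trans z≤ (≤-trans (x∧y≤y _ _) (π-just e₁ σ eq))))) ≤-refl ⟩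
        (e₀ t s₀ ∧ e₁ t s₀) ∧ m t s    ≈⟨ bad t (ℕ.≮⇒≥ ¬i) ⟩
        ⊥                              ∎)

    -- The labels are fixed for one sort after the other inside a shrinking `z`. It stays
    -- independent of `v₀`, since each conjunct added is cylindrified there.
    choose-labels : ∀ σ {κ₀ z} K → (∀ {κ} → κ ∈ K → κ ≢ κ₀) → Closed v₀ z → ¬ z ≈ ⊥ → z ≤ p′ κ₀ ∧ π e₁ σ →
      (∀ {κ} → κ ∈ K → z ≤ cyl v₀ (body σ κ)) →
      ∃ λ z′ → ¬ z′ ≈ ⊥ × z′ ≤ z × Closed v₀ z′ ×
      (∀ {κ} → κ ∈ K → ∃ λ ts → ts ∈ labels × (uncurry (Improves σ) ts × z′ ≤ labelled σ κ ts))
    choose-labels σ []      _  cz z≉⊥ _  _ = _ , z≉⊥ , ≤-refl , cz , λ ()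
    choose-labels σ (κ ∷ K) ≢₀ cz z≉⊥ z≤ h
      with choose-labels σ K (≢₀ ∘ there) cz z≉⊥ z≤ (h ∘ there)
    ... | z′ , z′≉⊥ , z′≤z , cz′ , f
      with choose-label σ (≢₀ (here ≡.refl)) cz′ z′≉⊥ (≤-trans z′≤z z≤) (≤-trans z′≤z (h (here ≡.refl)))
    ... | (t , s) , i , ≉⊥ = _ , ≉⊥ , ≤-trans (x∧y≤x _ _) z′≤z , Closed-∧ cz′ (cyl-idem v₀ _) , λ
      { (here ≡.refl) → (t , s) , ∈-cartesianProduct⁺ (∈-allFin t) (∈-allFin s) , i , x∧y≤y _ _
      ; (there κ∈K) → let ts , ts∈ , j , ≤l = f κ∈K in ts , ts∈ , j , ≤-trans (x∧y≤x _ _) ≤l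
      }

    -- As all sorts in `K` share the label, the node at `v₁` can be kept for the colour `t`.
    -- Forgetting the old entry of `σ` at `t` makes everything independent of `y t`, which may then
    -- be set equal to `v₁`.
    overwrite : ∀ σ t s K {z} → ¬ z ≈ ⊥ → (∀ {κ} → κ ∈ K → z ≤ labelled σ κ (t , s)) →
                ¬ Ψ (σ [ t ↦ just s ]) K ≈ ⊥
    overwrite σ t s K {z} z≉⊥ h ≈⊥ = z≉⊥ (x≤⊥⇒x≈⊥ (begin
      z                                   ≤⟨ ⋀-greatest {xs = K} (λ κ∈K → ≤-trans (h κ∈K) (cyl-mono v₀ (forget _))) ⟩
      rest                                ≈⟨ ∧-identityˡ rest ⟨
      ⊤ ∧ rest                            ≈⟨ ∧-congʳ (cyl-diagʳ (v₁≢y t ∘ ≡.sym)) ⟨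
      cyl (y t) (diag v₁ (y t)) ∧ rest    ≈⟨ cyl-∧-closed rest-closed ⟨
      cyl (y t) (diag v₁ (y t) ∧ rest)    ≤⟨ cyl-mono (y t) (⋀-greatest {xs = K} copied) ⟩
      cyl (y t) (Ψ (σ [ t ↦ just s ]) K)  ≈⟨ cyl-cong (y t) ≈⊥ ⟩
      cyl (y t) ⊥                         ≈⟨ cyl-⊥ (y t) ⟩
      ⊥                                   ∎))
      where
      kept : Fin ψ → Carrier
      kept κ = (p κ ∧ π e₀ (σ [ t ↦ nothing ])) ∧ m t s

      rest : Carrier
      rest = ⋀ K (cyl v₀ ∘ kept)

      weaken : π e₀ σ ≤ π e₀ (σ [ t ↦ nothing ])
      weaken = ⋀-greatest {xs = allFin N} λ {t′} _ → by t′ em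
        where
        by : ∀ t′ → Dec (t′ ≡ t) → π e₀ σ ≤ literal e₀ (σ [ t ↦ nothing ]) t′
        by t′ (yes ≡.refl) = ≡.subst (π e₀ σ ≤_) (≡.cong (value e₀ t) (≡.sym (↦-same σ t))) (x≤⊤ _)
        by t′ (no t′≢t) = ≡.subst (π e₀ σ ≤_) (≡.cong (value e₀ t′) (≡.sym (↦-other σ t t′≢t))) (⋀-lower (∈-allFin t′))

      forget : ∀ κ → body σ κ ∧ m t s ≤ kept κ
      forget κ = ∧-mono (∧-mono ≤-refl weaken) ≤-refl

      kept-closed : ∀ κ → Closed (y t) (kept κ)
      kept-closed κ = Closed-∧ (Closed-∧ (p-closedʸ κ t) (⋀-closed {xs = allFin N} λ {t′} _ → by t′ em)) (m-closedʸ t s t)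
        where
        by : ∀ t′ → Dec (t′ ≡ t) → Closed (y t) (literal e₀ (σ [ t ↦ nothing ]) t′)
        by t′ (no t′≢t) = literal-closed e₀ (σ [ t ↦ nothing ]) t′ λ s′ → e₀-closedʸ t′ s′ (t′≢t ∘ ≡.sym)
        by t′ (yes ≡.refl) = ≡.subst (Closed (y t) ∘ value e₀ t) (≡.sym (↦-same σ t)) Closed-⊤

      rest-closed : Closed (y t) rest
      rest-closed = ⋀-closed {xs = K} λ {κ} _ → Closed-cyl v₀ (kept-closed κ)

      enter : ∀ κ → diag v₁ (y t) ∧ kept κ ≤ body (σ [ t ↦ just s ]) κ
      enter κ = ∧-greatest (≤-trans (x∧y≤y _ _) (≤-trans (x∧y≤x _ _) (x∧y≤x _ _)))
        (⋀-greatest {xs = allFin N} λ {t′} _ → by t′ em)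
        where
        by : ∀ t′ → Dec (t′ ≡ t) → diag v₁ (y t) ∧ kept κ ≤ literal e₀ (σ [ t ↦ just s ]) t′
        by t′ (yes ≡.refl) = ≡.subst (diag v₁ (y t) ∧ kept κ ≤_)
          (≡.cong (value e₀ t) (≡.sym (↦-same σ t)))
          (≤-trans (∧-mono ≤-refl (x∧y≤y _ _)) (copy t s))
        by t′ (no t′≢t) = ≤-trans (x∧y≤y _ _) (≤-trans (x∧y≤x _ _) (≤-trans (x∧y≤y _ _)
          (≡.subst (π e₀ (σ [ t ↦ nothing ]) ≤_)
            (≡.cong (value e₀ t′) (≡.trans (↦-other σ t t′≢t) (≡.sym (↦-other σ t t′≢t))))
            (⋀-lower (∈-allFin t′)))))

      copied : ∀ {κ} → κ ∈ K → diag v₁ (y t) ∧ rest ≤ cyl v₀ (body (σ [ t ↦ just s ]) κ)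
      copied {κ} κ∈K = begin
        diag v₁ (y t) ∧ rest                ≤⟨ ∧-mono ≤-refl (⋀-lower κ∈K) ⟩
        diag v₁ (y t) ∧ cyl v₀ (kept κ)     ≈⟨ ∧-comm _ _ ⟩
        cyl v₀ (kept κ) ∧ diag v₁ (y t)     ≈⟨ cyl-∧-closed (Closed-diag v₀≢v₁ (v₀≢y t)) ⟨
        cyl v₀ (kept κ ∧ diag v₁ (y t))     ≤⟨ cyl-mono v₀ (≤-trans (≤-reflexive (∧-comm _ _)) (enter κ)) ⟩
        cyl v₀ (body (σ [ t ↦ just s ]) κ)  ∎

    measure-decreases : ∀ σ {t s} → Improves σ t s → measure (σ [ t ↦ just s ]) ℕ.< measure σ
    measure-decreases σ {t} {s} i = sum-< (allFin N) le (∈-allFin t)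
      (≡.subst (λ x → weight x ℕ.< weight (σ t)) (≡.sym (↦-same σ t)) i)
      where
      le : ∀ x → weight ((σ [ t ↦ just s ]) x) ℕ.≤ weight (σ x)
      le x = by em
        where
        by : Dec (x ≡ t) → weight ((σ [ t ↦ just s ]) x) ℕ.≤ weight (σ x)
        by (yes ≡.refl) = ≡.subst (λ z → weight z ℕ.≤ weight (σ t)) (≡.sym (↦-same σ t)) (ℕ.<⇒≤ i)
        by (no x≢t)     = ℕ.≤-reflexive (≡.cong weight (↦-other σ t x≢t))

    -- Every round lowers the measure while enough sorts survive, so a non-zero value would outlast
    -- the bound `d` on the measure.
    descent : ∀ d σ {K} → measure σ ℕ.< d → Unique K → need d ℕ.< length K → Ψ σ K ≈ ⊥
    descent (ℕ.suc d) σ {κ ∷ K} (s≤s μ≤d) (κ≢ ∷ K!) (s≤s n<) = dne λ ≉⊥ →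
      let z′ , z′≉⊥ , z′≤z , _ , f = choose-labels σ K (λ κ′∈K κ′≡κ → All.lookup κ≢ κ′∈K (≡.sym κ′≡κ))
            (Closed-∧ (Closed-∧ (p′-closed₀ κ)
              (⋀-closed {xs = allFin N} λ {t} _ → literal-closed e₁ σ t (e₁-closed₀ t))) (Ψ-closed₀ σ K))
            (choose-node σ κ K ≉⊥) (x∧y≤x _ _) (λ κ∈K → ≤-trans (x∧y≤y _ _) (⋀-lower κ∈K))
          (t , s) , _ , K′ , K′! , n<′ , g = majority
            (λ ts κ → uncurry (Improves σ) ts × z′ ≤ labelled σ κ ts) (need d) labels K! f n<
      in overwrite σ t s K′ z′≉⊥ (λ κ∈ → proj₂ (proj₂ (g κ∈)))
           (descent d (σ [ t ↦ just s ]) (ℕ.<-≤-trans (measure-decreases σ (improves K′ n<′ g)) μ≤d) K′! n<′)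
      where
      improves : ∀ {n t s z} K′ → n ℕ.< length K′ →
                 (∀ {κ} → κ ∈ K′ → κ ∈ K × (Improves σ t s × z ≤ labelled σ κ (t , s))) → Improves σ t s
      improves (_ ∷ _) _ g = proj₁ (proj₂ (g (here ≡.refl)))

    contradictory : sorts ≡ ψ → ⋀ (allFin ψ) (λ κ → cyl v₀ (p κ)) ≈ ⊥
    contradictory ≡.refl = x≤⊥⇒x≈⊥ (≤-trans
      (⋀-greatest {xs = allFin ψ} λ {κ} κ∈ → ≤-trans (⋀-lower κ∈) (cyl-mono v₀ (∧-greatest ≤-refl
        (⋀-greatest {xs = allFin N} λ _ → x≤⊤ _))))
      (≤-reflexive (descent (ℕ.suc (measure initial)) initial ℕ.≤-refl (allFin⁺ ψ)
        (≡.subst (need (ℕ.suc (measure initial)) ℕ.<_) (≡.sym (length-tabulate {n = ψ} id)) ℕ.≤-refl))))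

-- An isomorphism of 𝔄 with a subalgebra of the neat reduct of 𝔅 to the range of
-- ι, the indices outside this range being those in Out.
record NeatEmbedding {a b c c′ e e′ o} {I : Set a} {J : Set b} (ι : I → J) (Out : J → Set o)
                     (𝔄 : RawCylindricAlgebra I c e) (𝔅 : RawCylindricAlgebra J c′ e′)
                     : Set (a ⊔ b ⊔ c ⊔ c′ ⊔ e ⊔ e′ ⊔ o) where
  private
    module A = RawCylindricAlgebra 𝔄
    module B = RawCylindricAlgebra 𝔅
  field
    to         : A.Carrier → B.Carrier
    to-fixed   : ∀ x j → Out j → B.cyl j (to x) B.≈ to x
    to-cong    : ∀ {x y} → x A.≈ y → to x B.≈ to y
    injective  : ∀ {x y} → to x B.≈ to y → x A.≈ y
    ∨-homo     : ∀ x y → to (x A.∨ y) B.≈ to x B.∨ to y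
    ∧-homo     : ∀ x y → to (x A.∧ y) B.≈ to x B.∧ to y
    neg-homo   : ∀ x → to (A.- x) B.≈ B.- to x
    ⊤-homo     : to A.⊤ B.≈ B.⊤
    ⊥-homo     : to A.⊥ B.≈ B.⊥
    cyl-homo   : ∀ i x → to (A.cyl i x) B.≈ B.cyl (ι i) (to x)
    diag-homo  : ∀ i j → to (A.diag i j) B.≈ B.diag (ι i) (ι j)

module _ {ℓ} {α β : Ordinal ℓ} (α≤β : α ≤ₒ β) where

  open _≤ₒ_ α≤β using (embed; Outside)

  S⇒NeatEmbedding : ∀ {𝔄 : RawCylindricAlgebra ∣ α ∣ ℓ ℓ} → S (NrCA {α = α} {β = β} α≤β) 𝔄 →
    Σ (RawCylindricAlgebra ∣ β ∣ ℓ ℓ) λ 𝔇 → IsCylindricAlgebra 𝔇 × NeatEmbedding embed Outside 𝔄 𝔇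
  S⇒NeatEmbedding (𝔅 , (𝔇 , isCA , 𝔅≅) , P , 𝔄≅) = 𝔇 , isCA , record
    { to         = λ x → proj₁ (ψ.to (proj₁ (φ.to x)))
    ; to-fixed   = λ x → proj₂ (ψ.to (proj₁ (φ.to x)))
    ; to-cong    = λ p → ψ.to-cong (φ.to-cong p)
    ; injective  = λ p → φ.injective (ψ.injective p)
    ; ∨-homo     = λ x y → ≈-trans (ψ.to-cong (φ.∨-homo x y)) (ψ.∨-homo _ _)
    ; ∧-homo     = λ x y → ≈-trans (ψ.to-cong (φ.∧-homo x y)) (ψ.∧-homo _ _)
    ; neg-homo   = λ x → ≈-trans (ψ.to-cong (φ.neg-homo x)) (ψ.neg-homo _)
    ; ⊤-homo     = ≈-trans (ψ.to-cong φ.⊤-homo) ψ.⊤-homo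
    ; ⊥-homo     = ≈-trans (ψ.to-cong φ.⊥-homo) ψ.⊥-homo
    ; cyl-homo   = λ i x → ≈-trans (ψ.to-cong (φ.cyl-homo i x)) (ψ.cyl-homo i _)
    ; diag-homo  = λ i j → ≈-trans (ψ.to-cong (φ.diag-homo i j)) (ψ.diag-homo i j)
    }
    where
    module φ = _≅_ 𝔄≅
    module ψ = _≅_ 𝔅≅
    open CylindricProperties isCA using (≈-trans)

-- The three-variable facts that are contradictory in dimension α + k + 1.
record Obstruction {ℓ} {A : Set ℓ} (𝔄 : RawCylindricAlgebra A ℓ ℓ) (k r ψ : ℕ) : Set ℓ where
  open RawCylindricAlgebra 𝔄
  open Measure (ℕ.suc (k + 1)) r using (Shade; labels)
  infix 4 _≤ᵃ_
  _≤ᵃ_ : Carrier → Carrier → Set ℓ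
  X ≤ᵃ Y = X ≈ X ∧ Y
  field
    triple      : Triple A
  open Triple triple public
  field
    p₀ p₁       : Fin ψ → Carrier
    E₂₀ E₂₁ E₁₀ : Fin (ℕ.suc (k + 1)) → Shade → Carrier
    p₀-closed₁  : ∀ κ → cyl o₁ (p₀ κ) ≈ p₀ κ
    p₀-closed₂  : ∀ κ → cyl o₂ (p₀ κ) ≈ p₀ κ
    p₁-closed₀  : ∀ κ → cyl o₀ (p₁ κ) ≈ p₁ κ
    E₂₀-closed₁ : ∀ t s → cyl o₁ (E₂₀ t s) ≈ E₂₀ t s
    E₂₁-closed₀ : ∀ t s → cyl o₀ (E₂₁ t s) ≈ E₂₁ t s
    E₁₀-closed₂ : ∀ t s → cyl o₂ (E₁₀ t s) ≈ E₁₀ t s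
    p-rename    : ∀ κ → cyl o₀ (diag o₀ o₁ ∧ p₀ κ) ≤ᵃ p₁ κ
    E-rename    : ∀ t s → cyl o₀ (diag o₀ o₁ ∧ E₂₀ t s) ≤ᵃ E₂₁ t s
    E-copy      : ∀ t s → diag o₁ o₂ ∧ E₁₀ t s ≤ᵃ E₂₀ t s
    no-bad      : ∀ t {s s′} → s Fin.≤ s′ → E₂₀ t s ∧ (E₂₁ t s ∧ E₁₀ t s′) ≈ ⊥
    covered     : ∀ {κ κ′} → κ ≢ κ′ →
                  p₀ κ ∧ p₁ κ′ ≤ᵃ foldr (λ ts X → E₁₀ (proj₁ ts) (proj₂ ts) ∨ X) ⊥ labels
    -- The start of the descent: a position at which coordinate `o₀` can be changed into a node of
    -- any sort.
    common      : Carrier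
    common-≤    : ∀ κ → common ≤ᵃ cyl o₀ (p₀ κ)
    common-≉⊥   : ¬ common ≈ ⊥

-- From three-variable facts to the descent, using the spare dimensions

module Transfer (cl : Classical) {ℓ} {A : Set ℓ} {𝔄 : RawCylindricAlgebra A ℓ ℓ} {k r ψ : ℕ}
                (ψ≡ : Measure.sorts (ℕ.suc (k + 1)) r ≡ ψ) (obs : Obstruction 𝔄 k r ψ)
                {𝔇 : RawCylindricAlgebra (A ⊎ Fin (k + 1)) ℓ ℓ} (isCA : IsCylindricAlgebra 𝔇)
                {Out : A ⊎ Fin (k + 1) → Set ℓ} (out : ∀ b → Out (inj₂ b))
                (emb : NeatEmbedding inj₁ Out 𝔄 𝔇) where

  private
    module M = Measure (ℕ.suc (k + 1)) r
    module Desc = Descent cl isCA (ℕ.suc (k + 1)) r ψ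
    module 𝔄 = RawCylindricAlgebra 𝔄
    N = ℕ.suc (k + 1)

  open Measure (ℕ.suc (k + 1)) r using (Shade)
  open Obstruction obs
  open CylindricProperties isCA
  open NeatEmbedding emb
  open PosetReasoning poset

  to-mono : ∀ {X Y} → X ≤ᵃ Y → to X ≤ to Y
  to-mono {X} {Y} h = ≈-trans (to-cong h) (∧-homo X Y)

  to-closed₁ : ∀ {a X} → 𝔄.cyl a X 𝔄.≈ X → Closed (inj₁ a) (to X)
  to-closed₁ {a} {X} h = ≈-trans (≈-sym (cyl-homo a X)) (to-cong h)

  to-subs : ∀ i j X → subs (inj₁ i) (inj₁ j) (to X) ≈ to (𝔄.cyl i (𝔄.diag i j 𝔄.∧ X))
  to-subs i j X = ≈-sym (begin-equality
    to (𝔄.cyl i (𝔄.diag i j 𝔄.∧ X))              ≈⟨ cyl-homo i _ ⟩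
    cyl (inj₁ i) (to (𝔄.diag i j 𝔄.∧ X))         ≈⟨ cyl-cong _ (∧-homo _ X) ⟩
    cyl (inj₁ i) (to (𝔄.diag i j) ∧ to X)        ≈⟨ cyl-cong _ (∧-congʳ (diag-homo i j)) ⟩
    subs (inj₁ i) (inj₁ j) (to X)                ∎)

  to-subs-≤ : ∀ i j {X Y} → 𝔄.cyl i (𝔄.diag i j 𝔄.∧ X) ≤ᵃ Y → subs (inj₁ i) (inj₁ j) (to X) ≤ to Y
  to-subs-≤ i j {X} h = ≤-trans (≤-reflexive (to-subs i j X)) (to-mono h)

  any-coloured : List (Fin N × Shade) → 𝔄.Carrier
  any-coloured = foldr (λ ts X → E₁₀ (proj₁ ts) (proj₂ ts) 𝔄.∨ X) 𝔄.⊥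

  to-any-coloured : ∀ L → to (any-coloured L) ≈ ⋁ L (λ ts → to (E₁₀ (proj₁ ts) (proj₂ ts)))
  to-any-coloured []            = ⊥-homo
  to-any-coloured ((t , s) ∷ L) = ≈-trans (∨-homo _ _) (∨-cong ≈-refl (to-any-coloured L))

  v₀ v₁ v₂ : A ⊎ Fin (k + 1)
  v₀ = inj₁ o₀
  v₁ = inj₁ o₁
  v₂ = inj₁ o₂

  v₀≢v₁ : v₀ ≢ v₁
  v₀≢v₁ e = o₀≢o₁ (inj₁-injective e)

  v₀≢v₂ : v₀ ≢ v₂
  v₀≢v₂ e = o₀≢o₂ (inj₁-injective e)

  v₁≢v₂ : v₁ ≢ v₂
  v₁≢v₂ e = o₁≢o₂ (inj₁-injective e)

  -- One slot per remaining colour: `o₂` and the `k + 1` spare dimensions. Together with `o₀` and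
  -- `o₁` these are the `N + 2` variables of the descent.
  slot : Fin N → A ⊎ Fin (k + 1)
  slot Fin.zero    = v₂
  slot (Fin.suc b) = inj₂ b

  -- `E₂₀` and `E₂₁` see a kept node only at `o₂`; substitution moves it to the slot of its colour.
  at-slot : Fin N → Carrier → Carrier
  at-slot Fin.zero    x = x
  at-slot (Fin.suc b) x = subs v₂ (inj₂ b) x

  at-slot-closed : ∀ {v} t X → v ≢ v₂ → v ≢ slot t → Closed v (to X) → Closed v (at-slot t (to X))
  at-slot-closed Fin.zero    X _    _   c = c
  at-slot-closed (Fin.suc b) X v≢v₂ v≢y c = Closed-cyl v₂ (Closed-∧ (Closed-diag v≢v₂ v≢y) c)

  no-bad-D : ∀ t {s s′} → s Fin.≤ s′ → to (E₂₀ t s) ∧ (to (E₂₁ t s) ∧ to (E₁₀ t s′)) ≈ ⊥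
  no-bad-D t {s} {s′} s≤s′ = begin-equality
    to (E₂₀ t s) ∧ (to (E₂₁ t s) ∧ to (E₁₀ t s′))    ≈⟨ ∧-congˡ (∧-homo _ _) ⟨
    to (E₂₀ t s) ∧ to (E₂₁ t s 𝔄.∧ E₁₀ t s′)         ≈⟨ ∧-homo _ _ ⟨
    to (E₂₀ t s 𝔄.∧ (E₂₁ t s 𝔄.∧ E₁₀ t s′))          ≈⟨ to-cong (no-bad t s≤s′) ⟩
    to 𝔄.⊥                                           ≈⟨ ⊥-homo ⟩
    ⊥                                                ∎

  -- `E₁₀` does not depend on `o₂`, so it passes under the substitution, which preserves
  -- disjointness.
  bad : ∀ t {s s′} → s Fin.≤ s′ → (at-slot t (to (E₂₀ t s)) ∧ at-slot t (to (E₂₁ t s))) ∧ to (E₁₀ t s′) ≈ ⊥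
  bad Fin.zero    s≤s′ = ≈-trans (∧-assoc _ _ _) (no-bad-D Fin.zero s≤s′)
  bad (Fin.suc b) {s} {s′} s≤s′ = begin-equality
    (subs v₂ w X ∧ subs v₂ w Y) ∧ Z  ≈⟨ ∧-assoc _ _ _ ⟩
    subs v₂ w X ∧ (subs v₂ w Y ∧ Z)  ≈⟨ ∧-congˡ (subs-∧-closed (to-closed₁ (E₁₀-closed₂ (Fin.suc b) s′))) ⟨
    subs v₂ w X ∧ subs v₂ w (Y ∧ Z)  ≈⟨ subs-disjoint (λ ()) (no-bad-D (Fin.suc b) s≤s′) ⟩
    ⊥                                ∎
    where
    w = inj₂ b
    X = to (E₂₀ (Fin.suc b) s)
    Y = to (E₂₁ (Fin.suc b) s)
    Z = to (E₁₀ (Fin.suc b) s′)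

  copy-D : ∀ t s → diag v₁ v₂ ∧ to (E₁₀ t s) ≤ to (E₂₀ t s)
  copy-D t s = begin
    diag v₁ v₂ ∧ to (E₁₀ t s)             ≈⟨ ∧-congʳ (diag-homo o₁ o₂) ⟨
    to (𝔄.diag o₁ o₂) ∧ to (E₁₀ t s)      ≈⟨ ∧-homo _ _ ⟨
    to (𝔄.diag o₁ o₂ 𝔄.∧ E₁₀ t s)         ≤⟨ to-mono (E-copy t s) ⟩
    to (E₂₀ t s)                          ∎

  -- For a spare slot, the diagonal axiom inserts `v₂` between `v₁` and the slot; `E-copy` applies
  -- to the first half of the equality and the second half is the substitution.
  copy : ∀ t s → diag v₁ (slot t) ∧ to (E₁₀ t s) ≤ at-slot t (to (E₂₀ t s))
  copy Fin.zero    s = copy-D Fin.zero s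
  copy (Fin.suc b) s = begin
    diag v₁ w ∧ Z                                ≈⟨ ∧-congʳ (diag-cyl (v₁≢v₂ ∘ ≡.sym) λ ()) ⟩
    cyl v₂ (diag v₁ v₂ ∧ diag v₂ w) ∧ Z          ≈⟨ cyl-∧-closed (to-closed₁ (E₁₀-closed₂ (Fin.suc b) s)) ⟨
    cyl v₂ ((diag v₁ v₂ ∧ diag v₂ w) ∧ Z)        ≤⟨ cyl-mono v₂ (∧-greatest
        (≤-trans (x∧y≤x _ _) (x∧y≤y _ _))
        (≤-trans (∧-mono (x∧y≤x _ _) ≤-refl) (copy-D (Fin.suc b) s))) ⟩
    subs v₂ w (to (E₂₀ (Fin.suc b) s))           ∎
    where
    w = inj₂ b
    Z = to (E₁₀ (Fin.suc b) s)

  e-rename : ∀ t s → subs v₀ v₁ (at-slot t (to (E₂₀ t s))) ≤ at-slot t (to (E₂₁ t s))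
  e-rename Fin.zero    s = to-subs-≤ o₀ o₁ (E-rename Fin.zero s)
  e-rename (Fin.suc b) s = ≤-trans
    (≤-reflexive (subs-comm v₀≢v₂ (λ ()) (v₁≢v₂ ∘ ≡.sym) _))
    (subs-mono v₂ (inj₂ b) (to-subs-≤ o₀ o₁ (E-rename (Fin.suc b) s)))

  slot-≢ : ∀ {a} → a ≢ o₂ → ∀ t → inj₁ a ≢ slot t
  slot-≢ a≢o₂ Fin.zero    e = a≢o₂ (inj₁-injective e)
  slot-≢ a≢o₂ (Fin.suc b) ()

  slot-closed : ∀ {X} → 𝔄.cyl o₂ X 𝔄.≈ X → ∀ t → Closed (slot t) (to X)
  slot-closed h Fin.zero        = to-closed₁ h
  slot-closed {X} h (Fin.suc b) = to-fixed X (inj₂ b) (out b)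

  e₀-closedʸ : ∀ t s {t′} → t′ ≢ t → Closed (slot t′) (at-slot t (to (E₂₀ t s)))
  e₀-closedʸ Fin.zero    s {Fin.zero}   t′≢t = contradiction ≡.refl t′≢t
  e₀-closedʸ Fin.zero    s {Fin.suc b}  t′≢t = to-fixed _ (inj₂ b) (out b)
  e₀-closedʸ (Fin.suc b) s {Fin.zero}   t′≢t = cyl-idem v₂ _
  e₀-closedʸ (Fin.suc b) s {Fin.suc b′} t′≢t = at-slot-closed (Fin.suc b) _ (λ ())
    (λ e → t′≢t (≡.cong Fin.suc (inj₂-injective e))) (to-fixed _ (inj₂ b′) (out b′))

  pattern′ : Desc.Pattern
  pattern′ = record
    { v₀ = v₀ ; v₁ = v₁ ; y = slot
    ; v₀≢v₁ = v₀≢v₁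
    ; v₀≢y = slot-≢ o₀≢o₂
    ; v₁≢y = slot-≢ o₁≢o₂
    ; p = to ∘ p₀ ; p′ = to ∘ p₁
    ; e₀ = λ t s → at-slot t (to (E₂₀ t s))
    ; e₁ = λ t s → at-slot t (to (E₂₁ t s))
    ; m = λ t s → to (E₁₀ t s)
    ; p-closed₁ = λ κ → to-closed₁ (p₀-closed₁ κ)
    ; p-closedʸ = λ κ → slot-closed (p₀-closed₂ κ)
    ; p′-closed₀ = λ κ → to-closed₁ (p₁-closed₀ κ)
    ; e₀-closed₁ = λ t s → at-slot-closed t (E₂₀ t s) v₁≢v₂ (slot-≢ o₁≢o₂ t) (to-closed₁ (E₂₀-closed₁ t s))
    ; e₀-closedʸ = e₀-closedʸ
    ; e₁-closed₀ = λ t s → at-slot-closed t (E₂₁ t s) v₀≢v₂ (slot-≢ o₀≢o₂ t) (to-closed₁ (E₂₁-closed₀ t s))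
    ; m-closedʸ = λ t s → slot-closed (E₁₀-closed₂ t s)
    ; p-rename = λ κ → to-subs-≤ o₀ o₁ (p-rename κ)
    ; e-rename = e-rename
    ; cover = λ κ≢κ′ z≤ z⊥ → ≈-trans (≤-trans z≤ (≤-trans (≤-reflexive (≈-sym (∧-homo _ _)))
          (≤-trans (to-mono (covered κ≢κ′)) (≤-reflexive (to-any-coloured M.labels)))))
        (⋁-disjoint {xs = M.labels} λ {ts} _ → z⊥ (proj₁ ts) (proj₂ ts))
    ; bad = bad
    ; copy = copy
    }

  no-embedding : ⊥₀
  no-embedding = common-≉⊥ (injective (≈-trans (x≤⊥⇒x≈⊥ (≤-trans
    (⋀-greatest {xs = allFin ψ} λ {κ} _ → ≤-trans (to-mono (common-≤ κ)) (≤-reflexive (cyl-homo o₀ (p₀ κ))))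
    (≤-reflexive (Desc.contradictory pattern′ ψ≡)))) (≈-sym ⊥-homo)))

𝔑𝔯∈NrCA : ∀ {ℓ} {α β : Ordinal ℓ} (α≤β : α ≤ₒ β) {𝔅 : RawCylindricAlgebra ∣ β ∣ ℓ ℓ}
          (isCA : IsCylindricAlgebra 𝔅) → NrCA {α = α} {β = β} α≤β (𝔑𝔯 {α = α} {β = β} α≤β {B = 𝔅} isCA)
𝔑𝔯∈NrCA α≤β {𝔅} isCA = 𝔅 , isCA , record
  { to         = id
  ; to-cong    = id
  ; injective  = id
  ; surjective = λ y → y , id
  ; ∨-homo     = λ _ _ → ≈-refl
  ; ∧-homo     = λ _ _ → ≈-refl
  ; neg-homo   = λ _ → ≈-refl
  ; ⊤-homo     = ≈-refl
  ; ⊥-homo     = ≈-refl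
  ; cyl-homo   = λ _ _ → ≈-refl
  ; diag-homo  = λ _ _ → ≈-refl
  }
  where open CylindricProperties isCA using (≈-refl)

module NeatReduct (cl : Classical) {ℓ : Level} (α : Ordinal ℓ) (os : Triple ∣ α ∣) (k r ψ : ℕ) where

  open Logic cl
  open Networks cl os k r ψ
  open NetworkAlgebra cl os k r ψ

  𝔄 : RawCylindricAlgebra ∣ α ∣ ℓ ℓ
  𝔄 = 𝔑𝔯 {ℓ} {ℓ} {ℓ} {ℓ} {α = α} {β = α +ₒ fin k} (≤-+ₒ α (fin k)) {B = complex} isCylindricAlgebra

  module 𝔄 = RawCylindricAlgebra 𝔄

  𝔄∈NrCA : NrCA (≤-+ₒ α (fin k)) 𝔄
  𝔄∈NrCA = 𝔑𝔯∈NrCA {α = α} {β = α +ₒ fin k} (≤-+ₒ α (fin k)) {complex} isCylindricAlgebra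

  infix 4 _⊩_
  _⊩_ : World → 𝔄.Carrier → Set
  g ⊩ X = g ∈ᵉ proj₁ X

-- The obstruction inside the network algebra

module NonEmbedding (cl : Classical) {ℓ : Level} (α : Ordinal ℓ) (os : Triple ∣ α ∣) (k r ψ : ℕ) (ψ≡ : Measure.sorts (ℕ.suc (k + 1)) r ≡ ℕ.suc ψ) where

  N : ℕ
  N = ℕ.suc (k + 1)

  module M = Measure N r

  open Logic cl
  open Triple os
  open Networks cl os k r (ℕ.suc ψ)
  open NetworkAlgebra cl os k r (ℕ.suc ψ)
    renaming (cyl to cylᶜ) hiding (diag)
  open NeatReduct cl α os k r (ℕ.suc ψ)
  open Net

  Independent : I → (Net I → Set ℓ) → Set ℓ
  Independent i P = ∀ g h → Agree i g h → P g → P h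

  Respects : (Net I → Set ℓ) → Set ℓ
  Respects P = ∀ {g h} → g ≗ⁿ h → P g → P h

  -- Independence of the spare nodes is what places the corresponding element in the neat reduct.
  record Property : Set (suc ℓ) where
    field
      holds       : Net I → Set ℓ
      respects    : Respects holds
      independent : ∀ b → Independent (inj₂ b) holds

  open Property

  ≗ⁿ-sym : ∀ {g h : Net I} → g ≗ⁿ h → h ≗ⁿ g
  ≗ⁿ-sym (p , q) = (λ x y → ≡.sym (p x y)) , λ x → ≡.sym (q x)

  element : Property → Element
  element P = ⟨ holds P ∘ net ⟩ (respects P) (respects P ∘ ≗ⁿ-sym)

  element-closed : ∀ P {i} → Independent i (holds P) → RawCylindricAlgebra._≈_ complex (cylᶜ i (element P)) (element P)
  element-closed P {i} ind = ext {cylᶜ i (element P)} {element P}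
    (λ {g} c → let h , a , x = cyl⁻ {i} (element P) {g} c in
      ⌈⌉⁺ (ind (net h) (net g) (Agree-sym {i} {net g} {net h} a) (⌈⌉⁻ x)))
    (λ {g} x → cyl⁺ {i} (element P) {g} {g} ((λ _ _ _ _ → ≡.refl) , λ _ _ → ≡.refl) x)

  neat : Property → 𝔄.Carrier
  neat P = element P , λ
    { (inj₁ a) out → contradiction ≡.refl (out a)
    ; (inj₂ b) _   → element-closed P (independent P b)
    }

  -- The other indices are played by constants; their edges to good nodes use up
  -- all colours outside the range of free.
  Constant : ∣ α ∣ → Set ℓ
  Constant c = c ≢ o₀ × c ≢ o₁ × c ≢ o₂

  inj₁≢ : ∀ {a b : ∣ α ∣} → a ≢ b → _≢_ {A = I} (inj₁ a) (inj₁ b)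
  inj₁≢ a≢b e = a≢b (inj₁-injective e)

  good : Fin (ℕ.suc ψ) → (a : ∣ α ∣) → ¬ Constant a → Property
  good κ a a∉C = record
    { holds = λ g → sort g (inj₁ a) ≡ just κ ×
        (∀ c → Constant c → sort g (inj₁ c) ≡ nothing × lab g (inj₁ c) (inj₁ a) ≡ col (inj₁ c) Fin.zero)
    ; respects = λ (p , q) (x , y) → ≡.trans (≡.sym (q _)) x ,
        λ c C → ≡.trans (≡.sym (q _)) (proj₁ (y c C)) , ≡.trans (≡.sym (p _ _)) (proj₂ (y c C))
    ; independent = λ b _ _ (p , q) (x , y) → ≡.trans (≡.sym (q _ λ ())) x ,
        λ c C → ≡.trans (≡.sym (q _ λ ())) (proj₁ (y c C)) ,
                ≡.trans (≡.sym (p _ _ (λ ()) (λ ()))) (proj₂ (y c C))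
    }

  good-independent : ∀ κ a a∉C {a′} → a ≢ a′ → ¬ Constant a′ → Independent (inj₁ a′) (holds (good κ a a∉C))
  good-independent κ a a∉C {a′} a≢a′ a′∉C _ _ (p , q) (x , y) = ≡.trans (≡.sym (q _ (inj₁≢ a≢a′))) x ,
    λ c C → let c≢ = inj₁≢ λ { ≡.refl → a′∉C C } in ≡.trans (≡.sym (q _ c≢)) (proj₁ (y c C)) ,
      ≡.trans (≡.sym (p _ _ c≢ (inj₁≢ a≢a′))) (proj₂ (y c C))

  coloured : I → Shade → ∣ α ∣ → ∣ α ∣ → Property
  coloured c s a b = record
    { holds       = λ g → lab g (inj₁ a) (inj₁ b) ≡ col c s
    ; respects    = λ (p , q) x → ≡.trans (≡.sym (p _ _)) x
    ; independent = λ b _ _ (p , q) x → ≡.trans (≡.sym (p _ _ (λ ()) (λ ()))) x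
    }

  coloured-independent : ∀ c s {a b a′} → a ≢ a′ → b ≢ a′ → Independent (inj₁ a′) (holds (coloured c s a b))
  coloured-independent c s a≢ b≢ _ _ (p , q) x = ≡.trans (≡.sym (p _ _ (inj₁≢ a≢) (inj₁≢ b≢))) x

  -- The colours not claimed by constants, namely `o₂`, the `k` spare ones and `o₁`; hence
  -- `N = k + 2`.
  free : Fin N → I
  free Fin.zero    = inj₁ o₂
  free (Fin.suc b) = [ inj₂ , (λ _ → inj₁ o₁) ]′ (Fin.splitAt k b)

  free-surjective : ∀ c → c ≢ inj₁ o₀ → (∀ a → Constant a → c ≢ inj₁ a) → ∃ λ t → free t ≡ c
  free-surjective (inj₂ b) _ _ = Fin.suc (b ↑ˡ 1) , ≡.cong [ inj₂ , _ ]′ (Fin.splitAt-↑ˡ k b 1)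
  free-surjective (inj₁ a) a≢o₀ a∉C with em {P = a ≡ o₁} | em {P = a ≡ o₂}
  ... | yes ≡.refl | _          = Fin.suc (k ↑ʳ Fin.zero) , ≡.cong [ inj₂ , _ ]′ (Fin.splitAt-↑ʳ k 1 Fin.zero)
  ... | no _       | yes ≡.refl = Fin.zero , ≡.refl
  ... | no a≢o₁    | no a≢o₂    = contradiction ≡.refl (a∉C a ((λ { ≡.refl → a≢o₀ ≡.refl }) , a≢o₁ , a≢o₂))

  o₀∉C : ¬ Constant o₀
  o₀∉C (o≢ , _) = o≢ ≡.refl

  o₁∉C : ¬ Constant o₁
  o₁∉C (_ , o≢ , _) = o≢ ≡.refl

  o₂∉C : ¬ Constant o₂
  o₂∉C (_ , _ , o≢) = o≢ ≡.refl

  p₀ p₁ : Fin (ℕ.suc ψ) → 𝔄.Carrier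
  p₀ κ = neat (good κ o₀ o₀∉C)
  p₁ κ = neat (good κ o₁ o₁∉C)

  E₂₀ E₂₁ E₁₀ : Fin N → Shade → 𝔄.Carrier
  E₂₀ t s = neat (coloured (free t) s o₂ o₀)
  E₂₁ t s = neat (coloured (free t) s o₂ o₁)
  E₁₀ t s = neat (coloured (free t) s o₁ o₀)

  good-coloured : ∀ {κ κ′} → κ ≢ κ′ → ∀ g → g ⊩ p₀ κ → g ⊩ p₁ κ′ → ∃ λ t → ∃ λ s → g ⊩ E₁₀ t s
  good-coloured {κ} {κ′} κ≢κ′ (g , _) x₀ x₁ = by _ ≡.refl
    where
    good₀ = ⌈⌉⁻ x₀
    good₁ = ⌈⌉⁻ x₁

    by : ∀ l → lab g (inj₁ o₁) (inj₁ o₀) ≡ l → ∃ λ t → ∃ λ s → ⌈ lab g (inj₁ o₁) (inj₁ o₀) ≡ col (free t) s ⌉ ≡ true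
    by eq e = contradiction (just-injective (≡.trans (≡.sym (proj₁ good₀))
      (≡.trans (≡.sym (sort-cong g e)) (proj₁ good₁)))) κ≢κ′
      where
      just-injective : ∀ {x y : Fin (ℕ.suc ψ)} → just x ≡ just y → x ≡ y
      just-injective ≡.refl = ≡.refl
    by cc e with ≡.subst (Edge _ _) e (edge g (inj₁ o₁) (inj₁ o₀))
    ... | ccᵉ p _ = case ≡.trans (≡.sym (proj₁ good₁)) p of λ ()
    by (col c s) e with ≡.subst (Edge _ _) e (edge g (inj₁ o₁) (inj₁ o₀))
    ... | colᵉ c≢o₀ _ with free-surjective c c≢o₀ not-constant
      where
      -- The constant `a` is joined to both nodes by its own colour in shade zero, so an edge of
      -- this colour between them would need a shade below zero.
      not-constant : ∀ a → Constant a → c ≢ inj₁ a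
      not-constant a C ≡.refl = case Half.not-bad (proj₁ (tri g (inj₁ a) (inj₁ o₁) (inj₁ o₀)))
        (proj₂ (proj₂ good₁ a C)) (proj₂ (proj₂ good₀ a C)) e of λ ()
    ...   | t , ≡.refl = t , s , ⌈⌉⁺ e

  no-bad : ∀ t {s s′} → s Fin.≤ s′ → ∀ g → g ⊩ E₂₀ t s → g ⊩ E₂₁ t s → ¬ g ⊩ E₁₀ t s′
  no-bad t {s} {s′} s≤s′ (g , _) x y z = ℕ.<⇒≱ (Half.not-bad (proj₁ (tri g (inj₁ o₂) (inj₁ o₁) (inj₁ o₀)))
    (⌈⌉⁻ y) (⌈⌉⁻ x) (⌈⌉⁻ z)) s≤s′

  module Start where

    -- The extra constant `nothing` is the value of `o₁`, of `o₂` and of all spare nodes in `world`.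
    constants : Net (Maybe ∣ α ∣)
    constants = record
      { lab = lb ; sort = λ _ → nothing ; lab-refl = rf ; lab-sym = sy ; edge = ed ; tri = tr }
      where
      lb : Maybe ∣ α ∣ → Maybe ∣ α ∣ → Lab
      lb x y with em {P = x ≡ y}
      ... | yes _ = eq
      ... | no _  = cc

      rf : ∀ x → lb x x ≡ eq
      rf x with em {P = x ≡ x}
      ... | yes _  = ≡.refl
      ... | no x≢x = contradiction ≡.refl x≢x

      sy : ∀ x y → lb x y ≡ lb y x
      sy x y with em {P = x ≡ y} | em {P = y ≡ x}
      ... | yes _      | yes _      = ≡.refl
      ... | no _       | no _       = ≡.refl
      ... | yes ≡.refl | no y≢x     = contradiction ≡.refl y≢x
      ... | no x≢y     | yes ≡.refl = contradiction ≡.refl x≢y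

      ed : ∀ x y → Edge nothing nothing (lb x y)
      ed x y with em {P = x ≡ y}
      ... | yes _ = eqᵉ ≡.refl
      ... | no _  = ccᵉ ≡.refl ≡.refl

      hf : ∀ x y z → Half (lb x y) (lb x z) (lb y z)
      hf x y z = half
        (λ e → by e em)
        (λ p q _ → no-col p)
        where
        by : lb y z ≡ eq → Dec (y ≡ z) → lb x y ≡ lb x z
        by e (yes ≡.refl) = ≡.refl
        by e (no y≢z) with em {P = y ≡ z}
        by e  (no y≢z) | yes y≡z = contradiction y≡z y≢z
        by () (no y≢z) | no _

        no-col : ∀ {c s} {B : Set} → lb x y ≡ col c s → B
        no-col p with em {P = x ≡ y}
        no-col () | yes _
        no-col () | no _

      tr : ∀ x y z → Tri (lb x y) (lb x z) (lb y z)
      tr x y z = hf x y z ,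
        ≡.subst (λ l → Half l (lb y z) (lb x z)) (sy y x) (hf y x z) ,
        ≡.subst₂ (λ l l′ → Half l l′ (lb x y)) (sy z x) (sy z y) (hf z x y)

    private
      -- `nothing` and `o₀` have no colour of their own and borrow `o₁`. No bad triangle arises, as
      -- edges between different constants are `cc`.
      colour : Maybe ∣ α ∣ → ∣ α ∣
      colour nothing  = o₁
      colour (just a) = (id [ o₀ ↦ o₁ ]) a

      colour≢o₀ : ∀ x → colour x ≢ o₀
      colour≢o₀ nothing  = o₀≢o₁ ∘ ≡.sym
      colour≢o₀ (just a) with em {P = a ≡ o₀}
      ... | yes _   = o₀≢o₁ ∘ ≡.sym
      ... | no a≢o₀ = a≢o₀

      label : Maybe ∣ α ∣ → Lab
      label x = col (inj₁ (colour x)) Fin.zero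

      label-tri : ∀ x y → Tri (label x) (label y) (lab constants x y)
      label-tri x y with em {P = x ≡ y}
      ... | yes ≡.refl = Tri-swapʳ (Tri-swapˡ (Tri-eq (label x)))
      ... | no _       = half (λ ()) (λ _ _ ()) , half (λ ()) (λ _ ()) , half (λ ()) (λ _ ())

    model : Fin (ℕ.suc ψ) → Net (Maybe (Maybe ∣ α ∣))
    model κ = extend constants label (just κ)
      (λ x → colᵉ (colour≢o₀ x ∘ inj₁-injective) λ ()) label-tri

    private
      kindᵃ : ∣ α ∣ → Maybe (Maybe ∣ α ∣)
      kindᵃ = ((λ a → just (just a)) [ o₁ ↦ just nothing ] [ o₂ ↦ just nothing ]) [ o₀ ↦ nothing ]

      kind : I → Maybe (Maybe ∣ α ∣)
      kind (inj₁ a) = kindᵃ a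
      kind (inj₂ _) = just nothing

      kind-constant : ∀ a → Constant a → kindᵃ a ≡ just (just a)
      kind-constant a (a≢o₀ , a≢o₁ , a≢o₂) =
        ≡.trans (↦-other _ o₀ a≢o₀) (≡.trans (↦-other _ o₂ a≢o₂) (↦-other _ o₁ a≢o₁))

      just-update : ∀ {f : ∣ α ∣ → Maybe (Maybe ∣ α ∣)} i {z} → (∀ a → ∃ λ y → f a ≡ just y) →
                    ∀ a → ∃ λ y → (f [ i ↦ just z ]) a ≡ just y
      just-update i {z} h a with em {P = a ≡ i}
      ... | yes _ = z , ≡.refl
      ... | no _  = h a

      kind-old : ∀ x → x ≢ inj₁ o₀ → ∃ λ y → kind x ≡ just y
      kind-old (inj₂ _) _  = nothing , ≡.refl
      kind-old (inj₁ a) a≢ =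
        let y , e = just-update o₂ (just-update o₁ (λ a → just a , ≡.refl)) a in
        y , ≡.trans (↦-other _ o₀ λ { ≡.refl → a≢ ≡.refl }) e

      colour-constant : ∀ a → Constant a → colour (just a) ≡ a
      colour-constant a (a≢o₀ , _) = ↦-other id o₀ a≢o₀

      to-new : ∀ κ a → Constant a → lab (model κ) (kindᵃ a) nothing ≡ col (inj₁ a) Fin.zero
      to-new κ a C = ≡.trans (≡.cong (λ x → lab (model κ) x nothing) (kind-constant a C))
        (≡.cong (λ x → col (inj₁ x) Fin.zero) (colour-constant a C))

    world : Fin (ℕ.suc ψ) → World
    world κ = pull kind (model κ) , o₀ ∷ o₁ ∷ o₂ ∷ [] , λ a a∉ →
      let C = (λ e → a∉ (here e)) , (λ e → a∉ (there (here e))) , (λ e → a∉ (there (there (here e)))) in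
      ≡.cong (sort (model κ)) (kind-constant a C) ,
      λ x nc → Fin.zero , new {kindᵃ a} (kind x) nc (to-new κ a C)
      where
      new : ∀ {y l} x → sort (model κ) x ≢ nothing → lab (model κ) y nothing ≡ l → lab (model κ) y x ≡ l
      new nothing  _  e = e
      new (just _) nc e = contradiction ≡.refl nc

    -- The models differ only in the sort of the new node, and only `o₀` points to it.
    world-agree : ∀ κ κ′ → Agree (inj₁ o₀) (net (world κ)) (net (world κ′))
    world-agree κ κ′ = (λ x y x≢ y≢ → same-lab (kind x) (kind y)) , λ x x≢ →
      let y , e = kind-old x x≢ in
      ≡.trans (≡.cong (sort (model κ)) e) (≡.sym (≡.cong (sort (model κ′)) e))
      where
      same-lab : ∀ x y → lab (model κ) x y ≡ lab (model κ′) x y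
      same-lab nothing  nothing  = ≡.refl
      same-lab nothing  (just _) = ≡.refl
      same-lab (just _) nothing  = ≡.refl
      same-lab (just _) (just _) = ≡.refl

    world-good : ∀ κ → world κ ⊩ p₀ κ
    world-good κ = ⌈⌉⁺ (≡.cong (sort (model κ)) (↦-same _ o₀) , λ c C →
      ≡.cong (sort (model κ)) (kind-constant c C) ,
      ≡.trans (≡.cong (lab (model κ) (kindᵃ c)) (↦-same _ o₀)) (to-new κ c C))

    ∧-⊩ : ∀ X Y g → g ⊩ X → g ⊩ Y → g ⊩ X 𝔄.∧ Y
    ∧-⊩ X Y g = ∧⁺

    ⊩-∧ : ∀ X Y g → g ⊩ X 𝔄.∧ Y → g ⊩ X × g ⊩ Y
    ⊩-∧ X Y g = ∧⁻

    extension : Fin (ℕ.suc ψ) → 𝔄.Carrier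
    extension κ = 𝔄.cyl o₀ (p₀ κ)

    extensions : List (Fin (ℕ.suc ψ)) → 𝔄.Carrier
    extensions = foldr (λ κ X → extension κ 𝔄.∧ X) 𝔄.⊤

    common : 𝔄.Carrier
    common = extensions (allFin (ℕ.suc ψ))

    extensions-lower : ∀ g {κ K} → κ ∈ K → g ⊩ extensions K → g ⊩ extension κ
    extensions-lower g {K = κ ∷ K} (here ≡.refl) x = proj₁ (⊩-∧ (extension κ) (extensions K) g x)
    extensions-lower g {K = κ ∷ K} (there κ∈) x    =
      extensions-lower g κ∈ (proj₂ (⊩-∧ (extension κ) (extensions K) g x))

    common-lower : ∀ κ g → g ⊩ common → g ⊩ extension κ
    common-lower κ g = extensions-lower g (∈-allFin κ)

    world-extensions : ∀ K → world Fin.zero ⊩ extensions K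
    world-extensions []      = ≡.refl
    world-extensions (κ ∷ K) = ∧-⊩ (extension κ) (extensions K) (world Fin.zero)
      (cyl⁺ {inj₁ o₀} (proj₁ (p₀ κ)) {world Fin.zero} {world κ} (world-agree Fin.zero κ) (world-good κ))
      (world-extensions K)

    world-common : world Fin.zero ⊩ common
    world-common = world-extensions (allFin (ℕ.suc ψ))

  incl : ∀ X Y → (∀ g → g ⊩ X → g ⊩ Y) → X 𝔄.≈ (X 𝔄.∧ Y)
  incl X Y h g = Bool-ext (λ x → ∧⁺ x (h g x)) (proj₁ ∘ ∧⁻)

  subs-incl : ∀ i j P Q → (∀ g → lab g (inj₁ i) (inj₁ j) ≡ eq → holds P g → holds Q g) →
              Independent (inj₁ i) (holds Q) →
              ∀ g → g ⊩ 𝔄.cyl i (𝔄.diag i j 𝔄.∧ neat P) → g ⊩ neat Q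
  subs-incl i j P Q h ind g x =
    let g′ , a , y = cyl⁻ {inj₁ i} (proj₁ (𝔄.diag i j 𝔄.∧ neat P)) {g} x ; d , z = ∧⁻ y in
    ⌈⌉⁺ (ind (net g′) (net g) (Agree-sym {inj₁ i} {net g} {net g′} a) (h (net g′) (⌈⌉⁻ d) (⌈⌉⁻ z)))

  any-coloured : List (Fin N × Shade) → 𝔄.Carrier
  any-coloured = foldr (λ ts X → E₁₀ (proj₁ ts) (proj₂ ts) 𝔄.∨ X) 𝔄.⊥

  coloured-any : ∀ {g t s L} → g ⊩ E₁₀ t s → (t , s) ∈ L → g ⊩ any-coloured L
  coloured-any e (here ≡.refl) = ∨⁺ (inj₁ e)
  coloured-any e (there ts∈)   = ∨⁺ (inj₂ (coloured-any e ts∈))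

  obstruction : Obstruction 𝔄 k r (ℕ.suc ψ)
  obstruction = record
    { triple = os
    ; p₀ = p₀ ; p₁ = p₁ ; E₂₀ = E₂₀ ; E₂₁ = E₂₁ ; E₁₀ = E₁₀
    ; p₀-closed₁ = λ κ → element-closed (good κ o₀ o₀∉C) (good-independent κ o₀ o₀∉C o₀≢o₁ o₁∉C)
    ; p₀-closed₂ = λ κ → element-closed (good κ o₀ o₀∉C) (good-independent κ o₀ o₀∉C o₀≢o₂ o₂∉C)
    ; p₁-closed₀ = λ κ → element-closed (good κ o₁ o₁∉C) (good-independent κ o₁ o₁∉C (o₀≢o₁ ∘ ≡.sym) o₀∉C)
    ; E₂₀-closed₁ = λ t s → element-closed (coloured (free t) s o₂ o₀)
        (coloured-independent (free t) s (o₁≢o₂ ∘ ≡.sym) o₀≢o₁)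
    ; E₂₁-closed₀ = λ t s → element-closed (coloured (free t) s o₂ o₁)
        (coloured-independent (free t) s (o₀≢o₂ ∘ ≡.sym) (o₀≢o₁ ∘ ≡.sym))
    ; E₁₀-closed₂ = λ t s → element-closed (coloured (free t) s o₁ o₀)
        (coloured-independent (free t) s o₁≢o₂ o₀≢o₂)
    ; p-rename = λ κ → incl (𝔄.cyl o₀ (𝔄.diag o₀ o₁ 𝔄.∧ p₀ κ)) (p₁ κ)
        (subs-incl o₀ o₁ (good κ o₀ o₀∉C) (good κ o₁ o₁∉C)
          (λ g e (x , h) → ≡.trans (≡.sym (sort-cong g e)) x , λ c C → proj₁ (h c C) ,
            ≡.trans (lab-sym g _ _) (≡.trans (≡.sym (lab-cong g (inj₁ c) e)) (≡.trans (lab-sym g _ _) (proj₂ (h c C)))))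
          (good-independent κ o₁ o₁∉C (o₀≢o₁ ∘ ≡.sym) o₀∉C))
    ; E-rename = λ t s → incl (𝔄.cyl o₀ (𝔄.diag o₀ o₁ 𝔄.∧ E₂₀ t s)) (E₂₁ t s)
        (subs-incl o₀ o₁ (coloured (free t) s o₂ o₀) (coloured (free t) s o₂ o₁)
          (λ g e x → ≡.trans (lab-sym g _ _) (≡.trans (≡.sym (lab-cong g (inj₁ o₂) e)) (≡.trans (lab-sym g _ _) x)))
          (coloured-independent (free t) s (o₀≢o₂ ∘ ≡.sym) (o₀≢o₁ ∘ ≡.sym)))
    ; E-copy = λ t s → incl (𝔄.diag o₁ o₂ 𝔄.∧ E₁₀ t s) (E₂₀ t s) λ (g , _) x → let d , y = ∧⁻ x in
        ⌈⌉⁺ (≡.trans (≡.sym (lab-cong g (inj₁ o₀) (⌈⌉⁻ d))) (⌈⌉⁻ y))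
    ; no-bad = λ t s≤s′ g → Bool-ext
        (λ x → let x₀ , y = ∧⁻ x ; x₁ , x₂ = ∧⁻ y in contradiction x₂ (no-bad t s≤s′ g x₀ x₁)) λ ()
    ; covered = λ {κ} {κ′} κ≢κ′ → incl (p₀ κ 𝔄.∧ p₁ κ′) (any-coloured M.labels) λ g x →
        let t , s , e = good-coloured κ≢κ′ g (proj₁ (∧⁻ x)) (proj₂ (∧⁻ x)) in
        coloured-any {g} {t} {s} e (∈-cartesianProduct⁺ (∈-allFin t) (∈-allFin s))
    ; common = Start.common
    ; common-≤ = λ κ → incl Start.common (𝔄.cyl o₀ (p₀ κ)) (Start.common-lower κ)
    ; common-≉⊥ = λ h → contradiction (≡.trans (≡.sym Start.world-common) (h (Start.world Fin.zero))) λ ()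
    }

  𝔄∉SNrCA : ¬ S (NrCA (≤-+ₒ α (fin (k + 1)))) 𝔄
  𝔄∉SNrCA s = let 𝔇 , isCA , emb = S⇒NeatEmbedding {α = α} {β = α +ₒ fin (k + 1)} (≤-+ₒ α (fin (k + 1))) {𝔄} s in
    Transfer.no-embedding cl ψ≡ obstruction isCA (λ _ _ ()) emb

-- Representability

module Structures (cl : Classical) {ℓ : Level} (α : Ordinal ℓ) (os : Triple ∣ α ∣) (k r ψ : ℕ) (spare : Fin k) where

  open Logic cl
  open Triple os
  open Pigeonhole cl
  open Networks cl os k r ψ
  open NetworkAlgebra cl os k r ψ
  open NeatReduct cl α os k r ψ
  open Net

  A = ∣ α ∣

  -- A node that duplicates no more than the α − 1 demanded ones leaves a colour
  -- for its edges to all other nodes, because k ≥ 1.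
  unused-colour : ∀ (b : World) (i : A) →
    (∀ β → ∃ λ j → j ≢ i × lab (net b) (inj₂ β) (inj₁ j) ≡ eq) →
    ∃ λ c → c ≢ inj₁ o₀ × (∀ y → y ≢ inj₁ i → ∀ s → lab (net b) (inj₁ i) y ≢ col c s)
  unused-colour (b , Δ , w) i dup = dne λ none →
    no-proper-injection R R-inj {U} {i} (here refl) (λ {a} a∈U → user none a∈U)
    where
    U : List A
    U = i ∷ o₀ ∷ Δ

    -- An injection of α into the permitted colours: the forbidden `o₀` is replaced by a spare
    -- colour. This is the use of k ≥ 1.
    κ : A → I
    κ = inj₁ [ o₀ ↦ inj₂ spare ]

    κ-inj₁ : ∀ {a w} → κ a ≡ inj₁ w → a ≡ w
    κ-inj₁ {a} e with em {P = a ≡ o₀}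
    κ-inj₁ () | yes _
    κ-inj₁ refl | no _ = refl

    κ≢o₀ : ∀ a → κ a ≢ inj₁ o₀
    κ≢o₀ a e with em {P = a ≡ o₀}
    κ≢o₀ a ()   | yes _
    κ≢o₀ a refl | no a≢o₀ = a≢o₀ refl

    κ-injective : ∀ {a a′} → κ a ≡ κ a′ → a ≡ a′
    κ-injective {a} {a′} e with em {P = a ≡ o₀} | em {P = a′ ≡ o₀}
    κ-injective refl | yes p | yes q = trans p (sym q)
    κ-injective ()   | yes p | no _
    κ-injective ()   | no _  | yes q
    κ-injective refl | no _  | no _  = refl

    R : A → A → Set ℓ
    R a x = ∃ λ s → lab b (inj₁ i) (inj₁ x) ≡ col (κ a) s

    R-inj : ∀ {a a′ x} → R a x → R a′ x → a ≡ a′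
    R-inj (_ , l) (_ , l′) = κ-injective (col-injective l l′)

    -- A node outside `U` is a constant. Its edge to `i` has its own colour, or none if `i` is a
    -- constant too, hence never a colour from `U`.
    in-U : ∀ {a x} → a ∈ U → R a x → x ∈ U
    in-U {a} {x} a∈U (s , l) = dne λ x∉U →
      let x-const , x-lab = w x (x∉U ∘ there ∘ there) in
      case em {P = sort b (inj₁ i) ≡ nothing} of λ
        { (no nc) → x∉U (subst (_∈ U) (κ-inj₁ (col-injective l
            (trans (lab-sym b _ _) (proj₂ (x-lab (inj₁ i) nc))))) a∈U)
        ; (yes ic) → both-constant (subst (Edge _ _) l (edge b (inj₁ i) (inj₁ x))) (ic , x-const)
        }
      where
      both-constant : ∀ {σ τ c s} → Edge σ τ (col c s) → ¬ (σ ≡ nothing × τ ≡ nothing)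
      both-constant (colᵉ _ h) = h

    user : ¬ (∃ λ c → c ≢ inj₁ o₀ × (∀ y → y ≢ inj₁ i → ∀ s → lab b (inj₁ i) y ≢ col c s)) →
           ∀ {a} → a ∈ U → ∃ λ x → x ∈ U × x ≢ i × R a x
    user none {a} a∈U = dne λ h → none (κ a , κ≢o₀ a , unused h)
      where
      unused : ¬ (∃ λ x → x ∈ U × x ≢ i × R a x) → ∀ y → y ≢ inj₁ i → ∀ s → lab b (inj₁ i) y ≢ col (κ a) s
      unused h (inj₁ x) x≢i s l = h (x , in-U a∈U (s , l) , (λ { refl → x≢i refl }) , s , l)
      unused h (inj₂ β) _   s l = let j , j≢i , e = dup β
                                      l′ = trans (lab-cong₂ b (lab-refl b (inj₁ i)) (trans (lab-sym b _ _) e)) l in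
        h (j , in-U a∈U (s , l′) , j≢i , s , l′)

  length-cartesianProductWith : ∀ {a b c} {X : Set a} {Y : Set b} {Z : Set c} (f : X → Y → Z) xs ys →
    length (cartesianProductWith f xs ys) ≡ length xs * length ys
  length-cartesianProductWith f []       ys = refl
  length-cartesianProductWith f (x ∷ xs) ys = trans (length-++ (map (f x) ys))
    (cong₂ _+_ (length-map (f x) ys) (length-cartesianProductWith f xs ys))

  shadeOf : Lab → Shade
  shadeOf (col _ s) = s
  shadeOf _         = Fin.zero

  -- Equal nodes must receive the same edge, so a new shade is given to the whole `eq`-class of a
  -- point at once.
  fresh-shades : ∀ {Q : Set ℓ} (M : Net Q) (used : List Shade) (xs : List Q) → length used + length xs ℕ.≤ r →
    ∃ λ (ν : Q → Shade) → (∀ {x y} → lab M x y ≡ eq → ν x ≡ ν y) × (∀ {x} → x ∈ xs → ν x ∉ used) ×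
                          (∀ {x y} → x ∈ xs → y ∈ xs → ν x ≡ ν y → lab M x y ≡ eq)
  fresh-shades M used []       _ = (λ _ → Fin.zero) , (λ _ → refl) , (λ ()) , λ ()
  fresh-shades {Q} M used (p ∷ xs) room
    with fresh-shades M used xs (ℕ.≤-trans (ℕ.+-monoʳ-≤ (length used) (ℕ.n≤1+n _)) room)
  ... | ν₀ , cong₀ , fresh₀ , inj₀
    with fresh (used ++ map ν₀ xs) (subst (ℕ._< ℕ.suc r)
      (sym (trans (length-++ used) (cong (length used +_) (length-map ν₀ xs))))
      (ℕ.≤-trans (subst (ℕ._≤ r) (ℕ.+-suc (length used) (length xs)) room) (ℕ.n≤1+n r)))
  ... | s , s∉ = ν , ν-cong , ν-fresh , ν-inj
    where
    ν : Q → Shade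
    ν x with em {P = lab M x p ≡ eq}
    ... | yes _ = s
    ... | no _  = ν₀ x

    ν-cong : ∀ {x y} → lab M x y ≡ eq → ν x ≡ ν y
    ν-cong {x} {y} e with em {P = lab M x p ≡ eq} | em {P = lab M y p ≡ eq}
    ... | yes _ | yes _ = refl
    ... | no _  | no _  = cong₀ e
    ... | yes q | no ¬q = contradiction (trans (sym (lab-cong M p e)) q) ¬q
    ... | no ¬q | yes q = contradiction (trans (lab-cong M p e) q) ¬q

    old : ∀ {x} → x ∈ p ∷ xs → ¬ lab M x p ≡ eq → x ∈ xs
    old (here refl) ¬q = contradiction (lab-refl M _) ¬q
    old (there x∈)  _  = x∈

    ν-fresh : ∀ {x} → x ∈ p ∷ xs → ν x ∉ used
    ν-fresh {x} x∈ with em {P = lab M x p ≡ eq}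
    ... | yes _ = s∉ ∘ ∈-++⁺ˡ
    ... | no ¬q = fresh₀ (old x∈ ¬q)

    ν-inj : ∀ {x y} → x ∈ p ∷ xs → y ∈ p ∷ xs → ν x ≡ ν y → lab M x y ≡ eq
    ν-inj {x} {y} x∈ y∈ e with em {P = lab M x p ≡ eq} | em {P = lab M y p ≡ eq}
    ... | yes q | yes q′ = lab-trans M q (trans (lab-sym M p y) q′)
    ... | no ¬q | no ¬q′ = inj₀ (old x∈ ¬q) (old y∈ ¬q′) e
    ... | yes q | no ¬q′ = contradiction (∈-++⁺ʳ used (subst (_∈ map ν₀ xs) (sym e) (∈-map⁺ ν₀ (old y∈ ¬q′)))) s∉
    ... | no ¬q | yes q′ = contradiction (∈-++⁺ʳ used (subst (_∈ map ν₀ xs) e (∈-map⁺ ν₀ (old x∈ ¬q)))) s∉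

  -- The edges among `n` points use at most `n * n` shades, and `n` new ones are wanted out of
  -- `r + 1`.
  Room : ℕ → Set
  Room n = n * n + n ℕ.≤ r

  Room-mono : ∀ {m n} → m ℕ.≤ n → Room n → Room m
  Room-mono m≤n = ℕ.≤-trans (ℕ.+-mono-≤ (ℕ.*-mono-≤ m≤n m≤n) m≤n)

  -- Finite up to named points: whatever is not in `pts` is named by an index outside `Γ`. Only
  -- members of `pts` will ever ask for new shades.
  record Structure (Γ : List A) : Set (suc ℓ) where
    field
      Q     : Set ℓ
      M     : Net Q
      e     : A → Q
      weak  : Weak M e
      pts   : List Q
      cover : ∀ x → x ∈ pts ⊎ ∃ λ j → j ∉ Γ × x ≡ e j

    Fixes : (I → Q) → Set ℓ
    Fixes f = ∀ j → j ∉ Γ → f (inj₁ j) ≡ e j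

    view : (f : I → Q) → Fixes f → World
    view f fix = pull f M , pull-weak {M = M} f inj₁ Γ fix weak

  record _⊑_ {Γ} (S S′ : Structure Γ) : Set ℓ where
    module S  = Structure S
    module S′ = Structure S′
    field
      ι      : S.Q → S′.Q
      ι-lab  : ∀ x y → lab S′.M (ι x) (ι y) ≡ lab S.M x y
      ι-sort : ∀ x → sort S′.M (ι x) ≡ sort S.M x
      ι-e    : ∀ a → S′.e a ≡ ι (S.e a)

  ⊑-refl : ∀ {Γ} {S : Structure Γ} → S ⊑ S
  ⊑-refl = record { ι = id ; ι-lab = λ _ _ → refl ; ι-sort = λ _ → refl ; ι-e = λ _ → refl }

  ⊑-trans : ∀ {Γ} {S T U : Structure Γ} → S ⊑ T → T ⊑ U → S ⊑ U
  ⊑-trans p q = record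
    { ι      = q.ι ∘ p.ι
    ; ι-lab  = λ x y → trans (q.ι-lab _ _) (p.ι-lab x y)
    ; ι-sort = λ x → trans (q.ι-sort _) (p.ι-sort x)
    ; ι-e    = λ a → trans (q.ι-e a) (cong q.ι (p.ι-e a))
    }
    where
    module p = _⊑_ p
    module q = _⊑_ q

  module OnePoint {Γ} (S : Structure Γ) where

    open Structure S

    record Realises (f : I → Q) (i : A) (b : World) : Set (suc ℓ) where
      field
        S′    : Structure Γ
        S⊑S′  : S ⊑ S′
        z     : Structure.Q S′
        net≗  : net b ≗ⁿ pull ((_⊑_.ι S⊑S′ ∘ f) [ inj₁ i ↦ z ]) (Structure.M S′)
        size  : length (Structure.pts S′) ℕ.≤ ℕ.suc (length pts)

    module _ (f : I → Q) (fix : Fixes f) (i : A) (i∈Γ : i ∈ Γ) (b : World)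
             (agree : Agree (inj₁ i) (pull f M) (net b)) where

      realise-old : ∀ y → y ≢ inj₁ i → lab (net b) (inj₁ i) y ≡ eq → Realises f i b
      realise-old y y≢i l = record
        { S′ = S ; S⊑S′ = ⊑-refl ; z = f y ; size = ℕ.n≤1+n _
        ; net≗ = (λ x x′ → trans (lab-cong₂ (net b) (τ-eq x) (τ-eq x′)) (trans
                    (sym (proj₁ agree (τ x) (τ x′) (τ≢i x) (τ≢i x′))) (cong₂ (lab M) (fτ x) (fτ x′)))) ,
                 (λ x → trans (sort-cong (net b) (τ-eq x)) (trans
                    (sym (proj₂ agree (τ x) (τ≢i x))) (cong (sort M) (fτ x))))
        }
        where
        τ : I → I
        τ = id [ inj₁ i ↦ y ]

        τ-eq : ∀ x → lab (net b) x (τ x) ≡ eq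
        τ-eq x with em {P = x ≡ inj₁ i}
        ... | yes refl = l
        ... | no _     = lab-refl (net b) x

        τ≢i : ∀ x → τ x ≢ inj₁ i
        τ≢i x with em {P = x ≡ inj₁ i}
        ... | yes _  = y≢i
        ... | no x≢i = x≢i

        fτ : ∀ x → f (τ x) ≡ (f [ inj₁ i ↦ f y ]) x
        fτ x with em {P = x ≡ inj₁ i}
        ... | yes _ = refl
        ... | no _  = refl

      module New (new : ∀ y → y ≢ inj₁ i → lab (net b) (inj₁ i) y ≢ eq)
                 (c : I) (c≢o₀ : c ≢ inj₁ o₀) (unused : ∀ y → y ≢ inj₁ i → ∀ s → lab (net b) (inj₁ i) y ≢ col c s)
                 (ν : Q → Shade) (ν-cong : ∀ {x y} → lab M x y ≡ eq → ν x ≡ ν y)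
                 (ν-inj : ∀ {x y} → x ∈ pts → y ∈ pts → ν x ≡ ν y → lab M x y ≡ eq)
                 (ν-fresh : ∀ {x y} → x ∈ pts → y ∈ pts → ∀ {c′ s} → lab M x y ≡ col c′ s → ν x ≢ s × ν y ≢ s) where

        private
          bn = net b
          bi = lab bn (inj₁ i)

        Demanded : Q → Set ℓ
        Demanded x = ∃ λ y → y ≢ inj₁ i × lab M x (f y) ≡ eq

        generic : Q → Lab
        generic x with em {P = sort bn (inj₁ i) ≡ nothing × sort M x ≡ nothing}
        ... | yes _ = cc
        ... | no _  = col c (ν x)

        l : Q → Lab
        l x with em {P = Demanded x}
        ... | yes (y , _) = bi y
        ... | no _        = generic x

        l-demanded : ∀ {x} y → y ≢ inj₁ i → lab M x (f y) ≡ eq → l x ≡ bi y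
        l-demanded {x} y y≢i e with em {P = Demanded x}
        ... | no ¬d = contradiction (y , y≢i , e) ¬d
        ... | yes (y′ , y′≢i , e′) = lab-cong₂ bn (lab-refl bn _)
          (trans (sym (proj₁ agree y′ y y′≢i y≢i)) (lab-trans M (trans (lab-sym M _ _) e′) e))

        data View (x : Q) : Set ℓ where
          demanded  : ∀ y → y ≢ inj₁ i → lab M x (f y) ≡ eq → l x ≡ bi y → View x
          undemanded : ¬ Demanded x → l x ≡ generic x → View x

        view-of : ∀ x → View x
        view-of x = by em
          where
          by : Dec (Demanded x) → View x
          by (yes (y , y≢i , e)) = demanded y y≢i e (l-demanded y y≢i e)
          by (no ¬d) = undemanded ¬d l≡
            where
            l≡ : l x ≡ generic x
            l≡ with em {P = Demanded x}
            ... | yes d = contradiction d ¬d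
            ... | no _  = refl

        generic≢eq : ∀ {x} → generic x ≢ eq
        generic≢eq {x} e with em {P = sort bn (inj₁ i) ≡ nothing × sort M x ≡ nothing}
        generic≢eq () | yes _
        generic≢eq () | no _

        generic-col : ∀ {x c′ s} → generic x ≡ col c′ s → c′ ≡ c × s ≡ ν x
        generic-col {x} e with em {P = sort bn (inj₁ i) ≡ nothing × sort M x ≡ nothing}
        generic-col ()   | yes _
        generic-col refl | no _ = refl , refl

        generic-cong : ∀ {x y} → lab M x y ≡ eq → generic x ≡ generic y
        generic-cong {x} {y} e
          with em {P = sort bn (inj₁ i) ≡ nothing × sort M x ≡ nothing}
             | em {P = sort bn (inj₁ i) ≡ nothing × sort M y ≡ nothing}
        ... | yes _ | yes _ = refl
        ... | no _  | no _  = cong (col c) (ν-cong e)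
        ... | yes (p , q) | no ¬pq = contradiction (p , trans (sym (sort-cong M e)) q) ¬pq
        ... | no ¬pq | yes (p , q) = contradiction (p , trans (sort-cong M e) q) ¬pq

        generic-edge : ∀ x → Edge (sort bn (inj₁ i)) (sort M x) (generic x)
        generic-edge x with em {P = sort bn (inj₁ i) ≡ nothing × sort M x ≡ nothing}
        ... | yes (p , q) = ccᵉ p q
        ... | no ¬pq      = colᵉ c≢o₀ ¬pq

        -- Any other point is `e j` for some `j ∉ Γ`; then `j ≢ i`, and `f` already takes this point
        -- at coordinate `j`.
        undemanded-pts : ∀ {x} → ¬ Demanded x → x ∈ pts
        undemanded-pts {x} ¬d with cover x
        ... | inj₁ x∈ = x∈
        ... | inj₂ (j , j∉Γ , refl) = contradiction
          (inj₁ j , (λ { refl → j∉Γ i∈Γ }) , trans (cong (lab M (e j)) (fix j j∉Γ)) (lab-refl M (e j))) ¬d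

        l-edge : ∀ x → Edge (sort bn (inj₁ i)) (sort M x) (l x)
        l-edge x with view-of x
        ... | undemanded _ l≡ = subst (Edge _ _) (sym l≡) (generic-edge x)
        ... | demanded y y≢i e l≡ = subst₂ (Edge _)
          (trans (sym (proj₂ agree y y≢i)) (sym (sort-cong M e))) (sym l≡) (edge bn (inj₁ i) y)

        -- The colour `c` is absent from the prescribed edges, so a generic and a prescribed edge
        -- never have the same colour.
        mixed : ∀ {x y′ m} → y′ ≢ inj₁ i → m ≢ eq → Tri (generic x) (bi y′) m
        mixed {x} {y′} y′≢i m≢eq =
          half (λ e → contradiction e m≢eq) (λ p q _ → uses p q) ,
          half (λ e → contradiction e (new y′ y′≢i)) (λ p _ t → uses p t) ,
          half (λ e → contradiction e generic≢eq) (λ p _ t → uses t p)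
          where
          uses : ∀ {B : Set} {c′ s s′} → generic x ≡ col c′ s → bi y′ ≡ col c′ s′ → B
          uses p q with generic-col p
          ... | refl , _ = contradiction q (unused y′ y′≢i _)

        l-tri : ∀ x y → Tri (l x) (l y) (lab M x y)
        l-tri x y with view-of x | view-of y
        ... | demanded x′ x′≢i ex lx | demanded y′ y′≢i ey ly =
          subst₂ (λ m n → Tri m n (lab M x y)) (sym lx) (sym ly)
            (subst (Tri (bi x′) (bi y′)) (trans (sym (proj₁ agree x′ y′ x′≢i y′≢i)) (sym (lab-cong₂ M ex ey)))
              (tri bn (inj₁ i) x′ y′))
        ... | undemanded ¬d lx | demanded y′ y′≢i ey ly =
          subst₂ (λ m n → Tri m n (lab M x y)) (sym lx) (sym ly)
            (mixed y′≢i λ e → ¬d (y′ , y′≢i , lab-trans M e ey))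
        ... | demanded x′ x′≢i ex lx | undemanded ¬d ly =
          subst₂ (λ m n → Tri m n (lab M x y)) (sym lx) (sym ly)
            (Tri-swapˡ (mixed x′≢i λ e → ¬d (x′ , x′≢i , lab-trans M (trans (lab-sym M y x) e) ex)))
        -- Generic shades at different points differ from each other and from the shades of all old
        -- edges in `pts`, so no two edges of a proper triangle share a colour and a shade as a bad
        -- triangle requires.
        ... | undemanded ¬dx lx | undemanded ¬dy ly =
          subst₂ (λ m n → Tri m n (lab M x y)) (sym lx) (sym ly) (
            half generic-cong (λ p q t → distinct p q t) ,
            half (λ e → contradiction e generic≢eq) (λ p q _ → proj₁ (stale q) p) ,
            half (λ e → contradiction e generic≢eq) (λ p q _ → proj₂ (stale q) p))
          where
          x∈ = undemanded-pts ¬dx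
          y∈ = undemanded-pts ¬dy

          distinct : ∀ {B : Set} {c′ s s′} → generic x ≡ col c′ s → generic y ≡ col c′ s → lab M x y ≡ col c′ s′ → B
          distinct p q t = case trans (sym t)
            (ν-inj x∈ y∈ (trans (sym (proj₂ (generic-col p))) (proj₂ (generic-col q)))) of λ ()

          stale : ∀ {B : Set} {c′ s} → lab M x y ≡ col c′ s →
                  (generic x ≡ col c′ s → B) × (generic y ≡ col c′ s → B)
          stale t = (λ p → contradiction (sym (proj₂ (generic-col p))) (proj₁ (ν-fresh x∈ y∈ t))) ,
                    (λ p → contradiction (sym (proj₂ (generic-col p))) (proj₂ (ν-fresh x∈ y∈ t)))

        M′ : Net (Maybe Q)
        M′ = extend M l (sort bn (inj₁ i)) l-edge l-tri

        weak′ : Weak M′ (just ∘ e)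
        weak′ = (proj₁ weak ++ proj₁ (proj₂ b)) ++ Γ , λ j j∉ →
          let jc , jl = proj₂ weak j (j∉ ∘ ∈-++⁺ˡ ∘ ∈-++⁺ˡ)
              j∉Γ = j∉ ∘ ∈-++⁺ʳ (proj₁ weak ++ proj₁ (proj₂ b))
              _ , bl = proj₂ (proj₂ b) j (j∉ ∘ ∈-++⁺ˡ ∘ ∈-++⁺ʳ (proj₁ weak))
          in jc , λ
            { (just x) nc → jl x nc
            ; nothing nc → let s , t = bl (inj₁ i) nc in s , trans
                (l-demanded (inj₁ j) (λ { refl → j∉Γ i∈Γ }) (trans (cong (lab M (e j)) (fix j j∉Γ)) (lab-refl M (e j))))
                (trans (lab-sym bn _ _) t)
            }

        structure : Structure Γ
        structure = record
          { Q = Maybe Q ; M = M′ ; e = just ∘ e ; weak = weak′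
          ; pts = nothing ∷ map just pts
          ; cover = λ
            { nothing  → inj₁ (here refl)
            ; (just x) → case cover x of λ
                { (inj₁ x∈) → inj₁ (there (∈-map⁺ just x∈))
                ; (inj₂ (j , j∉ , e)) → inj₂ (j , j∉ , cong just e) } }
          }

        realise-new : Realises f i b
        realise-new = record
          { S′ = structure
          ; S⊑S′ = record { ι = just ; ι-lab = λ _ _ → refl ; ι-sort = λ _ → refl ; ι-e = λ _ → refl }
          ; z = nothing
          ; net≗ = lab≡ , sort≡
          ; size = ℕ.≤-reflexive (cong ℕ.suc (length-map just pts))
          }
          where
          h : I → Maybe Q
          h = (just ∘ f) [ inj₁ i ↦ nothing ]

          h-new : h (inj₁ i) ≡ nothing
          h-new = ↦-same (just ∘ f) (inj₁ i)

          h-old : ∀ {x} → x ≢ inj₁ i → h x ≡ just (f x)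
          h-old = ↦-other (just ∘ f) (inj₁ i)

          row : ∀ y → y ≢ inj₁ i → bi y ≡ lab M′ (h (inj₁ i)) (h y)
          row y y≢i = trans (sym (l-demanded y y≢i (lab-refl M (f y)))) (sym (cong₂ (lab M′) h-new (h-old y≢i)))

          lab≡ : ∀ x y → lab bn x y ≡ lab M′ (h x) (h y)
          lab≡ x y = by em em
            where
            by : Dec (x ≡ inj₁ i) → Dec (y ≡ inj₁ i) → lab bn x y ≡ lab M′ (h x) (h y)
            by (yes refl) (yes refl) = trans (lab-refl bn _) (sym (lab-refl M′ (h (inj₁ i))))
            by (yes refl) (no y≢i)   = row y y≢i
            by (no x≢i)   (yes refl) = trans (lab-sym bn x _) (trans (row x x≢i) (lab-sym M′ _ (h x)))
            by (no x≢i)   (no y≢i)   = trans (sym (proj₁ agree x y x≢i y≢i))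
                                         (sym (cong₂ (lab M′) (h-old x≢i) (h-old y≢i)))

          sort≡ : ∀ x → sort bn x ≡ sort M′ (h x)
          sort≡ x = by em
            where
            by : Dec (x ≡ inj₁ i) → sort bn x ≡ sort M′ (h x)
            by (yes refl) = sym (cong (sort M′) h-new)
            by (no x≢i)   = trans (sym (proj₂ agree x x≢i)) (sym (cong (sort M′) (h-old x≢i)))

      realise : (∀ β → ∃ λ j → j ≢ i × f (inj₂ β) ≡ f (inj₁ j)) → Room (length pts) → Realises f i b
      realise dup room = by em
        where
        duplicate : ∀ β → ∃ λ j → j ≢ i × lab (net b) (inj₂ β) (inj₁ j) ≡ eq
        duplicate β with dup β
        ... | j , j≢i , e = j , j≢i , trans (sym (proj₁ agree (inj₂ β) (inj₁ j) (λ ()) (j≢i ∘ inj₁-injective)))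
                                        (trans (cong (λ x → lab M x (f (inj₁ j))) e) (lab-refl M _))

        used : List Shade
        used = cartesianProductWith (λ x y → shadeOf (lab M x y)) pts pts

        by : Dec (∃ λ y → y ≢ inj₁ i × lab (net b) (inj₁ i) y ≡ eq) → Realises f i b
        by (yes (y , y≢i , l)) = realise-old y y≢i l
        by (no ¬old) with unused-colour b i duplicate
          | fresh-shades M used pts (subst (λ n → n + length pts ℕ.≤ r)
              (sym (length-cartesianProductWith (λ x y → shadeOf (lab M x y)) pts pts)) room)
        ... | c , c≢o₀ , unused | ν , ν-cong , ν-fresh , ν-inj =
          New.realise-new (λ y y≢i l → ¬old (y , y≢i , l)) c c≢o₀ unused ν ν-cong ν-inj
            λ {x} {y} x∈ y∈ {c′} {s} l →
              let s∈ = subst (_∈ used) (cong shadeOf l) (∈-cartesianProductWith⁺ (λ x y → shadeOf (lab M x y)) x∈ y∈) in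
              (λ { refl → ν-fresh x∈ s∈ }) , (λ { refl → ν-fresh y∈ s∈ })

-- Skolem terms: wit s i X names a witness for the i-th cylindrification of X at
-- the sequence s.
data Point {a e} (A : Set a) (E : Set e) : Set (a ⊔ e) where
  base : A → Point A E
  wit  : (A → Point A E) → A → E → Point A E

module Approximation (cl : Classical) where

  module _ {a b} {X : Set a} {Y : Set b} where
    open Update cl {a} {b} {X} {Y} public

  -- A model of dimension Γ₀ in which the members of L are witnesses.
  record ApproximateModel {ℓ} {A : Set ℓ} (𝔅 : RawCylindricAlgebra A ℓ ℓ) {E : Set ℓ}
                          (eval : E → RawCylindricAlgebra.Carrier 𝔅) (Γ₀ : List A) (L : List (Point A E))
                          (a : RawCylindricAlgebra.Carrier 𝔅) : Set (suc ℓ) where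
    private module B = RawCylindricAlgebra 𝔅
    infix 4 _~_
    field
      Q        : Set ℓ
      _~_      : Q → Q → Set ℓ
      ~-refl   : ∀ {x} → x ~ x
      ~-sym    : ∀ {x y} → x ~ y → y ~ x
      ~-trans  : ∀ {x y z} → x ~ y → y ~ z → x ~ z
      env      : Point A E → Q
      Sat      : (A → Q) → B.Carrier → Set
      sat-≈    : ∀ {w X Y} → X B.≈ Y → Sat w X → Sat w Y
      sat-~    : ∀ {w w′} X → (∀ j → w j ~ w′ j) → Sat w X → Sat w′ X
      sat-∨⁻   : ∀ {w} X Y → Sat w (X B.∨ Y) → Sat w X ⊎ Sat w Y
      sat-∨⁺   : ∀ {w} X Y → Sat w X ⊎ Sat w Y → Sat w (X B.∨ Y)
      sat-∧⁻   : ∀ {w} X Y → Sat w (X B.∧ Y) → Sat w X × Sat w Y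
      sat-∧⁺   : ∀ {w} X Y → Sat w X × Sat w Y → Sat w (X B.∧ Y)
      sat-neg⁻ : ∀ {w} X → Sat w (B.- X) → ¬ Sat w X
      sat-neg⁺ : ∀ {w} X → ¬ Sat w X → Sat w (B.- X)
      sat-⊤    : ∀ {w} → Sat w B.⊤
      sat-⊥    : ∀ {w} → ¬ Sat w B.⊥
      sat-cyl  : ∀ {w w′} X i → (∀ j → j ≢ i → w j ≡ w′ j) → Sat w′ X → Sat w (B.cyl i X)
      sat-diag : ∀ w {i j} → i ∈ Γ₀ → j ∈ Γ₀ → (Sat w (B.diag i j) → w i ~ w j) × (w i ~ w j → Sat w (B.diag i j))
      sat-wit  : ∀ {s i X} → wit s i X ∈ L → i ∈ Γ₀ → Sat (env ∘ s) (B.cyl i (eval X)) →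
                 Sat ((env ∘ s) [ i ↦ env (wit s i X) ]) (eval X)
      sat-base : Sat (env ∘ base) a

-- Finite approximations closed under Skolem terms

module Growth {a e} {A : Set a} {E : Set e} (Γ₀ : List A) where

  -- Bounds the number of points once `t` has been processed, starting from `n`. Skolem terms are
  -- infinitary, but only their arguments at coordinates in `Γ₀` are processed, so the bound is
  -- finite and the same for all `r`.
  grow : Point A E → ℕ → ℕ
  grow (base _)    n = n
  grow (wit s _ _) n = ℕ.suc (foldl (λ m j → grow (s j) m) n Γ₀)

  foldl-≥ : ∀ {x} {Y : Set x} (g : Y → ℕ → ℕ) → (∀ y n → n ℕ.≤ g y n) → ∀ L n → n ℕ.≤ foldl (λ m y → g y m) n L
  foldl-≥ g h []      n = ℕ.≤-refl
  foldl-≥ g h (y ∷ L) n = ℕ.≤-trans (h y n) (foldl-≥ g h L (g y n))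

  grow-≥ : ∀ t n → n ℕ.≤ grow t n
  grow-≥ (base _)    n = ℕ.≤-refl
  grow-≥ (wit s _ _) n = ℕ.≤-trans (foldl-≥ (λ j → grow (s j)) (λ j → grow-≥ (s j)) Γ₀ n) (ℕ.n≤1+n _)

module Bound {a e} {A : Set a} {E : Set e} where

  -- The left side of `Room` at the final number of points.
  bound : List A → List (Point A E) → ℕ
  bound Γ₀ L = let n = foldl (λ m t → Growth.grow Γ₀ t m) (length Γ₀) L in n * n + n

module Witnesses (cl : Classical) {ℓ : Level} (α : Ordinal ℓ) (os : Triple ∣ α ∣) (k r ψ : ℕ) (spare : Fin k)
                (E : Set ℓ) (Γ₀ : List ∣ α ∣) where

  open Logic cl
  open Triple os
  open Networks cl os k r ψ
  open NetworkAlgebra cl os k r ψ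
  open NeatReduct cl α os k r ψ
  open Structures cl α os k r ψ spare
  open Growth {E = E} Γ₀
  open Net

  ⊩-resp : ∀ X {g h} → net g ≗ⁿ net h → g ⊩ X → h ⊩ X
  ⊩-resp X g≗h x = trans (sym (proj₂ (proj₁ X) g≗h)) x

  ⊩-inj₂ : ∀ X {β} g h → Agree (inj₂ β) (net g) (net h) → g ⊩ X → h ⊩ X
  ⊩-inj₂ X {β} g h a x = trans (sym (proj₂ X (inj₂ β) (λ _ ()) h))
    (cyl⁺ {inj₂ β} (proj₁ X) {h} {g} (Agree-sym {inj₂ β} {net g} {net h} a) x)

  module View {Γ} (S : Structure Γ) where

    open Structure S

    -- The spare nodes are exchanged one at a time; an element of the neat reduct notices none of
    -- these changes. Hence they may be filled at will.
    view-inj₂ : ∀ X {f f′ : I → Q} (fix : Fixes f) (fix′ : Fixes f′) →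
                (∀ a → f (inj₁ a) ≡ f′ (inj₁ a)) → view f fix ⊩ X → view f′ fix′ ⊩ X
    view-inj₂ X {f} {f′} fix fix′ h = go (allFin k) f fix h (λ β β∉ → contradiction (∈-allFin β) β∉)
      where
      go : ∀ L (f : I → Q) (fix : Fixes f) → (∀ a → f (inj₁ a) ≡ f′ (inj₁ a)) →
           (∀ β → β ∉ L → f (inj₂ β) ≡ f′ (inj₂ β)) → view f fix ⊩ X → view f′ fix′ ⊩ X
      go [] f fix h h′ = ⊩-resp X {view f fix} {view f′ fix′} (pull-cong M λ
        { (inj₁ a) → trans (cong (lab M (f (inj₁ a))) (sym (h a))) (lab-refl M _)
        ; (inj₂ β) → trans (cong (lab M (f (inj₂ β))) (sym (h′ β λ ()))) (lab-refl M _) })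
      go (β ∷ L) f fix h h′ x = go L g fix-g
        (λ a → trans (↦-other f (inj₂ β) λ ()) (h a)) g-off
        (⊩-inj₂ X (view f fix) (view g fix-g) agree x)
        where
        g : I → Q
        g = f [ inj₂ β ↦ f′ (inj₂ β) ]

        fix-g : Fixes g
        fix-g j j∉ = trans (↦-other f (inj₂ β) λ ()) (fix j j∉)

        agree : Agree (inj₂ β) (pull f M) (pull g M)
        agree = (λ x y x≢ y≢ → sym (cong₂ (lab M) (↦-other f (inj₂ β) x≢) (↦-other f (inj₂ β) y≢))) ,
                (λ x x≢ → sym (cong (sort M) (↦-other f (inj₂ β) x≢)))

        g-off : ∀ β′ → β′ ∉ L → g (inj₂ β′) ≡ f′ (inj₂ β′)
        g-off β′ β′∉ = by em
          where
          by : Dec (β′ ≡ β) → g (inj₂ β′) ≡ f′ (inj₂ β′)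
          by (yes refl) = ↦-same f (inj₂ β)
          by (no β′≢β)  = trans (↦-other f (inj₂ β) (β′≢β ∘ inj₂-injective))
            (h′ β′ λ { (here p) → β′≢β p ; (there q) → β′∉ q })

  -- The models are built for the reduct along an injection `σ`, since the schemes require
  -- ultraproducts of such reducts.
  module Expansion (σ : ∣ α ∣ → ∣ α ∣) (σ-injective : ∀ {a b} → σ a ≡ σ b → a ≡ b) (eval : E → 𝔄.Carrier) where

    Γ : List A
    Γ = map σ Γ₀

    module Sequences (S : Structure Γ) where

      open Structure S
      open View S

      -- Only the coordinates in `Γ₀` are taken from the sequence. The named points elsewhere keep
      -- the resulting network `Weak`.
      place : (A → Q) → A → Q
      place w a with em {P = ∃ λ j → j ∈ Γ₀ × σ j ≡ a}
      ... | yes (j , _) = w j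
      ... | no _        = e a

      place-σ : ∀ w {j} → j ∈ Γ₀ → place w (σ j) ≡ w j
      place-σ w {j} j∈ with em {P = ∃ λ j′ → j′ ∈ Γ₀ × σ j′ ≡ σ j}
      ... | yes (j′ , _ , p) = cong w (σ-injective p)
      ... | no ¬p            = contradiction (j , j∈ , refl) ¬p

      place-fixes : ∀ w a → a ∉ Γ → place w a ≡ e a
      place-fixes w a a∉ with em {P = ∃ λ j → j ∈ Γ₀ × σ j ≡ a}
      ... | yes (j , j∈ , refl) = contradiction (∈-map⁺ σ j∈) a∉
      ... | no _                = refl

      place-ext : ∀ w {u : A → Q} → (∀ j → j ∈ Γ₀ → w j ≡ u (σ j)) → (∀ a → a ∉ Γ → e a ≡ u a) → ∀ a → place w a ≡ u a
      place-ext w {u} h h′ a = by em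
        where
        by : Dec (a ∈ Γ) → place w a ≡ u a
        by (no a∉) = trans (place-fixes w a a∉) (h′ a a∉)
        by (yes a∈) with ∈-map⁻ σ a∈
        ... | j , j∈ , refl = trans (place-σ w j∈) (h j j∈)

      filled : (A → Q) → Q → I → Q
      filled u q = [ u , const q ]′

      Sat : (A → Q) → 𝔄.Carrier → Set
      Sat w X = view (filled (place w) (place w o₀)) (place-fixes w) ⊩ X

      Sat-view : ∀ w X {f : I → Q} (fix : Fixes f) → (∀ a → f (inj₁ a) ≡ place w a) → view f fix ⊩ X → Sat w X
      Sat-view w X fix h = view-inj₂ X fix (place-fixes w) h

      view-Sat : ∀ w X {f : I → Q} (fix : Fixes f) → (∀ a → f (inj₁ a) ≡ place w a) → Sat w X → view f fix ⊩ X
      view-Sat w X fix h = view-inj₂ X (place-fixes w) fix (sym ∘ h)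

      Sat-cong-eq : ∀ {w w′} X → (∀ j → j ∈ Γ₀ → lab M (w j) (w′ j) ≡ eq) → Sat w X → Sat w′ X
      Sat-cong-eq {w} {w′} X h = ⊩-resp X
        {view (filled (place w) (place w o₀)) (place-fixes w)}
        {view (filled (place w′) (place w′ o₀)) (place-fixes w′)}
        (pull-cong M λ { (inj₁ a) → place-eq a em ; (inj₂ _) → place-eq o₀ em })
        where
        place-eq : ∀ a → Dec (a ∈ Γ) → lab M (place w a) (place w′ a) ≡ eq
        place-eq a (no a∉) = trans (cong₂ (lab M) (place-fixes w a a∉) (place-fixes w′ a a∉)) (lab-refl M (e a))
        place-eq a (yes a∈) with ∈-map⁻ σ a∈
        ... | j , j∈ , refl = trans (cong₂ (lab M) (place-σ w j∈) (place-σ w′ j∈)) (h j j∈)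

      Sat-cong : ∀ {w w′} X → (∀ j → j ∈ Γ₀ → w j ≡ w′ j) → Sat w X → Sat w′ X
      Sat-cong {w} X h = Sat-cong-eq X λ j j∈ → trans (cong (lab M (w j)) (sym (h j j∈))) (lab-refl M (w j))

      Sat-cyl : ∀ {w w′} X i → (∀ j → j ∈ Γ₀ → j ≢ i → w j ≡ w′ j) → Sat w′ X → Sat w (𝔄.cyl (σ i) X)
      Sat-cyl {w} {w′} X i h x = Sat-view w (𝔄.cyl (σ i) X) (place-fixes w) (λ _ → refl)
        (cyl⁺ {inj₁ (σ i)} (proj₁ X) {view f (place-fixes w)} {view f′ (place-fixes w′)} agree
          (view-Sat w′ X (place-fixes w′) (λ _ → refl) x))
        where
        -- The spare nodes are filled from a coordinate other than `σ i`, so that they do not change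
        -- together with it.
        j₀ : A
        j₀ = proj₁ (another (inj₁ (σ i)) (inj₁ (σ i)))

        f f′ : I → Q
        f  = filled (place w) (place w j₀)
        f′ = filled (place w′) (place w′ j₀)

        place≡ : ∀ a → a ≢ σ i → Dec (a ∈ Γ) → place w a ≡ place w′ a
        place≡ a a≢ (no a∉) = trans (place-fixes w a a∉) (sym (place-fixes w′ a a∉))
        place≡ a a≢ (yes a∈) with ∈-map⁻ σ a∈
        ... | j , j∈ , refl = trans (place-σ w j∈) (trans (h j j∈ λ { refl → a≢ refl }) (sym (place-σ w′ j∈)))

        f≡ : ∀ x → x ≢ inj₁ (σ i) → f x ≡ f′ x
        f≡ (inj₁ a) x≢ = place≡ a (x≢ ∘ cong inj₁) em
        f≡ (inj₂ _) _  = place≡ j₀ (proj₁ (proj₂ (another (inj₁ (σ i)) (inj₁ (σ i)))) ∘ cong inj₁) em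

        agree : Agree (inj₁ (σ i)) (pull f M) (pull f′ M)
        agree = (λ x y x≢ y≢ → cong₂ (lab M) (f≡ x x≢) (f≡ y y≢)) , (λ x x≢ → cong (sort M) (f≡ x x≢))

      Sat-diag : ∀ w {i j} → i ∈ Γ₀ → j ∈ Γ₀ →
                 (Sat w (𝔄.diag (σ i) (σ j)) → lab M (w i) (w j) ≡ eq) ×
                 (lab M (w i) (w j) ≡ eq → Sat w (𝔄.diag (σ i) (σ j)))
      Sat-diag w i∈ j∈ = (λ x → trans (sym lab≡) (⌈⌉⁻ x)) , (λ l → ⌈⌉⁺ (trans lab≡ l))
        where
        lab≡ = cong₂ (lab M) (place-σ w i∈) (place-σ w j∈)

    module _ {S S′ : Structure Γ} (S⊑S′ : S ⊑ S′) where

      open _⊑_ S⊑S′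
      open Sequences

      place-ι : ∀ w a → place S′ (ι ∘ w) a ≡ ι (place S w a)
      place-ι w = place-ext S′ (ι ∘ w) (λ j j∈ → cong ι (sym (place-σ S w j∈)))
        (λ a a∉ → trans (ι-e a) (cong ι (sym (place-fixes S w a a∉))))

      filled-ι : ∀ w x → filled S′ (place S′ (ι ∘ w)) (place S′ (ι ∘ w) o₀) x
                       ≡ ι (filled S (place S w) (place S w o₀) x)
      filled-ι w (inj₁ a) = place-ι w a
      filled-ι w (inj₂ _) = place-ι w o₀

      sat-≗ : ∀ w → pull (filled S (place S w) (place S w o₀)) (Structure.M S)
                 ≗ⁿ pull (filled S′ (place S′ (ι ∘ w)) (place S′ (ι ∘ w) o₀)) (Structure.M S′)
      sat-≗ w = (λ x y → sym (trans (cong₂ (lab (Structure.M S′)) (filled-ι w x) (filled-ι w y)) (ι-lab _ _))) ,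
                (λ x → sym (trans (cong (sort (Structure.M S′)) (filled-ι w x)) (ι-sort _)))

      -- Truth at a sequence depends only on the network seen there, which an embedding leaves as it
      -- is; so witnesses found earlier remain witnesses.
      Sat-⊑ : ∀ w X → Sat S w X → Sat S′ (ι ∘ w) X
      Sat-⊑ w X = trans (sym (proj₂ (proj₁ X) (sat-≗ w)))

      Sat-⊒ : ∀ w X → Sat S′ (ι ∘ w) X → Sat S w X
      Sat-⊒ w X = trans (proj₂ (proj₁ X) (sat-≗ w))

    open Sequences

    record Step (S : Structure Γ) (w : A → Structure.Q S) (i : A) (X : 𝔄.Carrier) : Set (suc ℓ) where
      field
        S′   : Structure Γ
        S⊑S′ : S ⊑ S′
        z    : Structure.Q S′
        sat  : Sat S′ ((_⊑_.ι S⊑S′ ∘ w) [ i ↦ z ]) X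
        size : length (Structure.pts S′) ℕ.≤ ℕ.suc (length (Structure.pts S))

    step : ∀ S w {i} X → i ∈ Γ₀ → Room (length (Structure.pts S)) → Sat S w (𝔄.cyl (σ i) X) → Step S w i X
    step S w {i} X i∈ room x = record
      { S′ = S′ ; S⊑S′ = S⊑S′ ; z = z ; size = size
      ; sat = Sat-view S′ w′ X fix′ f′≡ (⊩-resp X {b} {view S′ f′ fix′} net≗ Xb)
      }
      where
      open Structure using (view)
      M = Structure.M S

      j₀ : A
      j₀ = proj₁ (another (inj₁ (σ i)) (inj₁ (σ i)))

      f : I → Structure.Q S
      f = filled S (place S w) (place S w j₀)

      seen : ∃ λ h → Agree (inj₁ (σ i)) (pull f M) (net h) × h ∈ᵉ proj₁ X
      seen = cyl⁻ {inj₁ (σ i)} (proj₁ X) {view S f (place-fixes S w)}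
        (view-Sat S w (𝔄.cyl (σ i) X) (place-fixes S w) (λ _ → refl) x)

      b : World
      b = proj₁ seen

      Xb : b ⊩ X
      Xb = proj₂ (proj₂ seen)

      open OnePoint S
      open Realises (realise f (place-fixes S w) (σ i) (∈-map⁺ σ i∈) b (proj₁ (proj₂ seen))
        (λ β → j₀ , (λ j₀≡ → proj₁ (proj₂ (another (inj₁ (σ i)) (inj₁ (σ i)))) (cong inj₁ j₀≡)) , refl) room)
      open _⊑_ S⊑S′ using (ι; ι-e)

      f′ : I → Structure.Q S′
      f′ = (ι ∘ f) [ inj₁ (σ i) ↦ z ]

      w′ : A → Structure.Q S′
      w′ = (ι ∘ w) [ i ↦ z ]

      fix′ : Structure.Fixes S′ f′
      fix′ a a∉ = trans (↦-other (ι ∘ f) (inj₁ (σ i)) (λ { refl → a∉ (∈-map⁺ σ i∈) }))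
        (trans (cong ι (place-fixes S w a a∉)) (sym (ι-e a)))

      f′≡ : ∀ a → f′ (inj₁ a) ≡ place S′ w′ a
      f′≡ a = sym (place-ext S′ w′ {f′ ∘ inj₁} (λ j j∈ → by j j∈ em) (λ a a∉ → sym (fix′ a a∉)) a)
        where
        by : ∀ j → j ∈ Γ₀ → Dec (j ≡ i) → w′ j ≡ f′ (inj₁ (σ j))
        by j j∈ (yes refl) = trans (↦-same (ι ∘ w) i) (sym (↦-same (ι ∘ f) (inj₁ (σ i))))
        by j j∈ (no j≢i)   = trans (↦-other (ι ∘ w) i j≢i) (trans (cong ι (sym (place-σ S w j∈)))
          (sym (↦-other (ι ∘ f) (inj₁ (σ i)) (j≢i ∘ σ-injective ∘ inj₁-injective))))

    Pt : Set ℓ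
    Pt = Point A E

    IsReady : List Pt → Pt → Set ℓ
    IsReady done t = (∃ λ a → t ≡ base a) ⊎ t ∈ done

    -- `env` is meaningful on ready terms only; elsewhere its values are provisional and may change
    -- when the structure grows.
    record State : Set (suc ℓ) where
      field
        str      : Structure Γ
        env      : Pt → Structure.Q str
        done     : List Pt
        env-base : ∀ a → env (base a) ≡ Structure.e str (σ a)
        closed   : ∀ {s i X} → wit s i X ∈ done → ∀ {j} → j ∈ Γ₀ → IsReady done (s j)
        sat      : ∀ {s i X} → wit s i X ∈ done → i ∈ Γ₀ → Sat str (env ∘ s) (𝔄.cyl (σ i) (eval X)) →
                   Sat str ((env ∘ s) [ i ↦ env (wit s i X) ]) (eval X)

      Ready : Pt → Set ℓ
      Ready = IsReady done

      size : ℕ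
      size = length (Structure.pts str)

    open State

    record _≤ˢ_ (T T′ : State) : Set (suc ℓ) where
      field
        struct-ext : str T ⊑ str T′
        env-ext  : ∀ {t} → Ready T t → env T′ t ≡ _⊑_.ι struct-ext (env T t)
        done-ext : ∀ {t} → t ∈ done T → t ∈ done T′

    open _≤ˢ_

    ready-mono : ∀ {T T′ t} → T ≤ˢ T′ → Ready T t → Ready T′ t
    ready-mono le (inj₁ b) = inj₁ b
    ready-mono le (inj₂ d) = inj₂ (done-ext le d)

    ≤ˢ-refl : ∀ {T} → T ≤ˢ T
    ≤ˢ-refl = record { struct-ext = ⊑-refl ; env-ext = λ _ → refl ; done-ext = id }

    ≤ˢ-trans : ∀ {T T′ T″} → T ≤ˢ T′ → T′ ≤ˢ T″ → T ≤ˢ T″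
    ≤ˢ-trans p q = record
      { struct-ext = ⊑-trans (struct-ext p) (struct-ext q)
      ; env-ext  = λ rd → trans (env-ext q (ready-mono p rd)) (cong (_⊑_.ι (struct-ext q)) (env-ext p rd))
      ; done-ext = done-ext q ∘ done-ext p
      }

    module Add (T : State) (s : A → Pt) (i : A) (X : E) (t∉ : wit s i X ∉ done T)
               (children : ∀ {j} → j ∈ Γ₀ → Ready T (s j))
               (S′ : Structure Γ) (S⊑S′ : str T ⊑ S′) (z : Structure.Q S′)
               (sat-t : i ∈ Γ₀ → Sat (str T) (env T ∘ s) (𝔄.cyl (σ i) (eval X)) →
                        Sat S′ ((_⊑_.ι S⊑S′ ∘ (env T ∘ s)) [ i ↦ z ]) (eval X)) where

      open _⊑_ S⊑S′

      t : Pt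
      t = wit s i X

      env′ : Pt → Structure.Q S′
      env′ = (ι ∘ env T) [ t ↦ z ]

      env′-t : env′ t ≡ z
      env′-t = ↦-same (ι ∘ env T) t

      env′-ready : ∀ {t′} → Ready T t′ → env′ t′ ≡ ι (env T t′)
      env′-ready {t′} rd = ↦-other (ι ∘ env T) t λ { refl → not-ready rd }
        where
        not-ready : ¬ Ready T t
        not-ready (inj₁ (_ , ()))
        not-ready (inj₂ t∈) = t∉ t∈

      weaken : ∀ {t′} → Ready T t′ → IsReady (t ∷ done T) t′
      weaken (inj₁ b) = inj₁ b
      weaken (inj₂ d) = inj₂ (there d)

      sat′ : ∀ {s′ i′ X′} → wit s′ i′ X′ ∈ t ∷ done T → i′ ∈ Γ₀ → Sat S′ (env′ ∘ s′) (𝔄.cyl (σ i′) (eval X′)) →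
             Sat S′ ((env′ ∘ s′) [ i′ ↦ env′ (wit s′ i′ X′) ]) (eval X′)
      sat′ (here refl) i∈ x = Sat-cong S′ (eval X) (λ j j∈ → by j j∈ em)
        (sat-t i∈ (Sat-⊒ S⊑S′ (env T ∘ s) (𝔄.cyl (σ i) (eval X))
          (Sat-cong S′ (𝔄.cyl (σ i) (eval X)) (λ j j∈ → env′-ready (children j∈)) x)))
        where
        by : ∀ j → j ∈ Γ₀ → Dec (j ≡ i) → ((ι ∘ (env T ∘ s)) [ i ↦ z ]) j ≡ ((env′ ∘ s) [ i ↦ env′ t ]) j
        by j j∈ (yes refl) = trans (↦-same (ι ∘ (env T ∘ s)) i) (trans (sym env′-t) (sym (↦-same (env′ ∘ s) i)))
        by j j∈ (no j≢i)   = trans (↦-other (ι ∘ (env T ∘ s)) i j≢i)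
          (trans (sym (env′-ready (children j∈))) (sym (↦-other (env′ ∘ s) i j≢i)))
      sat′ {s′} {i′} {X′} (there d) i∈ x = Sat-cong S′ (eval X′) (λ j j∈ → by j j∈ em)
        (Sat-⊑ S⊑S′ u (eval X′) (sat T d i∈ (Sat-⊒ S⊑S′ (env T ∘ s′) (𝔄.cyl (σ i′) (eval X′))
          (Sat-cong S′ (𝔄.cyl (σ i′) (eval X′)) (λ j j∈ → env′-ready (closed T d j∈)) x))))
        where
        u : A → Structure.Q (str T)
        u = (env T ∘ s′) [ i′ ↦ env T (wit s′ i′ X′) ]

        by : ∀ j → j ∈ Γ₀ → Dec (j ≡ i′) → ι (u j) ≡ ((env′ ∘ s′) [ i′ ↦ env′ (wit s′ i′ X′) ]) j
        by j j∈ (yes refl) = trans (cong ι (↦-same (env T ∘ s′) i′))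
          (trans (sym (env′-ready (inj₂ d))) (sym (↦-same (env′ ∘ s′) i′)))
        by j j∈ (no j≢i)   = trans (cong ι (↦-other (env T ∘ s′) i′ j≢i))
          (trans (sym (env′-ready (closed T d j∈))) (sym (↦-other (env′ ∘ s′) i′ j≢i)))

      added : State
      added = record
        { str = S′ ; env = env′ ; done = t ∷ done T
        ; env-base = λ a → trans (env′-ready (inj₁ (a , refl))) (trans (cong ι (env-base T a)) (sym (ι-e (σ a))))
        ; closed = λ { (here refl) j∈ → weaken (children j∈) ; (there d) j∈ → weaken (closed T d j∈) }
        ; sat = sat′
        }

      added-≤ : T ≤ˢ added
      added-≤ = record { struct-ext = S⊑S′ ; env-ext = env′-ready ; done-ext = there }

    Processed : State → ℕ → (Pt → Set ℓ) → Set (suc ℓ)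
    Processed T n P = ∃ λ T′ → T ≤ˢ T′ × size T′ ℕ.≤ n × (∀ {t} → P t → Ready T′ t)

    processes : ∀ {x} {Y : Set x} (f : Y → Pt) →
                (∀ y n T → size T ℕ.≤ n → Room (grow (f y) n) → Processed T (grow (f y) n) (_≡ f y)) →
                ∀ L n T → size T ℕ.≤ n → Room (foldl (λ m y → grow (f y) m) n L) →
                ∃ λ T′ → T ≤ˢ T′ × size T′ ℕ.≤ foldl (λ m y → grow (f y) m) n L × (∀ {y} → y ∈ L → Ready T′ (f y))
    processes f h []      n T T≤n room = T , ≤ˢ-refl , T≤n , λ ()
    processes f h (y ∷ L) n T T≤n room
      with h y n T T≤n (Room-mono (foldl-≥ (grow ∘ f) (grow-≥ ∘ f) L (grow (f y) n)) room)
    ... | T₁ , T≤T₁ , s₁ , r₁ with processes f h L (grow (f y) n) T₁ s₁ room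
    ...   | T₂ , T₁≤T₂ , s₂ , r₂ = T₂ , ≤ˢ-trans T≤T₁ T₁≤T₂ , s₂ ,
      λ { (here refl) → ready-mono T₁≤T₂ (r₁ refl) ; (there y∈) → r₂ y∈ }

    process : ∀ t n T → size T ℕ.≤ n → Room (grow t n) → Processed T (grow t n) (_≡ t)
    process (base a)    n T T≤n room = T , ≤ˢ-refl , T≤n , λ { refl → inj₁ (a , refl) }
    process (wit s i X) n T T≤n room
      with processes s (λ j → process (s j)) Γ₀ n T T≤n (Room-mono (ℕ.n≤1+n _) room)
    ... | T₁ , T≤T₁ , s₁ , r₁ = by em
      where
      by : Dec (wit s i X ∈ done T₁) → Processed T (grow (wit s i X) n) (_≡ wit s i X)
      by (yes d) = T₁ , T≤T₁ , ℕ.≤-trans s₁ (ℕ.n≤1+n _) , λ { refl → inj₂ d }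
      by (no t∉) = by₂ em
        where
        by₂ : Dec (i ∈ Γ₀ × Sat (str T₁) (env T₁ ∘ s) (𝔄.cyl (σ i) (eval X))) →
              Processed T (grow (wit s i X) n) (_≡ wit s i X)
        -- No witness is called for, so the term is done with its provisional value and its
        -- condition holds vacuously.
        by₂ (no ¬x) = added , ≤ˢ-trans T≤T₁ added-≤ , ℕ.≤-trans s₁ (ℕ.n≤1+n _) , λ { refl → inj₂ (here refl) }
          where open Add T₁ s i X t∉ r₁ (str T₁) ⊑-refl (env T₁ (wit s i X)) (λ i∈ x → contradiction (i∈ , x) ¬x)
        by₂ (yes (i∈ , x)) = added , ≤ˢ-trans T≤T₁ added-≤ , ℕ.≤-trans st.size (s≤s s₁) , λ { refl → inj₂ (here refl) }
          where
          module st = Step (step (str T₁) (env T₁ ∘ s) (eval X) i∈ (Room-mono (ℕ.≤-trans s₁ (ℕ.n≤1+n _)) room) x)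
          open Add T₁ s i X t∉ r₁ st.S′ st.S⊑S′ st.z (λ _ _ → st.sat)

    processAll : ∀ L n T → size T ℕ.≤ n → Room (foldl (λ m t → grow t m) n L) →
                 ∃ λ T′ → T ≤ˢ T′ × (∀ {t} → t ∈ L → Ready T′ t)
    processAll L n T T≤n room with processes id process L n T T≤n room
    ... | T′ , T≤T′ , _ , rd = T′ , T≤T′ , rd

    initial : World → State
    initial (g , w) = record
      { str = record
        { Q = A ; M = pull inj₁ g ; e = id
        ; weak = proj₁ w , λ j j∉ → proj₁ (proj₂ w j j∉) , λ x → proj₂ (proj₂ w j j∉) (inj₁ x)
        ; pts = Γ
        ; cover = λ x → case em {P = x ∈ Γ} of λ { (yes x∈) → inj₁ x∈ ; (no x∉) → inj₂ (x , x∉ , refl) }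
        }
      ; env = λ { (base a) → σ a ; (wit _ _ _) → o₀ }
      ; done = []
      ; env-base = λ _ → refl
      ; closed = λ ()
      ; sat = λ ()
      }

    initial-Sat : ∀ b X → b ⊩ X → Sat (str (initial b)) (env (initial b) ∘ base) X
    initial-Sat b@(g , w) X x = go
      where
      open Structure (str (initial b))
      -- b itself as a structure, to drop its nodes outside α
      whole : Structure Γ
      whole = record
        { Q = I ; M = g ; e = inj₁ ; weak = w ; pts = Γ′
        ; cover = λ { (inj₁ a) → case em {P = a ∈ Γ} of λ
                        { (yes a∈) → inj₁ (∈-++⁺ˡ (∈-map⁺ inj₁ a∈)) ; (no a∉) → inj₂ (a , a∉ , refl) }
                    ; (inj₂ β) → inj₁ (∈-++⁺ʳ (map inj₁ Γ) (∈-map⁺ inj₂ (∈-allFin β))) }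
        }
        where
        Γ′ = map inj₁ Γ ++ map inj₂ (allFin k)

      f : I → A
      f = filled (str (initial b)) (place (str (initial b)) (env (initial b) ∘ base))
                 (place (str (initial b)) (env (initial b) ∘ base) o₀)

      f-id : ∀ a → _≡_ {A = I} (inj₁ (f (inj₁ a))) (inj₁ a)
      f-id a = cong inj₁ (place-ext (str (initial b)) (env (initial b) ∘ base) {id} (λ _ _ → refl) (λ _ _ → refl) a)

      go : Sat (str (initial b)) (env (initial b) ∘ base) X
      go = ⊩-resp X {Structure.view whole (inj₁ ∘ f) (λ a _ → f-id a)}
        {view f (place-fixes (str (initial b)) (env (initial b) ∘ base))} ((λ _ _ → refl) , λ _ → refl)
        (View.view-inj₂ whole X (λ _ _ → refl) (λ a _ → f-id a) (sym ∘ f-id)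
          (⊩-resp X {b} {Structure.view whole id (λ _ _ → refl)} ((λ _ _ → refl) , λ _ → refl) x))

    open Approximation cl using (ApproximateModel)

    approximate-model : ∀ L a → Bound.bound Γ₀ L ℕ.≤ r → ¬ a 𝔄.≈ 𝔄.⊥ →
                        ApproximateModel (reduct σ 𝔄) eval Γ₀ L a
    approximate-model L a room a≉⊥ = record
      { Q = Q
      ; _~_ = λ x y → lab M x y ≡ eq
      ; ~-refl = lab-refl M _
      ; ~-sym = λ {x} {y} p → trans (lab-sym M y x) p
      ; ~-trans = lab-trans M
      ; env = env T
      ; Sat = Sat (str T)
      ; sat-≈ = λ X≈Y x → trans (sym (X≈Y _)) x
      ; sat-~ = λ X p → Sat-cong-eq (str T) X (λ j _ → p j)
      ; sat-∨⁻ = λ _ _ → ∨⁻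
      ; sat-∨⁺ = λ _ _ → ∨⁺
      ; sat-∧⁻ = λ _ _ → ∧⁻
      ; sat-∧⁺ = λ _ _ (x , y) → ∧⁺ x y
      ; sat-neg⁻ = λ _ → not⁻
      ; sat-neg⁺ = λ _ → not⁺
      ; sat-⊤ = refl
      ; sat-⊥ = λ ()
      ; sat-cyl = λ X i p → Sat-cyl (str T) X i (λ j _ → p j)
      ; sat-diag = Sat-diag (str T)
      ; sat-wit = λ t∈ i∈ → by-ready (proj₂ (proj₂ run) t∈) i∈
      ; sat-base = Sat-cong (str T) a (λ j _ → sym (env-ext T₀≤T (inj₁ (j , refl))))
          (Sat-⊑ (struct-ext T₀≤T) (env (initial (proj₁ b)) ∘ base) a (initial-Sat (proj₁ b) a (proj₂ b)))
      }
      where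
      b : ∃ λ g → g ⊩ a
      b = dne λ none → a≉⊥ λ g → Bool-ext (λ x → contradiction (g , x) none) λ ()

      run = processAll L (length Γ₀) (initial (proj₁ b)) (ℕ.≤-reflexive (length-map σ Γ₀)) room

      T : State
      T = proj₁ run

      T₀≤T : initial (proj₁ b) ≤ˢ T
      T₀≤T = proj₁ (proj₂ run)

      open Structure (str T) using (Q; M)

      by-ready : ∀ {s i X} → IsReady (done T) (wit s i X) → i ∈ Γ₀ →
                 Sat (str T) (env T ∘ s) (𝔄.cyl (σ i) (eval X)) →
                 Sat (str T) ((env T ∘ s) [ i ↦ env T (wit s i X) ]) (eval X)
      by-ready (inj₁ (_ , ()))
      by-ready (inj₂ d) = sat T d

-- The representation as an ultraproduct of approximations

module UltrafilterProperties {ℓ j} {J : Set j} {G : Pred (Pred J ℓ) ℓ} (uf : IsUltrafilter G) where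

  open IsUltrafilter uf

  union : ∀ {X Y : Pred J ℓ} → G (λ y → X y ⊎ Y y) → G X ⊎ G Y
  union {X} {Y} h with ultra X | ultra Y
  ... | inj₁ GX | _       = inj₁ GX
  ... | inj₂ _  | inj₁ GY = inj₂ GY
  ... | inj₂ ¬X | inj₂ ¬Y = contradiction
    (upward (λ { (inj₁ x , ¬x , _) → contradiction x ¬x ; (inj₂ y , _ , ¬y) → contradiction y ¬y })
      (meet h (meet ¬X ¬Y))) proper

  complement : ∀ {X : Pred J ℓ} → ¬ G X → G (λ y → ¬ X y)
  complement {X} ¬GX with ultra X
  ... | inj₁ GX  = contradiction GX ¬GX
  ... | inj₂ G¬X = G¬X

  disjoint : ∀ {X : Pred J ℓ} → G (λ y → ¬ X y) → ¬ G X
  disjoint G¬X GX = proper (upward (λ (¬x , x) → contradiction x ¬x) (meet G¬X GX))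

  inhabited : (cl : Classical) → ∀ {X : Pred J ℓ} → G X → ∃ X
  inhabited cl GX = Logic.dne cl λ none → proper (upward (λ {y} x → contradiction (y , x) none) GX)

module Representation (cl : Classical) {ℓ : Level} {A : Set ℓ} (𝔅 : ℕ → RawCylindricAlgebra A ℓ ℓ)
                      (F : Pred (Pred ℕ ℓ) ℓ) (uf : IsUltrafilter F)
                      (cofinite : ∀ B → F (λ r → Lift ℓ (B ℕ.≤ r))) where

  open Classical cl using (choice)
  open Logic cl
  open Subset using (_⊆_)
  open Approximation cl

  𝔘 : RawCylindricAlgebra A ℓ ℓ
  𝔘 = ultraproduct 𝔅 F

  module 𝔘 = RawCylindricAlgebra 𝔘
  private module 𝔅 r = RawCylindricAlgebra (𝔅 r)

  E : Set ℓ
  E = 𝔘.Carrier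

  eval : ∀ r → E → 𝔅.Carrier r
  eval r X = X r

  Pt : Set ℓ
  Pt = Point A E

  module F where
    open IsUltrafilter uf public
    open UltrafilterProperties uf public

  module Separation (bound : List A → List Pt → ℕ)
    (model : ∀ r Γ₀ L a → bound Γ₀ L ℕ.≤ r → ¬ 𝔅._≈_ r a (𝔅.⊥ r) → ApproximateModel (𝔅 r) (eval r) Γ₀ L a)
    (a : E) (a≉⊥ : ¬ a 𝔘.≈ 𝔘.⊥) where

    Admissible : ℕ → List A → List Pt → Set ℓ
    Admissible r Γ₀ L = Lift ℓ (bound Γ₀ L ℕ.≤ r) × ¬ 𝔅._≈_ r (a r) (𝔅.⊥ r)

    Index : Set ℓ
    Index = ∃ λ r → ∃ λ Γ₀ → ∃ λ L → Admissible r Γ₀ L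

    level : Index → ℕ
    level = proj₁

    coordinates : Index → List A
    coordinates (_ , Γ₀ , _) = Γ₀

    terms : Index → List Pt
    terms (_ , _ , L , _) = L

    -- The finite sets are quantified before `r`, because the `r` that are admissible depend on
    -- their size.
    Eventually : Pred (Pred Index ℓ) ℓ
    Eventually S = ∃ λ Γ₁ → ∃ λ L₁ → ∀ Γ₀ L → Γ₁ ⊆ Γ₀ → L₁ ⊆ L → F (λ r → ∀ ok → S (r , Γ₀ , L , ok))

    private

      extension = Ultrafilters.extend cl Index Eventually
        (λ S⊆T (Γ₁ , L₁ , h) → Γ₁ , L₁ , λ Γ₀ L p q → F.upward (λ s ok → S⊆T (s ok)) (h Γ₀ L p q))
        (λ (Γ₁ , L₁ , h) (Γ₂ , L₂ , h′) → Γ₁ ++ Γ₂ , L₁ ++ L₂ , λ Γ₀ L p q → F.upward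
          (λ (s , s′) ok → s ok , s′ ok) (F.meet
          (h Γ₀ L (p ∘ ∈-++⁺ˡ) (q ∘ ∈-++⁺ˡ)) (h′ Γ₀ L (p ∘ ∈-++⁺ʳ Γ₁) (q ∘ ∈-++⁺ʳ L₁))))
        ([] , [] , λ _ _ _ _ → F.upward (λ _ _ → _) F.whole)
        -- An admissible index exists, as `F` contains the final segment from the bound on as well
        -- as the set of `r` at which `a` is non-zero.
        (λ (Γ₁ , L₁ , h) → let r , s , ok = F.inhabited cl (F.meet (h Γ₁ L₁ id id)
                                 (F.meet (cofinite (bound Γ₁ L₁)) (F.complement a≉⊥))) in
          (r , Γ₁ , L₁ , ok) , s ok)

    G : Pred (Pred Index ℓ) ℓ
    G = proj₁ extension

    G-ultrafilter : IsUltrafilter G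
    G-ultrafilter = proj₁ (proj₂ extension)

    eventually : ∀ {S} → Eventually S → G S
    eventually = proj₂ (proj₂ extension)

    module G where
      open IsUltrafilter G-ultrafilter public
      open UltrafilterProperties G-ultrafilter public

    always : ∀ {S : Pred Index ℓ} → (∀ ι → S ι) → G S
    always h = G.upward (λ {ι} _ → h ι) G.whole

    mostly-∈Γ : ∀ i → G (λ ι → i ∈ coordinates ι)
    mostly-∈Γ i = eventually (i ∷ [] , [] , λ Γ₀ L p _ → F.upward (λ _ _ → p (here refl)) F.whole)

    mostly-∈L : ∀ t → G (λ ι → t ∈ terms ι)
    mostly-∈L t = eventually ([] , t ∷ [] , λ Γ₀ L _ q → F.upward (λ _ _ → q (here refl)) F.whole)

    from-F : ∀ {S : Pred ℕ ℓ} → F S → G (S ∘ level)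
    from-F FS = eventually ([] , [] , λ _ _ _ _ → F.upward (λ s _ → s) FS)

    module St (ι : Index) where
      modelᵢ : ApproximateModel (𝔅 (level ι)) (eval (level ι)) (coordinates ι) (terms ι) (a (level ι))
      modelᵢ = let r , Γ₀ , L , lift room , a≉ = ι in model r Γ₀ L (a r) room a≉
      open ApproximateModel modelᵢ public

    Equal : Pt → Pt → Index → Set ℓ
    Equal u v ι = St._~_ ι (St.env ι u) (St.env ι v)

    points : Setoid ℓ ℓ
    points = record
      { Carrier = Pt
      ; _≈_     = λ u v → G (Equal u v)
      ; isEquivalence = record
        { refl  = always λ ι → St.~-refl ι
        ; sym   = G.upward λ {ι} → St.~-sym ι
        ; trans = λ p q → G.upward (λ {ι} (e , e′) → St.~-trans ι e e′) (G.meet p q)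
        }
      }

    module V = Setoid points

    private

      -- A section turns equivalent points into identical ones. This makes `h` invariant although
      -- `G` is closed under finite intersections only.
      representatives = choice (≡.setoid Pt) points (record
        { to = id ; cong = λ { refl → V.refl } ; surjective = λ y → y , λ { refl → V.refl } })

      ρ₀ : Pt → Pt
      ρ₀ = Func.to (proj₁ representatives)

    -- Representatives depend on the coordinate, in order that base represents
    -- itself: infinitely many coordinates cannot be changed simultaneously.
    ρ : A → Pt → Pt
    ρ j u = pick em
      module ρ where
      pick : Dec (u V.≈ base j) → Pt
      pick (yes _) = base j
      pick (no _)  = ρ₀ u

    ρ-≈ : ∀ j u → ρ j u V.≈ u
    ρ-≈ j u = by em
      where
      by : ∀ d → ρ.pick j u d V.≈ u
      by (yes p) = V.sym p
      by (no _)  = proj₂ representatives u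

    ρ-cong : ∀ j {u v} → u V.≈ v → ρ j u ≡ ρ j v
    ρ-cong j {u} {v} u≈v = by em em
      where
      by : ∀ d d′ → ρ.pick j u d ≡ ρ.pick j v d′
      by (yes _) (yes _) = refl
      by (no _)  (no _)  = Func.cong (proj₁ representatives) u≈v
      by (yes p) (no ¬p) = contradiction (V.trans (V.sym u≈v) p) ¬p
      by (no ¬p) (yes p) = contradiction (V.trans u≈v p) ¬p

    ρ-base : ∀ j → ρ j (base j) ≡ base j
    ρ-base j = by em
      where
      by : ∀ d → ρ.pick j (base j) d ≡ base j
      by (yes _) = refl
      by (no ¬p) = contradiction V.refl ¬p

    seq : (A → Pt) → ∀ ι → A → St.Q ι
    seq s ι j = St.env ι (ρ j (s j))

    Holds : E → (A → Pt) → Index → Set ℓ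
    Holds X s ι = Lift ℓ (St.Sat ι (seq s ι) (X (level ι)))

    h : E → Pred (A → Pt) ℓ
    h X s = G (Holds X s)

    h-invariant : ∀ X {s t} → (∀ i → s i V.≈ t i) → h X s → h X t
    h-invariant X {s} {t} s≈t = G.upward λ {ι} (lift x) → lift (St.sat-~ ι (X (level ι))
      (λ j → subst (λ u → St._~_ ι (seq s ι j) (St.env ι u)) (ρ-cong j (s≈t j)) (St.~-refl ι)) x)

    h-cong : ∀ {X Y} → X 𝔘.≈ Y → ∀ {s} → h X s → h Y s
    h-cong X≈Y x = G.upward (λ {ι} (e , lift x) → lift (St.sat-≈ ι e x)) (G.meet (from-F X≈Y) x)

    h-∨ : ∀ X Y → h (X 𝔘.∨ Y) ≐ (λ s → h X s ⊎ h Y s)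
    h-∨ X Y = (λ x → G.union (G.upward (λ {ι} (lift x) → [ inj₁ ∘ lift , inj₂ ∘ lift ]′ (St.sat-∨⁻ ι _ _ x)) x)) ,
              [ G.upward (λ {ι} (lift x) → lift (St.sat-∨⁺ ι _ _ (inj₁ x)))
              , G.upward (λ {ι} (lift x) → lift (St.sat-∨⁺ ι _ _ (inj₂ x))) ]′

    h-∧ : ∀ X Y → h (X 𝔘.∧ Y) ≐ (λ s → h X s × h Y s)
    h-∧ X Y = (λ x → G.upward (λ {ι} (lift x) → lift (proj₁ (St.sat-∧⁻ ι _ _ x))) x ,
                     G.upward (λ {ι} (lift x) → lift (proj₂ (St.sat-∧⁻ ι _ _ x))) x) ,
              λ (x , y) → G.upward (λ {ι} (lift x , lift y) → lift (St.sat-∧⁺ ι _ _ (x , y))) (G.meet x y)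

    h-neg : ∀ X → h (𝔘.- X) ≐ (λ s → ¬ h X s)
    h-neg X = (λ x y → G.disjoint (G.upward (λ {ι} (lift x) (lift y) → St.sat-neg⁻ ι _ x y) x) y) ,
              λ x → G.upward (λ {ι} ¬x → lift (St.sat-neg⁺ ι _ (λ y → ¬x (lift y)))) (G.complement x)

    h-⊤ : ∀ s → h 𝔘.⊤ s
    h-⊤ s = always λ ι → lift (St.sat-⊤ ι)

    h-⊥ : ∀ s → ¬ h 𝔘.⊥ s
    h-⊥ s x = let ι , lift y = G.inhabited cl x in St.sat-⊥ ι y

    h-diag : ∀ i j → h (𝔘.diag i j) ≐ (λ s → s i V.≈ s j)
    h-diag i j =
      (λ {s} x → V.trans (V.sym (ρ-≈ i (s i))) (V.trans
        (G.upward (λ {ι} (lift d , i∈ , j∈) → proj₁ (St.sat-diag ι (seq s ι) i∈ j∈) d) (with-i,j x)) (ρ-≈ j (s j)))) ,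
      (λ {s} e → G.upward (λ {ι} (l , i∈ , j∈) → lift (proj₂ (St.sat-diag ι (seq s ι) i∈ j∈) l))
        (with-i,j (V.trans (ρ-≈ i (s i)) (V.trans e (V.sym (ρ-≈ j (s j)))))))
      where
      with-i,j : ∀ {S : Pred Index ℓ} → G S → G (λ ι → S ι × i ∈ coordinates ι × j ∈ coordinates ι)
      with-i,j GS = G.meet GS (G.meet (mostly-∈Γ i) (mostly-∈Γ j))

    -- The witness is a Skolem term over the representatives `s′`, since these are the points at
    -- which `h` evaluates `s`; it belongs to the list of terms of almost all approximations.
    h-cyl : ∀ i X → h (𝔘.cyl i X) ≐ (λ s → ∃ λ t → h X t × (∀ j → j ≢ i → t j V.≈ s j))
    h-cyl i X = (λ {s} x → t s , witness s x , λ j j≢i → V.reflexive (↦-other s i j≢i)) ,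
                λ {s} (t , x , t≈s) → G.upward (λ {ι} (lift x) →
                  lift (St.sat-cyl ι (X (level ι)) i (λ j j≢i → cong (St.env ι) (sym (ρ-cong j (t≈s j j≢i)))) x)) x
      where
      module _ (s : A → Pt) where
        s′ : A → Pt
        s′ j = ρ j (s j)

        u : Pt
        u = wit s′ i X

        t : A → Pt
        t = s [ i ↦ u ]

        at : ∀ ι → Holds (𝔘.cyl i X) s ι → i ∈ coordinates ι → u ∈ terms ι → Equal u (ρ i u) ι → Holds X t ι
        at ι (lift x) i∈ u∈ e = lift (St.sat-~ ι (X (level ι)) (λ j → by j em) (St.sat-wit ι u∈ i∈ x))
          where
          by : ∀ j → Dec (j ≡ i) → St._~_ ι (((St.env ι ∘ s′) [ i ↦ St.env ι u ]) j) (seq t ι j)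
          by j (yes refl) = subst₂ (St._~_ ι) (sym (↦-same _ i)) (cong (St.env ι ∘ ρ i) (sym (↦-same s i))) e
          by j (no j≢i)   = subst₂ (St._~_ ι) (sym (↦-other _ i j≢i)) (cong (St.env ι ∘ ρ j) (sym (↦-other s i j≢i)))
                              (St.~-refl ι)

        witness : h (𝔘.cyl i X) s → h X t
        witness x = G.upward (λ {ι} (x , i∈ , u∈ , e) → at ι x i∈ u∈ e)
          (G.meet x (G.meet (mostly-∈Γ i) (G.meet (mostly-∈L u) (V.sym (ρ-≈ i u)))))

    h-nonempty : h a base
    h-nonempty = always λ ι → lift (St.sat-~ ι (a (level ι))
      (λ j → subst (λ u → St._~_ ι (St.env ι (base j)) (St.env ι u)) (sym (ρ-base j)) (St.~-refl ι)) (St.sat-base ι))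

-- Set algebras

record IsCongruence {a c e} {I : Set a} (𝔐 : RawCylindricAlgebra I c e) : Set (a ⊔ c ⊔ e) where
  open RawCylindricAlgebra 𝔐
  field
    isEquivalence : IsEquivalence _≈_
    ∨-cong        : ∀ {x x′ y y′} → x ≈ x′ → y ≈ y′ → x ∨ y ≈ x′ ∨ y′
    ∧-cong        : ∀ {x x′ y y′} → x ≈ x′ → y ≈ y′ → x ∧ y ≈ x′ ∧ y′
    neg-cong      : ∀ {x x′} → x ≈ x′ → - x ≈ - x′
    cyl-cong      : ∀ i {x x′} → x ≈ x′ → cyl i x ≈ cyl i x′
  open IsEquivalence isEquivalence public renaming (refl to ≈-refl; sym to ≈-sym; trans to ≈-trans)

Embedding : ∀ {a c e c′ e′} {I : Set a} → RawCylindricAlgebra I c e → RawCylindricAlgebra I c′ e′ → Set _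
Embedding {a} 𝔄 𝔐 = NeatEmbedding id (λ _ → ⊥₀) 𝔄 𝔐

module Image {a c e c′ e′ p : Level} {I : Set a} {𝔄 : RawCylindricAlgebra I c e} {𝔐 : RawCylindricAlgebra I c′ e′}
             (cong𝔐 : IsCongruence 𝔐) (emb : Embedding 𝔄 𝔐) where

  private
    module A = RawCylindricAlgebra 𝔄
    module B = RawCylindricAlgebra 𝔐
  open IsCongruence cong𝔐
  open NeatEmbedding emb

  image : Subuniverse 𝔐 (c ⊔ e′ ⊔ p)
  image = record
    { Member      = λ y → Lift p (∃ λ x → to x B.≈ y)
    ; resp        = λ y≈z (lift (x , e)) → lift (x , ≈-trans e y≈z)
    ; ∨-closed    = λ (lift (x , e)) (lift (y , e′)) → lift (x A.∨ y , ≈-trans (∨-homo x y) (∨-cong e e′))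
    ; ∧-closed    = λ (lift (x , e)) (lift (y , e′)) → lift (x A.∧ y , ≈-trans (∧-homo x y) (∧-cong e e′))
    ; neg-closed  = λ (lift (x , e)) → lift (A.- x , ≈-trans (neg-homo x) (neg-cong e))
    ; ⊤-closed    = lift (A.⊤ , ⊤-homo)
    ; ⊥-closed    = lift (A.⊥ , ⊥-homo)
    ; cyl-closed  = λ i (lift (x , e)) → lift (A.cyl i x , ≈-trans (cyl-homo i x) (cyl-cong i e))
    ; diag-closed = λ i j → lift (A.diag i j , diag-homo i j)
    }

  ≅-image : 𝔄 ≅ subalgebra image
  ≅-image = record
    { to         = λ x → to x , lift (x , ≈-refl)
    ; to-cong    = to-cong
    ; injective  = injective
    ; surjective = λ (y , lift (x , e)) → x , λ z≈x → ≈-trans (to-cong z≈x) e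
    ; ∨-homo     = ∨-homo
    ; ∧-homo     = ∧-homo
    ; neg-homo   = neg-homo
    ; ⊤-homo     = ⊤-homo
    ; ⊥-homo     = ⊥-homo
    ; cyl-homo   = cyl-homo
    ; diag-homo  = diag-homo
    }

neat-congruence : ∀ {ℓ} {α β : Ordinal ℓ} (α≤β : α ≤ₒ β) {𝔅 : RawCylindricAlgebra ∣ β ∣ ℓ ℓ}
                  (isCA : IsCylindricAlgebra 𝔅) → IsCongruence (𝔑𝔯 {α = α} {β = β} α≤β {B = 𝔅} isCA)
neat-congruence {α = α} {β} α≤β {𝔅} isCA = record
  { isEquivalence = record { refl = ≈-refl ; sym = ≈-sym ; trans = ≈-trans }
  ; ∨-cong        = ∨-cong
  ; ∧-cong        = ∧-cong
  ; neg-cong      = ¬-cong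
  ; cyl-cong      = λ i → cyl-cong (_≤ₒ_.embed α≤β i)
  }
  where
  open CylindricProperties isCA using (≈-refl; ≈-sym; ≈-trans; ∨-cong; ∧-cong; cyl-cong)
  open IsBooleanAlgebra (IsCylindricAlgebra.isBooleanAlgebra isCA) using (¬-cong)

S-embedding : ∀ {ℓ} {α β : Ordinal ℓ} (α≤β : α ≤ₒ β) {𝔅 : RawCylindricAlgebra ∣ β ∣ ℓ ℓ}
              (isCA : IsCylindricAlgebra 𝔅) {𝔄 : RawCylindricAlgebra ∣ α ∣ ℓ ℓ} →
              NeatEmbedding (_≤ₒ_.embed α≤β) (_≤ₒ_.Outside α≤β) 𝔄 𝔅 → S (NrCA {α = α} {β = β} α≤β) 𝔄
S-embedding {ℓ} {α} {β} α≤β {𝔅} isCA {𝔄} e =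
  𝔑𝔯 {α = α} {β = β} α≤β {B = 𝔅} isCA , 𝔑𝔯∈NrCA {α = α} {β} α≤β {𝔅} isCA , image , ≅-image
  where
  module e = NeatEmbedding e

  emb : Embedding 𝔄 (𝔑𝔯 {α = α} {β = β} α≤β {B = 𝔅} isCA)
  emb = record
    { to = λ x → e.to x , e.to-fixed x ; to-fixed = λ _ _ ()
    ; to-cong = e.to-cong ; injective = e.injective ; ∨-homo = e.∨-homo ; ∧-homo = e.∧-homo
    ; neg-homo = e.neg-homo ; ⊤-homo = e.⊤-homo ; ⊥-homo = e.⊥-homo ; cyl-homo = e.cyl-homo ; diag-homo = e.diag-homo
    }
  open Image {p = ℓ} (neat-congruence {α = α} {β} α≤β {𝔅} isCA) emb

NrCA⊆S : ∀ {ℓ} {α β : Ordinal ℓ} (α≤β : α ≤ₒ β) {𝔄 : RawCylindricAlgebra ∣ α ∣ ℓ ℓ} →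
         IsEquivalence (RawCylindricAlgebra._≈_ 𝔄) → NrCA {α = α} {β = β} α≤β 𝔄 → S (NrCA {α = α} {β = β} α≤β) 𝔄
NrCA⊆S {ℓ} α≤β {𝔄} isEq 𝔄∈ = 𝔄 , 𝔄∈ , everything , record
  { to         = λ x → x , _
  ; to-cong    = id
  ; injective  = id
  ; surjective = λ y → proj₁ y , id
  ; ∨-homo     = λ _ _ → ≈-refl
  ; ∧-homo     = λ _ _ → ≈-refl
  ; neg-homo   = λ _ → ≈-refl
  ; ⊤-homo     = ≈-refl
  ; ⊥-homo     = ≈-refl
  ; cyl-homo   = λ _ _ → ≈-refl
  ; diag-homo  = λ _ _ → ≈-refl
  }
  where
  open IsEquivalence isEq renaming (refl to ≈-refl)
  everything : Subuniverse 𝔄 ℓ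
  everything = record
    { Member = Polymorphic.U ; resp = λ _ _ → _ ; ∨-closed = λ _ _ → _ ; ∧-closed = λ _ _ → _
    ; neg-closed = λ _ → _ ; ⊤-closed = _ ; ⊥-closed = _ ; cyl-closed = λ _ _ → _ ; diag-closed = λ _ _ → _ }

module FullSetAlgebras {ℓ} (I : Set ℓ) {J : Set ℓ} (V : J → Setoid ℓ ℓ) where

  full : J → CylindricSetAlgebra I
  full j = record
    { base     = V j
    ; universe = record
      { Member = Polymorphic.U ; resp = λ _ _ → _ ; ∨-closed = λ _ _ → _ ; ∧-closed = λ _ _ → _
      ; neg-closed = λ _ → _ ; ⊤-closed = _ ; ⊥-closed = _ ; cyl-closed = λ _ _ → _ ; diag-closed = λ _ _ → _ }
    }

  product : RawCylindricAlgebra I (suc ℓ) ℓ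
  product = ∏ (CylindricSetAlgebra.algebra ∘ full)

  congruence : IsCongruence product
  congruence = record
    { isEquivalence = record
      { refl  = λ _ → id , id
      ; sym   = λ p j → proj₂ (p j) , proj₁ (p j)
      ; trans = λ p q j → proj₁ (q j) ∘ proj₁ (p j) , proj₂ (p j) ∘ proj₂ (q j)
      }
    ; ∨-cong   = λ p q j → [ inj₁ ∘ proj₁ (p j) , inj₂ ∘ proj₁ (q j) ]′ , [ inj₁ ∘ proj₂ (p j) , inj₂ ∘ proj₂ (q j) ]′
    ; ∧-cong   = λ p q j → (λ (x , y) → proj₁ (p j) x , proj₁ (q j) y) , (λ (x , y) → proj₂ (p j) x , proj₂ (q j) y)
    ; neg-cong = λ p j → (λ ¬x x → ¬x (proj₂ (p j) x)) , (λ ¬x x → ¬x (proj₁ (p j) x))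
    ; cyl-cong = λ i p j → (λ (t , x , e) → t , proj₁ (p j) x , e) , (λ (t , x , e) → t , proj₂ (p j) x , e)
    }

-- Sequences in a disjoint union of bases, as a frame: its complex algebra is
-- the product of the full set algebras with Boolean-valued relations.
module SequenceFrame (cl : Classical) {ℓ} (I : Set ℓ) {J : Set ℓ} (V : J → Setoid ℓ ℓ) where

  open Logic cl
  open Update cl

  Seq : J → Set ℓ
  Seq j = I → Setoid.Carrier (V j)

  data SameBase (P : ∀ {j} → Seq j → Seq j → Set ℓ) : Σ J Seq → Σ J Seq → Set ℓ where
    rel : ∀ {j} {s t : Seq j} → P s t → SameBase P (j , s) (j , t)

  Off : I → ∀ {j} → Seq j → Seq j → Set ℓ
  Off i {j} s t = ∀ x → x ≢ i → Setoid._≈_ (V j) (s x) (t x)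

  frame : Frame I
  frame = record
    { World    = Σ J Seq
    ; _≈_      = SameBase λ {j} s t → ∀ x → Setoid._≈_ (V j) (s x) (t x)
    ; R        = λ i → SameBase (Off i)
    ; D        = λ i i′ (j , s) → Setoid._≈_ (V j) (s i) (s i′)
    ; ≈⇒R      = λ { (rel p) → rel (λ x _ → p x) }
    ; R-refl   = λ { {i} {j , s} → rel (λ x _ → Setoid.refl (V j)) }
    ; R-sym    = λ { (rel {j} p) → rel (λ x x≢ → Setoid.sym (V j) (p x x≢)) }
    ; R-trans  = λ { (rel {j} p) (rel q) → rel (λ x x≢ → Setoid.trans (V j) (p x x≢) (q x x≢)) }
    ; R-comm   = λ { {i} {i′} (rel {j} {s} {t} p) (rel {_} {_} {u} q) → (j , s [ i′ ↦ u i′ ]) ,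
        rel (λ x x≢ → Setoid.reflexive (V j) (sym (↦-other s i′ x≢))) ,
        rel (λ x x≢ → swap {i} {i′} {j} {s} {t} {u} p q x x≢ em) }
    ; D-resp   = λ { {i} {i′} (rel {j} p) e → Setoid.trans (V j) (Setoid.sym (V j) (p i)) (Setoid.trans (V j) e (p i′)) }
    ; D-sym≈   = λ { {i} {i′} (rel {j} p) e → Setoid.trans (V j) (p i) (Setoid.trans (V j) e (Setoid.sym (V j) (p i′))) }
    ; D-refl   = λ { {i} {j , s} → Setoid.refl (V j) }
    ; D-split  = λ { {i} {i′} {k} {j , s} k≢i k≢i′ e → (j , s [ k ↦ s i ]) ,
        rel (λ x x≢ → Setoid.reflexive (V j) (sym (↦-other s k x≢))) ,
        Setoid.reflexive (V j) (trans (↦-other s k (k≢i ∘ sym)) (sym (↦-same s k))) ,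
        Setoid.trans (V j) (Setoid.reflexive (V j) (↦-same s k))
          (Setoid.trans (V j) e (Setoid.reflexive (V j) (sym (↦-other s k (k≢i′ ∘ sym))))) }
    ; D-join   = λ { {i} {i′} {k} k≢i k≢i′ (rel {j} p) d d′ → Setoid.trans (V j) (p i (k≢i ∘ sym))
        (Setoid.trans (V j) d (Setoid.trans (V j) d′ (Setoid.sym (V j) (p i′ (k≢i′ ∘ sym))))) }
    ; D-unique = λ { {i} {i′} i≢i′ (rel {j} {s} {t} p) d d′ → rel (λ x → unique {i} {i′} {j} {s} {t} i≢i′ p d d′ x em) }
    }
    where
    swap : ∀ {i i′ j} {s t u : Seq j} → Off i s t → Off i′ t u →
           ∀ x → x ≢ i → Dec (x ≡ i′) → Setoid._≈_ (V j) ((s [ i′ ↦ u i′ ]) x) (u x)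
    swap {i} {i′} {j} {s} p q x x≢i (yes refl) = Setoid.reflexive (V j) (↦-same s i′)
    swap {i} {i′} {j} {s} p q x x≢i (no x≢i′) = Setoid.trans (V j) (Setoid.reflexive (V j) (↦-other s i′ x≢i′))
      (Setoid.trans (V j) (p x x≢i) (q x x≢i′))

    unique : ∀ {i i′ j} {s t : Seq j} → i ≢ i′ → Off i s t → Setoid._≈_ (V j) (s i) (s i′) →
             Setoid._≈_ (V j) (t i) (t i′) → ∀ x → Dec (x ≡ i) → Setoid._≈_ (V j) (s x) (t x)
    unique i≢i′ p d d′ x (no x≢i) = p x x≢i
    unique {i′ = i′} {j} i≢i′ p d d′ x (yes refl) = Setoid.trans (V j) d
      (Setoid.trans (V j) (p i′ (i≢i′ ∘ sym)) (Setoid.sym (V j) d′))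

  open ComplexAlgebra cl frame public

module RCA⇒SNr (cl : Classical) {ℓ} {α : Ordinal ℓ} (o : ∣ α ∣) (m : ℕ)
               {𝔄 : RawCylindricAlgebra ∣ α ∣ ℓ ℓ} (rca : RCA α 𝔄) where

  private
    J    = proj₁ rca
    C    = proj₁ (proj₂ rca)
    A≅   = proj₂ (proj₂ (proj₂ rca))
    V : J → Setoid ℓ ℓ
    V j = CylindricSetAlgebra.base (C j)

    module 𝔄 = RawCylindricAlgebra 𝔄
    module φ = _≅_ A≅

  open Logic cl
  open SequenceFrame cl (∣ α ∣ ⊎ Fin m) V

  relation : 𝔄.Carrier → ∀ j → Pred (∣ α ∣ → Setoid.Carrier (V j)) ℓ
  relation x j = proj₁ (proj₁ (proj₁ (φ.to x) j))

  relation-invariant : ∀ x j {s t} → (∀ i → Setoid._≈_ (V j) (s i) (t i)) → relation x j s → relation x j t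
  relation-invariant x j = proj₂ (proj₁ (proj₁ (φ.to x) j))

  -- A relation on α is read on longer sequences by ignoring the last `m` entries; so a
  -- representable algebra embeds neatly into each dimension `α + m`.
  element : 𝔄.Carrier → Element
  element x = (λ (j , s) → ⌈ relation x j (s ∘ inj₁) ⌉) ,
    λ { (rel {j} p) → Bool-ext
      (λ e → ⌈⌉⁺ (relation-invariant x j (λ i → p (inj₁ i)) (⌈⌉⁻ e)))
      (λ e → ⌈⌉⁺ (relation-invariant x j (λ i → Setoid.sym (V j) (p (inj₁ i))) (⌈⌉⁻ e))) }

  module 𝔐 = RawCylindricAlgebra complex

  element-closed : ∀ x b → 𝔐.cyl (inj₂ b) (element x) 𝔐.≈ element x
  element-closed x b = ext {𝔐.cyl (inj₂ b) (element x)} {element x}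
    (λ { {j , s} c → by (cyl⁻ {inj₂ b} (element x) {j , s} c) })
    (λ { {j , s} e → cyl⁺ {inj₂ b} (element x) {j , s} (rel (λ _ _ → Setoid.refl (V j))) e })
    where
    by : ∀ {j s} → (∃ λ h → SameBase (Off (inj₂ b)) (j , s) h × h ∈ᵉ element x) → (j , s) ∈ᵉ element x
    by {j} (_ , rel p , e) = ⌈⌉⁺ (relation-invariant x j (λ i → Setoid.sym (V j) (p (inj₁ i) λ ())) (⌈⌉⁻ e))

  α≤ : α ≤ₒ α +ₒ fin m
  α≤ = ≤-+ₒ α (fin m)

  embedding : NeatEmbedding (_≤ₒ_.embed α≤) (_≤ₒ_.Outside α≤) 𝔄 complex
  embedding = record
    { to         = element
    ; to-fixed   = λ
        { x (inj₁ a) out → contradiction refl (out a) ; x (inj₂ b) _ → element-closed x b }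
    ; to-cong    = λ x≈y (j , s) → Bool-ext (λ e → ⌈⌉⁺ (proj₁ (φ.to-cong x≈y j) (⌈⌉⁻ e)))
                                            (λ e → ⌈⌉⁺ (proj₂ (φ.to-cong x≈y j) (⌈⌉⁻ e)))
    ; injective  = λ {x} {y} e → φ.injective λ j →
        -- The added entries are immaterial, and `s o` is a point of the base that is at hand.
        (λ {s} p → ⌈⌉⁻ (trans (sym (e (j , [ s , const (s o) ]′))) (⌈⌉⁺ p))) ,
        (λ {s} p → ⌈⌉⁻ (trans (e (j , [ s , const (s o) ]′)) (⌈⌉⁺ p)))
    ; ∨-homo     = λ x y (j , s) → Bool-ext
        (λ e → ∨⁺ ([ inj₁ ∘ ⌈⌉⁺ , inj₂ ∘ ⌈⌉⁺ ]′ (proj₁ (φ.∨-homo x y j) (⌈⌉⁻ e))))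
        (λ e → ⌈⌉⁺ (proj₂ (φ.∨-homo x y j) ([ inj₁ ∘ ⌈⌉⁻ , inj₂ ∘ ⌈⌉⁻ ]′ (∨⁻ e))))
    ; ∧-homo     = λ x y (j , s) → Bool-ext
        (λ e → let p , q = proj₁ (φ.∧-homo x y j) (⌈⌉⁻ e) in ∧⁺ (⌈⌉⁺ p) (⌈⌉⁺ q))
        (λ e → let p , q = ∧⁻ e in ⌈⌉⁺ (proj₂ (φ.∧-homo x y j) (⌈⌉⁻ p , ⌈⌉⁻ q)))
    ; neg-homo   = λ x (j , s) → Bool-ext
        (λ e → not⁺ (λ p → proj₁ (φ.neg-homo x j) (⌈⌉⁻ e) (⌈⌉⁻ p)))
        (λ e → ⌈⌉⁺ (proj₂ (φ.neg-homo x j) (λ p → not⁻ e (⌈⌉⁺ p))))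
    ; ⊤-homo     = λ (j , s) → Bool-ext (λ _ → refl) (λ _ → ⌈⌉⁺ (proj₂ (φ.⊤-homo j) _))
    ; ⊥-homo     = λ (j , s) → Bool-ext (λ e → case proj₁ (φ.⊥-homo j) (⌈⌉⁻ e) of λ ()) (λ ())
    ; cyl-homo   = λ i x (j , s) → Bool-ext
        (λ e → cyl-to i x j s (proj₁ (φ.cyl-homo i x j) (⌈⌉⁻ e)))
        (λ e → ⌈⌉⁺ (proj₂ (φ.cyl-homo i x j) (cyl-from i x (cyl⁻ {inj₁ i} (element x) {j , s} e))))
    ; diag-homo  = λ i i′ (j , s) → Bool-ext
        (λ e → ⌈⌉⁺ (proj₁ (φ.diag-homo i i′ j) (⌈⌉⁻ e)))
        (λ e → ⌈⌉⁺ (proj₂ (φ.diag-homo i i′ j) (⌈⌉⁻ e)))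
    }
    where
    cyl-to : ∀ i x j s → (∃ λ t → relation x j t × (∀ i′ → i′ ≢ i → Setoid._≈_ (V j) (t i′) (s (inj₁ i′)))) →
             (j , s) ∈ᵉ 𝔐.cyl (inj₁ i) (element x)
    cyl-to i x j s (t , p , t≈s) = cyl⁺ {inj₁ i} (element x) {j , s} {j , [ t , s ∘ inj₂ ]′}
      (rel λ { (inj₁ i′) i′≢i → Setoid.sym (V j) (t≈s i′ (λ { refl → i′≢i refl }))
             ; (inj₂ _) _ → Setoid.refl (V j) })
      (⌈⌉⁺ p)

    cyl-from : ∀ i x {j s} → (∃ λ h → SameBase (Off (inj₁ i)) (j , s) h × h ∈ᵉ element x) →
               ∃ λ t → relation x j t × (∀ i′ → i′ ≢ i → Setoid._≈_ (V j) (t i′) (s (inj₁ i′)))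
    cyl-from i x {j} (_ , rel {t = t} p , e) = t ∘ inj₁ , ⌈⌉⁻ e ,
      λ i′ i′≢i → Setoid.sym (V j) (p (inj₁ i′) (i′≢i ∘ inj₁-injective))

  RCA⇒SNrCA : S (NrCA {α = α} {β = α +ₒ fin m} α≤) 𝔄
  RCA⇒SNrCA = S-embedding {α = α} {β = α +ₒ fin m} α≤ {𝔅 = complex} isCylindricAlgebra {𝔄 = 𝔄} embedding

-- The Boolean law by which different elements have a non-zero symmetric difference.
Separated : ∀ {ℓ} {I : Set ℓ} → RawCylindricAlgebra I ℓ ℓ → Set ℓ
Separated 𝔅 = ∀ x y → (x ∧ - y) ∨ (y ∧ - x) ≈ ⊥ → x ≈ y
  where open RawCylindricAlgebra 𝔅

module UltraproductRCA (cl : Classical) {ℓ : Level} (α : Ordinal ℓ) (𝔅 : ℕ → RawCylindricAlgebra ∣ α ∣ ℓ ℓ)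
  (F : Pred (Pred ℕ ℓ) ℓ) (uf : IsUltrafilter F) (cofinite : ∀ B → F (λ r → Lift ℓ (B ℕ.≤ r)))
  (≈-isEquivalence : ∀ r → IsEquivalence (RawCylindricAlgebra._≈_ (𝔅 r)))
  (separated : ∀ r → Separated (𝔅 r)) where

  open Logic cl
  open Approximation cl
  open Representation cl 𝔅 F uf cofinite

  module _ (bound : List ∣ α ∣ → List Pt → ℕ)
    (model : ∀ r Γ₀ L a → bound Γ₀ L ℕ.≤ r → ¬ RawCylindricAlgebra._≈_ (𝔅 r) a (RawCylindricAlgebra.⊥ (𝔅 r)) →
             ApproximateModel (𝔅 r) (eval r) Γ₀ L a) where

    private

      J : Set ℓ
      J = Σ E λ a → ¬ a 𝔘.≈ 𝔘.⊥

      module S (j : J) = Separation bound model (proj₁ j) (proj₂ j)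

      open FullSetAlgebras ∣ α ∣ S.points

      ≈-sym : ∀ {X Y} → X 𝔘.≈ Y → Y 𝔘.≈ X
      ≈-sym = F.upward λ {r} → IsEquivalence.sym (≈-isEquivalence r)

      -- The component that belongs to the symmetric difference of `X` and `Y` satisfies it at
      -- `base`, hence tells them apart.
      injective : ∀ {X Y} → (∀ j {s} → S.h j X s → S.h j Y s) → (∀ j {s} → S.h j Y s → S.h j X s) → X 𝔘.≈ Y
      injective {X} {Y} p q = dne λ X≉Y →
        let a = (X 𝔘.∧ 𝔘.- Y) 𝔘.∨ (Y 𝔘.∧ 𝔘.- X)
            j = a , λ a≈⊥ → X≉Y (F.upward (λ {r} → separated r (X r) (Y r)) a≈⊥)
            differ = λ {X} {Y} (p : ∀ {s} → S.h j X s → S.h j Y s) (x : S.h j (X 𝔘.∧ 𝔘.- Y) base) →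
              let x₁ , x₂ = proj₁ (S.h-∧ j X (𝔘.- Y)) x in proj₁ (S.h-neg j Y) x₂ (p x₁)
        in [ differ {X} {Y} (p j) , differ {Y} {X} (q j) ]′ (proj₁ (S.h-∨ j _ _) (S.h-nonempty j))

      embedding : Embedding 𝔘 product
      embedding = record
        { to-fixed   = λ _ _ ()
        ; to         = λ X j → (S.h j X , λ {s} {t} → S.h-invariant j X {s} {t}) , _
        ; to-cong    = λ {X} {Y} X≈Y j → S.h-cong j X≈Y , S.h-cong j (≈-sym {X} {Y} X≈Y)
        ; injective  = λ {X} {Y} e → injective {X} {Y} (λ j → proj₁ (e j)) (λ j → proj₂ (e j))
        ; ∨-homo     = λ X Y j → S.h-∨ j X Y
        ; ∧-homo     = λ X Y j → S.h-∧ j X Y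
        ; neg-homo   = λ X j → S.h-neg j X
        ; ⊤-homo     = λ j → (λ _ → _) , λ _ → S.h-⊤ j _
        ; ⊥-homo     = λ j → (λ x → contradiction x (S.h-⊥ j _)) , λ ()
        ; cyl-homo   = λ i X j → S.h-cyl j i X
        ; diag-homo  = λ i i′ j → S.h-diag j i i′
        }

    ultraproduct∈RCA : RCA α 𝔘
    ultraproduct∈RCA = J , full , image , ≅-image
      where open Image {p = suc ℓ} congruence embedding

-- Non-principal ultrafilters and the failure of finite schemes

module NonPrincipal (cl : Classical) {ℓ : Level} where

  open Logic cl

  -- By induction: a singleton in `F` would make `F` principal, so one more number can always be
  -- removed.
  cofinite : ∀ {F : Pred (Pred ℕ ℓ) ℓ} → IsUltrafilter F → ¬ Principal F → ∀ B → F (λ r → Lift ℓ (B ℕ.≤ r))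
  cofinite {F} uf np ℕ.zero    = IsUltrafilter.upward uf (λ _ → lift z≤n) (IsUltrafilter.whole uf)
  cofinite {F} uf np (ℕ.suc B) = upward (λ (lift B≤r , r≢B) → lift (ℕ.≤∧≢⇒< B≤r λ { refl → r≢B (lift refl) }))
    (meet (cofinite uf np B) (complement singleton∉F))
    where
    open IsUltrafilter uf
    open UltrafilterProperties uf
    singleton∉F : ¬ F (λ r → Lift ℓ (r ≡ B))
    singleton∉F FB = np (B , λ X → mk⇔
      (λ FX → case inhabited cl (meet FX FB) of λ { (_ , x , lift refl) → x })
      (λ XB → upward (λ { (lift refl) → XB }) FB))

  -- Any ultrafilter above the filter of final segments; the segment beyond `j` refutes that it is
  -- principal at `j`.
  nonprincipal : ∃ λ (F : Pred (Pred ℕ ℓ) ℓ) → IsUltrafilter F × ¬ Principal F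
  nonprincipal = (λ X → G (X ∘ lower)) , record
    { upward = λ X⊆Y → G.upward X⊆Y ; meet = G.meet ; whole = G.whole ; proper = G.proper
    ; ultra = λ X → G.ultra (X ∘ lower) } ,
    λ (j , h) → ℕ.<-irrefl refl (lower (Equivalence.to (h (λ r → Lift ℓ (j ℕ.< r)))
      (proj₂ (proj₂ extension) (ℕ.suc j , λ r j<r → lift j<r))))
    where
    extension = Ultrafilters.extend cl (Lift ℓ ℕ) (λ X → ∃ λ B → ∀ r → B ℕ.≤ r → X (lift r))
      (λ X⊆Y (B , h) → B , λ r B≤r → X⊆Y (h r B≤r))
      (λ (B , h) (C , h′) → B ℕ.+ C , λ r le → h r (ℕ.m+n≤o⇒m≤o B le) , h′ r (ℕ.m+n≤o⇒n≤o B le))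
      (0 , λ _ _ → _)
      (λ (B , h) → lift B , h B ℕ.≤-refl)
    G = proj₁ extension
    module G = IsUltrafilter (proj₁ (proj₂ extension))

module Łoś {ℓ : Level} {I : Set ℓ} (𝔅 : ℕ → RawCylindricAlgebra I ℓ ℓ)
           (F : Pred (Pred ℕ ℓ) ℓ) (uf : IsUltrafilter F) where

  private
    𝔘 = ultraproduct 𝔅 F
    module 𝔅 r = RawCylindricAlgebra (𝔅 r)

  coordinate : ∀ t v r → ⟦_⟧ 𝔘 t v r ≡ ⟦_⟧ (𝔅 r) t (λ n → v n r)
  coordinate (var n)     v r = refl
  coordinate (s ∨′ t)    v r = cong₂ (𝔅._∨_ r) (coordinate s v r) (coordinate t v r)
  coordinate (s ∧′ t)    v r = cong₂ (𝔅._∧_ r) (coordinate s v r) (coordinate t v r)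
  coordinate (-′ t)      v r = cong (𝔅.-_ r) (coordinate t v r)
  coordinate ⊤′          v r = refl
  coordinate ⊥′          v r = refl
  coordinate (cyl′ i t)  v r = cong (𝔅.cyl r i) (coordinate t v r)
  coordinate (diag′ i j) v r = refl

  transfer : ∀ s t → 𝔘 ⊨ (s , t) → (v : ∀ r → ℕ → 𝔅.Carrier r) →
             F (λ r → 𝔅._≈_ r (⟦_⟧ (𝔅 r) s (v r)) (⟦_⟧ (𝔅 r) t (v r)))
  transfer s t 𝔘⊨ v = IsUltrafilter.upward uf
    (λ {r} → subst₂ (𝔅._≈_ r) (coordinate s v′ r) (coordinate t v′ r)) (𝔘⊨ v′)
    where
    v′ : ℕ → ∀ r → 𝔅.Carrier r
    v′ n r = v r n

module _ {ℓ : Level} {I : Set ℓ} where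

  reduct-term : ∀ (σ : I → I) (𝔅 : RawCylindricAlgebra I ℓ ℓ) t v →
                ⟦_⟧ (reduct σ 𝔅) t v ≡ ⟦_⟧ 𝔅 (mapIndices σ t) v
  reduct-term σ 𝔅 (var n)     v = refl
  reduct-term σ 𝔅 (s ∨′ t)    v = cong₂ (RawCylindricAlgebra._∨_ 𝔅) (reduct-term σ 𝔅 s v) (reduct-term σ 𝔅 t v)
  reduct-term σ 𝔅 (s ∧′ t)    v = cong₂ (RawCylindricAlgebra._∧_ 𝔅) (reduct-term σ 𝔅 s v) (reduct-term σ 𝔅 t v)
  reduct-term σ 𝔅 (-′ t)      v = cong (RawCylindricAlgebra.-_ 𝔅) (reduct-term σ 𝔅 t v)
  reduct-term σ 𝔅 ⊤′          v = refl
  reduct-term σ 𝔅 ⊥′          v = refl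
  reduct-term σ 𝔅 (cyl′ i t)  v = cong (RawCylindricAlgebra.cyl 𝔅 (σ i)) (reduct-term σ 𝔅 t v)
  reduct-term σ 𝔅 (diag′ i j) v = refl

  mapIndices-∘ : ∀ {h} {H : Set h} (σ : I → I) (ρ ρ′ : H → I) t → (∀ {m} → m ∈ indices t → σ (ρ m) ≡ ρ′ m) →
                 mapIndices σ (mapIndices ρ t) ≡ mapIndices ρ′ t
  mapIndices-∘ σ ρ ρ′ (var n)     h = refl
  mapIndices-∘ σ ρ ρ′ (s ∨′ t)    h = cong₂ _∨′_ (mapIndices-∘ σ ρ ρ′ s (h ∘ ∈-++⁺ˡ)) (mapIndices-∘ σ ρ ρ′ t (h ∘ ∈-++⁺ʳ (indices s)))
  mapIndices-∘ σ ρ ρ′ (s ∧′ t)    h = cong₂ _∧′_ (mapIndices-∘ σ ρ ρ′ s (h ∘ ∈-++⁺ˡ)) (mapIndices-∘ σ ρ ρ′ t (h ∘ ∈-++⁺ʳ (indices s)))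
  mapIndices-∘ σ ρ ρ′ (-′ t)      h = cong -′_ (mapIndices-∘ σ ρ ρ′ t h)
  mapIndices-∘ σ ρ ρ′ ⊤′          h = refl
  mapIndices-∘ σ ρ ρ′ ⊥′          h = refl
  mapIndices-∘ σ ρ ρ′ (cyl′ i t)  h = cong₂ cyl′ (h (here refl)) (mapIndices-∘ σ ρ ρ′ t (h ∘ there))
  mapIndices-∘ σ ρ ρ′ (diag′ i j) h = cong₂ diag′ (h (here refl)) (h (there (here refl)))

module ExtendInjection (cl : Classical) {a h} {A : Set a} {H : Set h} where

  open Logic cl

  InjectiveOn : List H → (H → A) → Set (a ⊔ h)
  InjectiveOn L ρ = ∀ {m n} → m ∈ L → n ∈ L → ρ m ≡ ρ n → m ≡ n

  swap : A → A → A → A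
  swap x y z with em {P = z ≡ x} | em {P = z ≡ y}
  ... | yes _ | _     = y
  ... | no _  | yes _ = x
  ... | no _  | no _  = z

  swap-x : ∀ x y → swap x y x ≡ y
  swap-x x y with em {P = x ≡ x}
  ... | yes _  = refl
  ... | no x≢x = contradiction refl x≢x

  swap-other : ∀ {x y z} → z ≢ x → z ≢ y → swap x y z ≡ z
  swap-other {x} {y} {z} z≢x z≢y with em {P = z ≡ x} | em {P = z ≡ y}
  ... | yes p | _     = contradiction p z≢x
  ... | no _  | yes q = contradiction q z≢y
  ... | no _  | no _  = refl

  swap-involutive : ∀ x y z → swap x y (swap x y z) ≡ z
  swap-involutive x y z with em {P = z ≡ x} | em {P = z ≡ y}
  ... | no z≢x   | no z≢y   = swap-other z≢x z≢y
  ... | no z≢x   | yes refl = swap-x x y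
  ... | yes refl | _        = swap-y em
    where
    swap-y : Dec (y ≡ x) → swap x y y ≡ x
    swap-y (yes refl) = swap-x x x
    swap-y (no y≢x) with em {P = y ≡ x} | em {P = y ≡ y}
    ... | yes p | _      = contradiction p y≢x
    ... | no _  | yes _  = refl
    ... | no _  | no y≢y = contradiction refl y≢y

  swap-injective : ∀ x y {z z′} → swap x y z ≡ swap x y z′ → z ≡ z′
  swap-injective x y {z} {z′} e = trans (sym (swap-involutive x y z)) (trans (cong (swap x y) e) (swap-involutive x y z′))

  -- `σ` is a product of transpositions, one for each index in `L`. Injectivity of `ρ` and `ρ′`
  -- ensures that a transposition leaves the values settled before it alone.
  extend-injection : ∀ L {ρ ρ′ : H → A} → InjectiveOn L ρ → InjectiveOn L ρ′ →
    ∃ λ (σ : A → A) → (∀ {x y} → σ x ≡ σ y → x ≡ y) × (∀ {m} → m ∈ L → σ (ρ m) ≡ ρ′ m)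
  extend-injection []      _ _ = id , id , λ ()
  extend-injection (m ∷ L) {ρ} {ρ′} inj inj′
    with extend-injection L {ρ} {ρ′} (λ p q → inj (there p) (there q)) (λ p q → inj′ (there p) (there q))
  ... | σ , σ-inj , σρ≡ = swap x y ∘ σ , σ-inj ∘ swap-injective x y , λ
    { (here refl) → swap-x x y ; (there n∈) → by n∈ em }
    where
    x = σ (ρ m)
    y = ρ′ m

    by : ∀ {n} → n ∈ L → Dec (n ≡ m) → swap x y (σ (ρ n)) ≡ ρ′ n
    by n∈ (yes refl) = swap-x x y
    by {n} n∈ (no n≢m) = trans (swap-other
      (λ e → n≢m (inj (there n∈) (here refl) (σ-inj e)))
      (λ e → n≢m (inj′ (there n∈) (here refl) (trans (sym (σρ≡ n∈)) e)))) (σρ≡ n∈)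

module NotAxiomatizable (cl : Classical) {ℓ : Level} (α : Ordinal ℓ) (o : ∣ α ∣) (k : ℕ)
  (𝔄 : ℕ → RawCylindricAlgebra ∣ α ∣ ℓ ℓ)
  (𝔄∈𝔎 : ∀ r → S (NrCA (≤-+ₒ α (fin k))) (𝔄 r))
  (𝔄∉𝔏 : ∀ r → ¬ S (NrCA (≤-+ₒ α (fin (k + 1)))) (𝔄 r))
  (F : Pred (Pred ℕ ℓ) ℓ) (uf : IsUltrafilter F)
  (representable : ∀ (σ : ℕ → ∣ α ∣ → ∣ α ∣) → (∀ r {x y} → σ r x ≡ σ r y → x ≡ y) →
                   RCA α (ultraproduct (λ r → reduct (σ r) (𝔄 r)) F)) where

  open Logic cl
  open IsUltrafilter uf
  open UltrafilterProperties uf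
  open ExtendInjection cl

  𝔏 : Class ∣ α ∣ (suc ℓ)
  𝔏 = S (NrCA (≤-+ₒ α (fin (k + 1))))

  𝔎 : Class ∣ α ∣ (suc ℓ)
  𝔎 = S (NrCA (≤-+ₒ α (fin k)))

  -- Representable algebras embed neatly into all higher dimensions, so these ultraproducts satisfy
  -- every proposed axiom.
  twisted∈𝔏 : ∀ (σ : ℕ → ∣ α ∣ → ∣ α ∣) → (∀ r {x y} → σ r x ≡ σ r y → x ≡ y) →
              𝔏 (ultraproduct (λ r → reduct (σ r) (𝔄 r)) F)
  twisted∈𝔏 σ σ-inj = RCA⇒SNr.RCA⇒SNrCA cl {α = α} o (k + 1) (representable σ σ-inj)

  -- The instance that fails in 𝔄 r depends on r; renaming the dimensions by a
  -- suitable injection for each r turns all of these into one instance.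
  module _ (s t : Term ℕ) (valid : ∀ (σ : ℕ → ∣ α ∣ → ∣ α ∣) → (∀ r {x y} → σ r x ≡ σ r y → x ≡ y) →
                                   ultraproduct (λ r → reduct (σ r) (𝔄 r)) F ⊨ˢ (s , t)) where

    private
      module 𝔄 r = RawCylindricAlgebra (𝔄 r)

      Failure : ∀ r → (ℕ → ∣ α ∣) → Set ℓ
      Failure r ρ = ∃ λ v → ¬ 𝔄._≈_ r (⟦_⟧ (𝔄 r) (mapIndices ρ s) v) (⟦_⟧ (𝔄 r) (mapIndices ρ t) v)

      Fails : ℕ → Set ℓ
      Fails r = ∃ λ ρ → InjectiveOn (indices s ++ indices t) ρ × Failure r ρ

      fails : ∀ {r} → ¬ 𝔄 r ⊨ˢ (s , t) → Fails r
      fails {r} ¬valid = dne λ none → ¬valid λ ρ inj v → dne λ ≉ → none (ρ , (λ {m} {n} → inj {m} {n}) , v , ≉)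

      module Common (ρ : ℕ → ∣ α ∣) (inj : InjectiveOn (indices s ++ indices t) ρ) where

        record Twist (r : ℕ) : Set ℓ where
          field
            σ      : ∣ α ∣ → ∣ α ∣
            σ-inj  : ∀ {x y} → σ x ≡ σ y → x ≡ y
            v      : ℕ → 𝔄.Carrier r
            wrong  : Fails r → ¬ 𝔄._≈_ r (⟦_⟧ (reduct σ (𝔄 r)) (mapIndices ρ s) v)
                                        (⟦_⟧ (reduct σ (𝔄 r)) (mapIndices ρ t) v)

        twist : ∀ r → Twist r
        twist r = by em
          where
          by : Dec (Fails r) → Twist r
          by (no ¬f) = record { σ = id ; σ-inj = id ; v = λ _ → 𝔄.⊤ r ; wrong = λ f → contradiction f ¬f }
          by (yes (ρ′ , inj′ , v , ≉)) with extend-injection (indices s ++ indices t) {ρ} {ρ′} inj inj′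
          ... | σ , σ-inj , σρ≡ = record { σ = σ ; σ-inj = σ-inj ; v = v ; wrong = λ _ e → ≉
            (subst₂ (𝔄._≈_ r) (term s (σρ≡ ∘ ∈-++⁺ˡ)) (term t (σρ≡ ∘ ∈-++⁺ʳ (indices s))) e) }
            where
            term : ∀ u → (∀ {m} → m ∈ indices u → σ (ρ m) ≡ ρ′ m) →
                   ⟦_⟧ (reduct σ (𝔄 r)) (mapIndices ρ u) v ≡ ⟦_⟧ (𝔄 r) (mapIndices ρ′ u) v
            term u h = trans (reduct-term σ (𝔄 r) (mapIndices ρ u) v)
              (cong (λ u′ → ⟦_⟧ (𝔄 r) u′ v) (mapIndices-∘ σ ρ ρ′ u h))

        σ : ℕ → ∣ α ∣ → ∣ α ∣
        σ r = Twist.σ (twist r)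

        impossible : ¬ F Fails
        impossible failing =
          let r , e , f = inhabited cl (meet
                (Łoś.transfer (λ r → reduct (σ r) (𝔄 r)) F uf (mapIndices ρ s) (mapIndices ρ t)
                  (valid σ (λ r → Twist.σ-inj (twist r)) ρ inj) (λ r → Twist.v (twist r)))
                failing)
          in Twist.wrong (twist r) f e

    mostly-valid : F (λ r → 𝔄 r ⊨ˢ (s , t))
    mostly-valid = dne λ ¬valid →
      let failing = upward fails (complement ¬valid)
          -- Any one failing instance supplies the injection `ρ` to which the instances for all
          -- other `r` are renamed.
          _ , ρ , inj , _ = inhabited cl failing
      in Common.impossible ρ inj failing

  mostly-valid-equation : ∀ s t → ultraproduct 𝔄 F ⊨ (s , t) → F (λ r → 𝔄 r ⊨ (s , t))
  mostly-valid-equation s t valid = dne λ ¬valid →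
    let r , e , f = inhabited cl (meet (Łoś.transfer 𝔄 F uf s t valid v) (complement ¬valid)) in wrong r f e
    where
    module 𝔄 r = RawCylindricAlgebra (𝔄 r)

    Wrong : ∀ r → (ℕ → 𝔄.Carrier r) → Set ℓ
    Wrong r v = ¬ 𝔄._≈_ r (⟦_⟧ (𝔄 r) s v) (⟦_⟧ (𝔄 r) t v)

    valuation : ∀ r → ∃ λ v → ¬ 𝔄 r ⊨ (s , t) → Wrong r v
    valuation r = by em
      where
      by : Dec (∃ (Wrong r)) → ∃ λ v → ¬ 𝔄 r ⊨ (s , t) → Wrong r v
      by (yes (v , w)) = v , λ _ → w
      by (no none)     = (λ _ → 𝔄.⊤ r) , λ ¬valid → contradiction (λ v → dne λ w → none (v , w)) ¬valid

    v : ∀ r → ℕ → 𝔄.Carrier r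
    v r = proj₁ (valuation r)

    wrong : ∀ r → ¬ 𝔄 r ⊨ (s , t) → Wrong r (v r)
    wrong r = proj₂ (valuation r)

  simultaneously : ∀ {e} {X : Set e} (P : ℕ → X → Set ℓ) xs → (∀ {x} → x ∈ xs → F (λ r → P r x)) →
                   ∃ λ (Y : Pred ℕ ℓ) → F Y × (∀ r → Y r → All (P r) xs)
  simultaneously P []       h = _ , whole , λ _ _ → []
  simultaneously P (x ∷ xs) h = let Y , FY , f = simultaneously P xs (h ∘ there) in
    _ , meet (h (here refl)) FY , λ r (p , y) → p ∷ f r y

  not-all-valid : ∀ {e} {X : Set e} (P : ℕ → X → Set ℓ) xs → (∀ {x} → x ∈ xs → F (λ r → P r x)) →
                  (∀ r → All (P r) xs → 𝔏 (𝔄 r)) → ⊥₀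
  not-all-valid P xs h axioms =
    let _ , FY , f = simultaneously P xs h ; r , y = inhabited cl FY in 𝔄∉𝔏 r (axioms r (f r y))

  not-axiomatizable : ¬ FiniteSchemaAxiomatizable α 𝔏 𝔎
  not-axiomatizable (inj₁ (_ , E , axioms)) = not-all-valid (λ r → 𝔄 r ⊨_) E
    (λ {(s , t)} ε∈ → mostly-valid-equation s t
      (All.lookup (proj₂ (Equivalence.to (axioms (ultraproduct 𝔄 F)) (twisted∈𝔏 (λ _ → id) (λ _ → id)))) ε∈))
    (λ r valid → Equivalence.from (axioms (𝔄 r)) (𝔄∈𝔎 r , valid))
  not-axiomatizable (inj₂ (_ , E , axioms)) = not-all-valid (λ r → 𝔄 r ⊨ˢ_) E
    (λ {(s , t)} ε∈ → mostly-valid s t λ σ σ-inj → All.lookup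
      (proj₂ (Equivalence.to (axioms (ultraproduct (λ r → reduct (σ r) (𝔄 r)) F)) (twisted∈𝔏 σ σ-inj))) ε∈)
    (λ r valid → Equivalence.from (axioms (𝔄 r)) (𝔄∈𝔎 r , valid))

untwist : ∀ {ℓ} (α : Ordinal ℓ) (𝔄 : ℕ → RawCylindricAlgebra ∣ α ∣ ℓ ℓ) (F : Pred (Pred ℕ ℓ) ℓ) →
          RCA α (ultraproduct (λ r → reduct id (𝔄 r)) F) → RCA α (ultraproduct 𝔄 F)
untwist α 𝔄 F rca = rca

module Main (cl : Classical) {ℓ : Level} (α : Ordinal ℓ) (2<α : fin 2 <ₒ α) (k : ℕ) (1≤k : 1 ℕ.≤ k) where

  open Logic cl
  open _≤ₒ_ (proj₁ 2<α) using (embed; monotone)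

  os : Triple ∣ α ∣
  os = record
    { o₀    = embed Fin.zero
    ; o₁    = embed (Fin.suc Fin.zero)
    ; o₂    = proj₁ (proj₂ 2<α)
    ; o₀≢o₁ = λ e → IsStrictTotalOrder.irrefl (Ordinal.isStrictTotalOrder α) e
        (monotone {Fin.zero} {Fin.suc Fin.zero} (s≤s z≤n))
    ; o₀≢o₂ = proj₂ (proj₂ 2<α) Fin.zero
    ; o₁≢o₂ = proj₂ (proj₂ 2<α) (Fin.suc Fin.zero)
    }

  spare : Fin k
  spare = Fin.fromℕ< 1≤k

  -- One less than `sorts`, so that the form `suc (ψ r)` of the number of sorts shows that there is
  -- a sort.
  ψ : ℕ → ℕ
  ψ r = need (ℕ.suc (measure initial))
    where open Measure (ℕ.suc (k + 1)) r

  𝔄 : ℕ → RawCylindricAlgebra ∣ α ∣ ℓ ℓ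
  𝔄 r = NeatReduct.𝔄 cl α os k r (ℕ.suc (ψ r))

  𝔄∈NrCA : ∀ r → NrCA (≤-+ₒ α (fin k)) (𝔄 r)
  𝔄∈NrCA r = NeatReduct.𝔄∈NrCA cl α os k r (ℕ.suc (ψ r))

  𝔄∉SNrCA : ∀ r → ¬ S (NrCA (≤-+ₒ α (fin (k + 1)))) (𝔄 r)
  𝔄∉SNrCA r = NonEmbedding.𝔄∉SNrCA cl α os k r (ψ r) refl

  𝔄-isEquivalence : ∀ r → IsEquivalence (RawCylindricAlgebra._≈_ (𝔄 r))
  𝔄-isEquivalence r = record
    { refl = λ _ → refl ; sym = λ p g → sym (p g) ; trans = λ p q g → trans (p g) (q g) }

  𝔄-separated : ∀ r → Separated (𝔄 r)
  𝔄-separated r x y e g = by (proj₁ (proj₁ x) g) (proj₁ (proj₁ y) g) (e g)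
    where
    by : ∀ b c → (b 𝔹.∧ 𝔹.not c) 𝔹.∨ (c 𝔹.∧ 𝔹.not b) ≡ false → b ≡ c
    by false false _ = refl
    by true  true  _ = refl

  representable : ∀ (σ : ℕ → ∣ α ∣ → ∣ α ∣) → (∀ r {x y} → σ r x ≡ σ r y → x ≡ y) →
    ∀ (F : Pred (Pred ℕ ℓ) ℓ) → IsUltrafilter F → ¬ Principal F →
    RCA α (ultraproduct (λ r → reduct (σ r) (𝔄 r)) F)
  representable σ σ-inj F uf np = UltraproductRCA.ultraproduct∈RCA cl α (λ r → reduct (σ r) (𝔄 r)) F uf
    (NonPrincipal.cofinite cl uf np) 𝔄-isEquivalence 𝔄-separated Bound.bound
    (λ r Γ₀ L → Witnesses.Expansion.approximate-model cl α os k r (ℕ.suc (ψ r)) spare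
      (∀ r → RawCylindricAlgebra.Carrier (𝔄 r)) Γ₀ (σ r) (σ-inj r) (λ X → X r) L)

  𝔄∈SNrCA : ∀ r → S (NrCA (≤-+ₒ α (fin k))) (𝔄 r)
  𝔄∈SNrCA r = NrCA⊆S (≤-+ₒ α (fin k)) {𝔄 r} (𝔄-isEquivalence r) (𝔄∈NrCA r)

open import Data.Nat using (_≤_)

theorem9p8 : Classical →
    ∀ {ℓ : Level} (α : Ordinal ℓ) → fin 2 <ₒ α →
    (k : ℕ) → 1 ≤ k →
    (Σ (ℕ → RawCylindricAlgebra ∣ α ∣ ℓ ℓ) λ 𝔄 →
    (∀ r → NrCA (≤-+ₒ α (fin k)) (𝔄 r) × ¬ S (NrCA (≤-+ₒ α (fin (k + 1)))) (𝔄 r)) ×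
    (∀ (F : Pred (Pred ℕ ℓ) ℓ) → IsUltrafilter F → ¬ Principal F →
    RCA α (ultraproduct 𝔄 F)))
    × ¬ FiniteSchemaAxiomatizable α
    (S (NrCA (≤-+ₒ α (fin (k + 1)))))
    (S (NrCA (≤-+ₒ α (fin k))))
theorem9p8 cl α 2<α k 1≤k =
  (𝔄 , (λ r → 𝔄∈NrCA r , 𝔄∉SNrCA r) , λ F uf np → untwist α 𝔄 F (representable (λ _ → id) (λ _ → id) F uf np)) ,
  let F , uf , np = NonPrincipal.nonprincipal cl in
  NotAxiomatizable.not-axiomatizable cl α (Triple.o₀ os) k 𝔄 𝔄∈SNrCA 𝔄∉SNrCA F uf (λ σ σ-inj → representable σ σ-inj F uf np)
  where open Main cl α 2<α k 1≤k
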